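{- There is a randomized distributed algorithm such that for any unweighted graph $G=(V,E)$ on $n$ vertices, and parameters $1\le k\le \ln n$ and $c>3$, the algorithm computes, with probability at least $1-3/c$, a strong $\left(2k-2,\ (cn)^{1/k}\cdot\ln (cn)\right)$ network decomposition of $G$. The number of rounds required is $k(cn)^{1/k}\cdot\ln (cn)$, and each message consists of $O(1)$ words.
   Context: Network decomposition: $G=(V,E)$ is an unweighted undirected graph on $n$ vertices. Let $\mathcal{P}$ be a partition of $V$ into disjoint clusters. The supergraph $\mathcal{G}(\mathcal{P})$ has the clusters as vertices, and two distinct clusters $C\neq C'$ are adjacent iff some edge of $G$ joins a vertex of $C$ to a vertex of $C'$. The strong diameter of a cluster $C$ is $\max_{v,v'\in C} d_{G(C)}(v,v')$, where $G(C)$ is the subgraph of $G$ induced by $C$ and $d_{G(C)}$ is its distance function. $\mathcal{P}$ is a strong $(D,\chi)$ network decomposition of $G$ if every cluster has strong diameter at most $D$ and $\mathcal{G}(\mathcal{P})$ can be properly colored with at most $\chi$ colors (adjacent clusters receive different colors). Model: $G$ models a communication network. Each vertex of $G$ hosts a processor with a distinct identity number from $\{1,\dots,n\}$, and the processors communicate with one another via the edges of $G$ in synchronous rounds. The running time of an algorithm is the number of rounds of distributed communication. Messages of $O(1)$ words have $O(\log n)$ bits, as in the CONGEST model. -}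

module Defs where

open import Data.Bool.Base using (Bool)
open import Data.Empty using (⊥-elim)
open import Data.Fin.Base using (Fin; finToFun)
open import Data.Fin.Subset using (Subset; _∈_; ∣_∣)
open import Data.Integer.Base as ℤ using (+_)
import Data.Integer.Properties as ℤP
open import Data.List.Base using (List; length)
open import Data.Maybe.Base using (Maybe; nothing; just)
open import Data.Nat.Base as ℕ using (ℕ; zero; suc)
import Data.Nat.Coprimality as Coprimality
import Data.Nat.Logarithm as ℕL
import Data.Nat.Properties as ℕP
open import Data.Product using (Σ; ∃; ∃₂; _×_; _,_; proj₁; proj₂)
open import Data.Rational.Base as ℚ
  using (ℚ; 0ℚ; 1ℚ; _+_; _*_; _-_; -_; _<_; _≤_; _⊔_; _⊓_; _/_; *≤*)
import Data.Rational.Properties as ℚP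
import Data.Rational.Unnormalised.Base as ℚᵘ
import Data.Rational.Unnormalised.Properties as ℚᵘP
open import Data.Sum.Base using (_⊎_; inj₁; inj₂; [_,_]′)
open import Function.Base using (_∘_)
open import Relation.Binary.PropositionalEquality
  using (_≡_; _≢_; refl; sym; trans; cong; cong₂; subst)
open import Level using (0ℓ)
open import Relation.Nullary using (¬_; Dec; yes; no)
open import Tactic.RingSolver using (solve-∀)
open import Tactic.RingSolver.Core.AlmostCommutativeRing
  using (AlmostCommutativeRing; fromCommutativeRing)
open import Algebra.Bundles using (CommutativeRing)
open import Algebra.Properties.CommutativeSemiring.Exp
  (CommutativeRing.commutativeSemiring ℚP.+-*-commutativeRing)
  using (_^_; ^-assocʳ; ^-distrib-*)

module RationalFacts where
  ℚ-ring : AlmostCommutativeRing 0ℓ 0ℓ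
  ℚ-ring = fromCommutativeRing ℚP.+-*-commutativeRing isZero
    where
    isZero : ∀ x → Maybe (0ℚ ≡ x)
    isZero x with 0ℚ ℚP.≟ x
    ... | yes p = just p
    ... | no  _ = nothing


  eq-sub : ∀ x y → (y - x) + x ≡ y
  eq-sub = solve-∀ ℚ-ring

  <⇒0< : ∀ {x y} → x < y → 0ℚ < y - x
  <⇒0< {x} {y} x<y = subst (_< y - x) (ℚP.+-inverseʳ x) (ℚP.+-monoˡ-< (- x) x<y)

  ≤⇒0≤ : ∀ {x y} → x ≤ y → 0ℚ ≤ y - x
  ≤⇒0≤ {x} {y} x≤y = subst (_≤ y - x) (ℚP.+-inverseʳ x) (ℚP.+-monoˡ-≤ (- x) x≤y)

  by< : ∀ {x y d} → 0ℚ < d → d ≡ y - x → x < y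
  by< {x} {y} 0<d refl = subst (_< y) (ℚP.+-identityˡ x)
    (subst (0ℚ + x <_) (eq-sub x y) (ℚP.+-monoˡ-< x 0<d))

  by≤ : ∀ {x y d} → 0ℚ ≤ d → d ≡ y - x → x ≤ y
  by≤ {x} {y} 0≤d refl = subst (_≤ y) (ℚP.+-identityˡ x)
    (subst (0ℚ + x ≤_) (eq-sub x y) (ℚP.+-monoˡ-≤ x 0≤d))

  +>0 : ∀ {x y} → 0ℚ < x → 0ℚ < y → 0ℚ < x + y
  +>0 = ℚP.+-mono-<

  +>≥0 : ∀ {x y} → 0ℚ < x → 0ℚ ≤ y → 0ℚ < x + y
  +>≥0 = ℚP.+-mono-<-≤

  +≥0 : ∀ {x y} → 0ℚ ≤ x → 0ℚ ≤ y → 0ℚ ≤ x + y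
  +≥0 = ℚP.+-mono-≤

  *>0 : ∀ {x y} → 0ℚ < x → 0ℚ < y → 0ℚ < x * y
  *>0 {x} {y} 0<x 0<y = ℚP.positive⁻¹ (x * y)
    {{ℚP.pos*pos⇒pos x {{ℚ.positive 0<x}} y {{ℚ.positive 0<y}}}}

  *≥0 : ∀ {x y} → 0ℚ ≤ x → 0ℚ ≤ y → 0ℚ ≤ x * y
  *≥0 {x} {y} 0≤x 0≤y = ℚP.nonNegative⁻¹ (x * y)
    {{ℚP.nonNeg*nonNeg⇒nonNeg x {{ℚ.nonNegative 0≤x}} y {{ℚ.nonNegative 0≤y}}}}

  0<1 : 0ℚ < 1ℚ
  0<1 = ℚP.positive⁻¹ 1ℚ

  *-mono-≤ : ∀ {a b c d} → 0ℚ ≤ a → a ≤ b → 0ℚ ≤ c → c ≤ d → a * c ≤ b * d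
  *-mono-≤ {a} {b} {c} {d} 0≤a a≤b 0≤c c≤d =
    by≤ (+≥0 (*≥0 (≤⇒0≤ a≤b) (ℚP.≤-trans 0≤c c≤d)) (*≥0 0≤a (≤⇒0≤ c≤d))) (e a b c d)
    where
    e : ∀ a b c d → (b - a) * d + a * (d - c) ≡ b * d - a * c
    e = solve-∀ ℚ-ring

  *-mono-< : ∀ {a b c d} → 0ℚ ≤ a → a < b → 0ℚ < c → c ≤ d → a * c < b * d
  *-mono-< {a} {b} {c} {d} 0≤a a<b 0<c c≤d =
    by< (+>≥0 (*>0 (<⇒0< a<b) (ℚP.<-≤-trans 0<c c≤d)) (*≥0 0≤a (≤⇒0≤ c≤d))) (e a b c d)
    where
    e : ∀ a b c d → (b - a) * d + a * (d - c) ≡ b * d - a * c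
    e = solve-∀ ℚ-ring

  inverse : ∀ {x} → 0ℚ < x → ∃ λ y → 0ℚ < y × y * x ≡ 1ℚ
  inverse {x} 0<x =
      (ℚ.1/ x) {{nz}} , ℚP.positive⁻¹ _ {{ℚP.1/pos⇒pos x {{pos}}}} , ℚP.*-inverseˡ x {{nz}}
    where
    pos = ℚ.positive 0<x
    nz = ℚP.pos⇒nonZero x {{pos}}

  ⊔-lub : ∀ {x y z} → x < z → y < z → x ⊔ y < z
  ⊔-lub {x} {y} x<z y<z with ℚP.⊔-sel x y
  ... | inj₁ e = subst (_< _) (sym e) x<z
  ... | inj₂ e = subst (_< _) (sym e) y<z

  ⊓-glb : ∀ {x y z} → z < x → z < y → z < x ⊓ y
  ⊓-glb {x} {y} z<x z<y with ℚP.⊓-sel x y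
  ... | inj₁ e = subst (_ <_) (sym e) z<x
  ... | inj₂ e = subst (_ <_) (sym e) z<y

  p≤∣p∣ : ∀ p → p ≤ ℚ.∣ p ∣
  p≤∣p∣ p with ℚP.∣p∣≡p∨∣p∣≡-p p
  ... | inj₁ e = ℚP.≤-reflexive (sym e)
  ... | inj₂ e with ℚP.≤-total 0ℚ p
  ...   | inj₁ 0≤p = ℚP.≤-reflexive (sym (ℚP.0≤p⇒∣p∣≡p 0≤p))
  ...   | inj₂ p≤0 = ℚP.≤-trans p≤0 (ℚP.0≤∣p∣ p)

  -p≤∣p∣ : ∀ p → - p ≤ ℚ.∣ p ∣
  -p≤∣p∣ p = subst (- p ≤_) (ℚP.∣-p∣≡∣p∣ p) (p≤∣p∣ (- p))

  neg≤ : ∀ p → - ℚ.∣ p ∣ ≤ p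
  neg≤ p = by≤ (≤⇒0≤ (-p≤∣p∣ p)) (e p ℚ.∣ p ∣)
    where
    e : ∀ p a → a - (- p) ≡ p - (- a)
    e = solve-∀ ℚ-ring

  abs≤ : ∀ {u M} → - M ≤ u → u ≤ M → ℚ.∣ u ∣ ≤ M
  abs≤ {u} {M} l h with ℚP.∣p∣≡p∨∣p∣≡-p u
  ... | inj₁ e = subst (_≤ M) (sym e) h
  ... | inj₂ e = subst (_≤ M) (sym e) (by≤ (≤⇒0≤ l) (d u M))
    where
    d : ∀ u M → u - (- M) ≡ M - (- u)
    d = solve-∀ ℚ-ring

  *≤abs : ∀ {u v M K} → ℚ.∣ u ∣ ≤ M → ℚ.∣ v ∣ ≤ K → u * v ≤ M * K
  *≤abs {u} {v} u≤M v≤K = ℚP.≤-trans (p≤∣p∣ (u * v))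
    (subst (_≤ _) (sym (ℚP.∣p*q∣≡∣p∣*∣q∣ u v)) (*-mono-≤ (ℚP.0≤∣p∣ u) u≤M (ℚP.0≤∣p∣ v) v≤K))

open RationalFacts

fromℕ : ℕ → ℚ
fromℕ n = ℚ.mkℚ (+ n) 0 (Coprimality.sym (Coprimality.1-coprimeTo n))


-- 1/(m+1)
unitFraction : ℕ → ℚ
unitFraction m = ℚ.mkℚ (+ 1) m (Coprimality.1-coprimeTo (suc m))

module PowerFacts where
  fromℕ-suc : ∀ n → fromℕ (suc n) ≡ 1ℚ + fromℕ n
  fromℕ-suc n = ℚP.toℚᵘ-injective
    (ℚᵘP.≃-trans (ℚᵘ.*≡* eq) (ℚᵘP.≃-sym (ℚP.toℚᵘ-homo-+ 1ℚ (fromℕ n))))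
    where
    eq : (+ suc n) ℤ.* + 1 ≡ (+ 1 ℤ.* + 1 ℤ.+ + n ℤ.* + 1) ℤ.* + 1
    eq = cong (ℤ._* + 1) (cong (λ z → + 1 ℤ.+ z) (sym (ℤP.*-identityʳ (+ n))))

  fromℕ-unit : ∀ m → fromℕ (suc m) * unitFraction m ≡ 1ℚ
  fromℕ-unit m = ℚP.toℚᵘ-injective
    (ℚᵘP.≃-trans (ℚP.toℚᵘ-homo-* (fromℕ (suc m)) (unitFraction m)) (ℚᵘ.*≡* eq))
    where
    eq : (+ suc m ℤ.* + 1) ℤ.* + 1 ≡ + 1 ℤ.* (+ 1 ℤ.* + suc m)
    eq = trans (ℤP.*-identityʳ _) (trans (ℤP.*-comm (+ suc m) (+ 1))
           (sym (ℤP.*-identityˡ _)))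

  fromℕ≥0 : ∀ n → 0ℚ ≤ fromℕ n
  fromℕ≥0 zero    = ℚP.≤-refl
  fromℕ≥0 (suc n) = subst (0ℚ ≤_) (sym (fromℕ-suc n)) (+≥0 (ℚP.<⇒≤ 0<1) (fromℕ≥0 n))

  fromℕ<suc : ∀ n → fromℕ n < fromℕ (suc n)
  fromℕ<suc n = by< 0<1 (trans (e (fromℕ n)) (cong (_- fromℕ n) (sym (fromℕ-suc n))))
    where
    e : ∀ x → 1ℚ ≡ 1ℚ + x - x
    e = solve-∀ ℚ-ring

  fromℕ>0 : ∀ n → 0ℚ < fromℕ (suc n)
  fromℕ>0 n = ℚP.≤-<-trans (fromℕ≥0 n) (fromℕ<suc n)

  unit>0 : ∀ m → 0ℚ < unitFraction m
  unit>0 m = ℚP.positive⁻¹ (unitFraction m)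

  unit≤1 : ∀ m → unitFraction m ≤ 1ℚ
  unit≤1 m = go (fromℕ m) (unitFraction m) (fromℕ≥0 m) (ℚP.<⇒≤ (unit>0 m))
    (trans (cong (_* unitFraction m) (sym (fromℕ-suc m))) (fromℕ-unit m))
    where
    e : ∀ f u → f * u ≡ (1ℚ + f) * u - u
    e = solve-∀ ℚ-ring
    go : ∀ f u → 0ℚ ≤ f → 0ℚ ≤ u → (1ℚ + f) * u ≡ 1ℚ → u ≤ 1ℚ
    go f u 0≤f 0≤u fu = by≤ (*≥0 0≤f 0≤u) (trans (e f u) (cong (_- u) fu))

  ≤fromℕ : ∀ p → p ≤ fromℕ ℤ.∣ ℚ.↥ p ∣
  ≤fromℕ p = *≤* (le p)
    where
    le : ∀ p → ℚ.↥ p ℤ.* + 1 ℤ.≤ + ℤ.∣ ℚ.↥ p ∣ ℤ.* ℚ.↧ p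
    le (ℚ.mkℚ (+ n) d _) =
      ℤP.*-monoˡ-≤-nonNeg (+ n) {+ 1} {+ suc d} (ℤ.+≤+ (ℕ.s≤s ℕ.z≤n))
    le (ℚ.mkℚ (ℤ.-[1+ n ]) d _) = ℤ.-≤+

  <fromℕ : ∀ p → ∃ λ m → p < fromℕ (suc m)
  <fromℕ p = ℤ.∣ ℚ.↥ p ∣ ,
    ℚP.≤-<-trans {p} {fromℕ ℤ.∣ ℚ.↥ p ∣} (≤fromℕ p) (fromℕ<suc ℤ.∣ ℚ.↥ p ∣)

  archimedean : ∀ {d} K → 0ℚ < d → ∃ λ m → K < d * fromℕ (suc m)
  archimedean {d} K 0<d = m , scale (fromℕ (suc m)) (proj₂ (<fromℕ (K * i)))
    where
    i = proj₁ (inverse 0<d)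
    m = proj₁ (<fromℕ (K * i))
    e : ∀ d f K i → d * (f - K * i) ≡ d * f - K * (i * d)
    e = solve-∀ ℚ-ring
    scale : ∀ f → K * i < f → K < d * f
    scale f lt = by< (*>0 0<d (<⇒0< lt))
      (trans (e d f K i)
        (cong (λ z → d * f - z)
          (trans (cong (K *_) (proj₂ (proj₂ (inverse 0<d)))) (ℚP.*-identityʳ K))))

  archimedean-unit : ∀ {d} K → 0ℚ < d → ∃ λ m → K * unitFraction m < d
  archimedean-unit {d} K 0<d =
    m , scale (fromℕ (suc m)) (unitFraction m) (unit>0 m) (fromℕ-unit m)
          (proj₂ (archimedean K 0<d))
    where
    m = proj₁ (archimedean K 0<d)
    e : ∀ u d f K → u * (d * f - K) ≡ d * (f * u) - K * u
    e = solve-∀ ℚ-ring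
    scale : ∀ f u → 0ℚ < u → f * u ≡ 1ℚ → K < d * f → K * u < d
    scale f u 0<u fu lt = by< (*>0 0<u (<⇒0< lt))
      (trans (e u d f K)
        (cong (_- K * u) (trans (cong (d *_) fu) (ℚP.*-identityʳ d))))

  ^≥0 : ∀ {x} n → 0ℚ ≤ x → 0ℚ ≤ x ^ n
  ^≥0 zero    _   = ℚP.<⇒≤ 0<1
  ^≥0 (suc n) 0≤x = *≥0 0≤x (^≥0 n 0≤x)

  ^>0 : ∀ {x} n → 0ℚ < x → 0ℚ < x ^ n
  ^>0 zero    _   = 0<1
  ^>0 (suc n) 0<x = *>0 0<x (^>0 n 0<x)

  ^-mono-≤ : ∀ {x y} n → 0ℚ ≤ x → x ≤ y → x ^ n ≤ y ^ n
  ^-mono-≤ zero    _   _   = ℚP.≤-refl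
  ^-mono-≤ {x} {y} (suc n) 0≤x x≤y =
    *-mono-≤ {x} {y} {x ^ n} {y ^ n} 0≤x x≤y (^≥0 n 0≤x) (^-mono-≤ n 0≤x x≤y)

  ^-mono-< : ∀ {x y} n → 0ℚ < x → x < y → x ^ suc n < y ^ suc n
  ^-mono-< {x} {y} n 0<x x<y =
    *-mono-< {x} {y} {x ^ n} {y ^ n} (ℚP.<⇒≤ 0<x) x<y (^>0 n 0<x) (^-mono-≤ n (ℚP.<⇒≤ 0<x) (ℚP.<⇒≤ x<y))

  1^ : ∀ n → 1ℚ ^ n ≡ 1ℚ
  1^ zero    = refl
  1^ (suc n) = trans (ℚP.*-identityˡ _) (1^ n)

  ^≤1 : ∀ {x} n → 0ℚ ≤ x → x ≤ 1ℚ → x ^ n ≤ 1ℚ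
  ^≤1 {x} n 0≤x x≤1 = subst (x ^ n ≤_) (1^ n) (^-mono-≤ n 0≤x x≤1)

  1≤^ : ∀ {x} n → 1ℚ ≤ x → 1ℚ ≤ x ^ n
  1≤^ {x} n 1≤x = subst (_≤ x ^ n) (1^ n) (^-mono-≤ n (ℚP.<⇒≤ 0<1) 1≤x)

  ^suc≤ : ∀ {x} n → 0ℚ ≤ x → x ≤ 1ℚ → x ^ suc n ≤ x
  ^suc≤ {x} n 0≤x x≤1 = subst (x ^ suc n ≤_) (ℚP.*-identityʳ x)
    (*-mono-≤ {x} {x} {x ^ n} {1ℚ} 0≤x ℚP.≤-refl (^≥0 n 0≤x) (^≤1 n 0≤x x≤1))

  ≤^suc : ∀ {x} n → 1ℚ ≤ x → x ≤ x ^ suc n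
  ≤^suc {x} n 1≤x = subst (_≤ x ^ suc n) (ℚP.*-identityʳ x)
    (*-mono-≤ {x} {x} {1ℚ} {x ^ n} (ℚP.≤-trans (ℚP.<⇒≤ 0<1) 1≤x) ℚP.≤-refl (ℚP.<⇒≤ 0<1) (1≤^ n 1≤x))

  ^2≥0 : ∀ z → 0ℚ ≤ z * z
  ^2≥0 z with ℚP.≤-total 0ℚ z
  ... | inj₁ 0≤z = *≥0 0≤z 0≤z
  ... | inj₂ z≤0 = subst (0ℚ ≤_) (s z) (*≥0 (ℚP.neg-antimono-≤ z≤0) (ℚP.neg-antimono-≤ z≤0))
    where
    s : ∀ z → (- z) * (- z) ≡ z * z
    s = solve-∀ ℚ-ring

  bernoulli : ∀ {y} n → 0ℚ ≤ y → 1ℚ + fromℕ n * (y - 1ℚ) ≤ y ^ n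
  bernoulli {y} zero 0≤y = ℚP.≤-reflexive (e y)
    where
    e : ∀ y → 1ℚ + 0ℚ * (y - 1ℚ) ≡ 1ℚ
    e = solve-∀ ℚ-ring
  bernoulli {y} (suc n) 0≤y = by≤
    (+≥0 (*≥0 0≤y (≤⇒0≤ (bernoulli n 0≤y))) (*≥0 (fromℕ≥0 n) (^2≥0 (y - 1ℚ))))
    (trans (e y (fromℕ n) (y ^ n))
           (cong (λ f → y ^ suc n - (1ℚ + f * (y - 1ℚ))) (sym (fromℕ-suc n))))
    where
    e : ∀ y f p → y * (p - (1ℚ + f * (y - 1ℚ))) + f * ((y - 1ℚ) * (y - 1ℚ))
                ≡ y * p - (1ℚ + (1ℚ + f) * (y - 1ℚ))
    e = solve-∀ ℚ-ring

open PowerFacts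

-- Real numbers as located Dedekind cuts.  Below q means q < x; the
-- upper half of the cut is the complement, so ¬ Below q means x ≤ q.

record ℝ : Set₁ where
  field
    Below     : ℚ → Set
    inhabited : ∃ Below
    bounded   : ∃ λ q → ¬ Below q
    downward  : ∀ {p q} → p < q → Below q → Below p
    rounded   : ∀ {p} → Below p → ∃ λ q → p < q × Below q
    located   : ∀ {p q} → p < q → Below p ⊎ ¬ Below q

open ℝ public

infix 4 _<ℝ_ _≤ℝ_

_≤ℝ_ : ℝ → ℝ → Set
x ≤ℝ y = ∀ q → Below x q → Below y q

_<ℝ_ : ℝ → ℝ → Set
x <ℝ y = ∃ λ q → ¬ Below x q × Below y q

module CutFacts where
  downward-≤ : ∀ x {p q} → p ≤ q → Below x q → Below x p
  downward-≤ x p≤q q∈ =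
    downward x (ℚP.≤-<-trans p≤q (proj₁ (proj₂ (rounded x q∈)))) (proj₂ (proj₂ (rounded x q∈)))

  in<out : ∀ x {p q} → Below x p → ¬ Below x q → p < q
  in<out x {p} {q} p∈ q∉ = ℚP.≰⇒> λ q≤p → q∉ (downward-≤ x q≤p p∈)

  upward : ∀ x {p q} → p ≤ q → ¬ Below x p → ¬ Below x q
  upward x p≤q p∉ q∈ = p∉ (downward-≤ x p≤q q∈)

  record Bracket (x : ℝ) : Set where
    constructor bracket
    field
      {lo hi} : ℚ
      lo∈     : Below x lo
      hi∉     : ¬ Below x hi
    lo≤hi : lo ≤ hi
    lo≤hi = ℚP.<⇒≤ (in<out x lo∈ hi∉)
  open Bracket public

  initial : ∀ x → Bracket x
  initial x = bracket (proj₂ (inhabited x)) (proj₂ (bounded x))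

  Refinement : ∀ {x} → Bracket x → ℚ → Set
  Refinement {x} B ε = Σ (Bracket x) λ C →
    lo B ≤ lo C × hi C ≤ hi B × hi C ≤ lo C + ε

  double-half : ∀ ε → ℚ.½ * ε + ℚ.½ * ε ≡ ε
  double-half ε = trans (sym (ℚP.*-distribʳ-+ ε ℚ.½ ℚ.½)) (ℚP.*-identityˡ ε)

  refine : ∀ {x} (B : Bracket x) {ε} → 0ℚ < ε → Refinement B ε
  refine {x} B {ε} 0<ε =
    walk (suc (proj₁ arch)) (lo B) ℚP.≤-refl (lo∈ B) (start _ (proj₂ arch))
    where
    δ = ℚ.½ * ε

    0<δ : 0ℚ < δ
    0<δ = *>0 (ℚP.positive⁻¹ ℚ.½) 0<ε

    arch : ∃ λ m → hi B - lo B < δ * fromℕ (suc m)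
    arch = archimedean (hi B - lo B) 0<δ

    start : ∀ f → hi B - lo B < δ * f → hi B ≤ lo B + f * δ
    start f lt = by≤ (ℚP.<⇒≤ (<⇒0< lt)) (e δ f (lo B) (hi B))
      where
      e : ∀ d f l h → d * f - (h - l) ≡ l + f * d - h
      e = solve-∀ ℚ-ring

    a<a+δ : ∀ a → a < a + δ
    a<a+δ a = by< 0<δ (e a δ)
      where
      e : ∀ a d → d ≡ a + d - a
      e = solve-∀ ℚ-ring

    walk : ∀ N a → lo B ≤ a → Below x a → hi B ≤ a + fromℕ N * δ → Refinement B ε
    walk zero a _ a∈ h = ⊥-elim (hi∉ B (downward-≤ x (subst (hi B ≤_) (e a δ) h) a∈))
      where
      e : ∀ a d → a + 0ℚ * d ≡ a
      e = solve-∀ ℚ-ring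
    walk (suc N) a l≤a a∈ h = [ further , done ]′ (located x (a<a+δ (a + δ)))
      where
      further : Below x (a + δ) → Refinement B ε
      further b∈ = walk N (a + δ) (ℚP.≤-trans l≤a (ℚP.<⇒≤ (a<a+δ a))) b∈
        (subst (hi B ≤_) (trans (cong (λ f → a + f * δ) (fromℕ-suc N)) (e a (fromℕ N) δ)) h)
        where
        e : ∀ a f d → a + (1ℚ + f) * d ≡ a + d + f * d
        e = solve-∀ ℚ-ring
      done : ¬ Below x (a + δ + δ) → Refinement B ε
      done c∉ = bracket {lo = a} {hi = c ⊓ hi B} a∈ out , l≤a , ℚP.p⊓q≤q c (hi B) ,
        ℚP.≤-trans (ℚP.p⊓q≤p c (hi B))
          (ℚP.≤-reflexive (trans (ℚP.+-assoc a δ δ) (cong (λ z → a + z) (double-half ε))))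
        where
        c = a + δ + δ
        out : ¬ Below x (c ⊓ hi B)
        out c∈ = [ (λ e → c∉ (subst (Below x) e c∈)) , (λ e → hi∉ B (subst (Below x) e c∈)) ]′
                   (ℚP.⊓-sel c (hi B))

open CutFacts

fromℚ : ℚ → ℝ
fromℚ x = record
  { Below     = _< x
  ; inhabited = x - 1ℚ , by< 0<1 (e x)
  ; bounded   = x , ℚP.<-irrefl refl
  ; downward  = ℚP.<-trans
  ; rounded   = ℚP.<-dense
  ; located   = loc
  }
  where
  e : ∀ x → 1ℚ ≡ x - (x - 1ℚ)
  e = solve-∀ ℚ-ring
  loc : ∀ {p q} → p < q → p < x ⊎ ¬ q < x
  loc {p} {q} p<q with p ℚP.<? x
  ... | yes p<x = inj₁ p<x
  ... | no  p≮x = inj₂ λ q<x → p≮x (ℚP.<-trans p<q q<x)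

fromℕℝ : ℕ → ℝ
fromℕℝ n = fromℚ (fromℕ n)

infixl 6 _-ℝ_
infixl 7 _*ℝ_

_-ℝ_ : ℝ → ℝ → ℝ
x -ℝ y = record
  { Below     = B
  ; inhabited = lo X - hi Y - 1ℚ , lo X , hi Y , lo∈ X , hi∉ Y , by< 0<1 (e₁ (lo X - hi Y))
  ; bounded   = hi X - lo Y , bnd
  ; downward  = λ { p<q (a , b , a∈ , b∉ , q<) → a , b , a∈ , b∉ , ℚP.<-trans p<q q< }
  ; rounded   = λ { (a , b , a∈ , b∉ , p<) →
                    let q , p<q , q< = ℚP.<-dense p< in q , p<q , a , b , a∈ , b∉ , q< }
  ; located   = loc
  }
  where
  X = initial x
  Y = initial y
  B : ℚ → Set
  B q = ∃₂ λ a b → Below x a × ¬ Below y b × q < a - b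
  e₁ : ∀ z → 1ℚ ≡ z - (z - 1ℚ)
  e₁ = solve-∀ ℚ-ring
  bnd : ¬ B (hi X - lo Y)
  bnd (a , b , a∈ , b∉ , lt) = ℚP.<-irrefl refl (ℚP.<-trans lt
    (by< (+>0 (<⇒0< (in<out x a∈ (hi∉ X))) (<⇒0< (in<out y (lo∈ Y) b∉))) (e (hi X) (lo Y) a b)))
    where
    e : ∀ h l a b → (h - a) + (b - l) ≡ (h - l) - (a - b)
    e = solve-∀ ℚ-ring
  loc : ∀ {p q} → p < q → B p ⊎ ¬ B q
  loc {p} {q} p<q = go (refine Y {ℚ.½ * (q - p)} (*>0 (ℚP.positive⁻¹ ℚ.½) (<⇒0< p<q)))
    where
    ε = ℚ.½ * (q - p)
    0<ε : 0ℚ < ε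
    0<ε = *>0 (ℚP.positive⁻¹ ℚ.½) (<⇒0< p<q)
    go : Refinement Y ε → B p ⊎ ¬ B q
    go (C , _ , _ , w) = [ inj₁ ∘ below , inj₂ ∘ above ]′ (located x lt)
      where
      e : ∀ ε p q h l → ε + ε ≡ q - p → ε + (l + ε - h) ≡ (q + l) - (p + h)
      e ε p q h l eq = trans (e′ ε h l) (trans (cong (λ z → z + (l - h)) eq) (e″ p q h l))
        where
        e′ : ∀ ε h l → ε + (l + ε - h) ≡ (ε + ε) + (l - h)
        e′ = solve-∀ ℚ-ring
        e″ : ∀ p q h l → (q - p) + (l - h) ≡ (q + l) - (p + h)
        e″ = solve-∀ ℚ-ring
      lt : p + hi C < q + lo C
      lt = by< (+>≥0 0<ε (≤⇒0≤ w)) (e ε p q (hi C) (lo C) (double-half (q - p)))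
      below : Below x (p + hi C) → B p
      below s∈ = proj₁ r , hi C , proj₂ (proj₂ r) , hi∉ C ,
        by< (<⇒0< (proj₁ (proj₂ r))) (d (proj₁ r) p (hi C))
        where
        r = rounded x s∈
        d : ∀ r p h → r - (p + h) ≡ (r - h) - p
        d = solve-∀ ℚ-ring
      above : ¬ Below x (q + lo C) → ¬ B q
      above t∉ (a , b , a∈ , b∉ , q<) = ℚP.<-irrefl refl (ℚP.<-trans q<
        (by< (+>0 (<⇒0< (in<out x a∈ t∉)) (<⇒0< (in<out y (lo∈ C) b∉))) (d q (lo C) a b)))
        where
        d : ∀ q l a b → ((q + l) - a) + (b - l) ≡ q - (a - b)
        d = solve-∀ ℚ-ring

module ProductFacts where
  -- A bilinear form above q at the corners of a rectangle is above q inside it.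
  segment : ∀ {a b u v q} → a ≤ u → u ≤ b → q < a * v → q < b * v → q < u * v
  segment {a} {b} {u} {v} {q} a≤u u≤b q<av q<bv = [ pos , neg ]′ (ℚP.≤-total 0ℚ v)
    where
    pos : 0ℚ ≤ v → q < u * v
    pos 0≤v = ℚP.<-≤-trans q<av (by≤ (*≥0 (≤⇒0≤ a≤u) 0≤v) (e a u v))
      where
      e : ∀ a u v → (u - a) * v ≡ u * v - a * v
      e = solve-∀ ℚ-ring
    neg : v ≤ 0ℚ → q < u * v
    neg v≤0 = ℚP.<-≤-trans q<bv (by≤ (*≥0 (≤⇒0≤ u≤b) (≤⇒0≤ v≤0)) (e b u v))
      where
      e : ∀ b u v → (b - u) * (0ℚ - v) ≡ u * v - b * v
      e = solve-∀ ℚ-ring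

  rectangle : ∀ {a A b B u v q} → a ≤ u → u ≤ A → b ≤ v → v ≤ B →
              q < a * b → q < a * B → q < A * b → q < A * B → q < u * v
  rectangle {a} {A} {b} {B} {u} {v} {q} a≤u u≤A b≤v v≤B ab aB Ab AB =
    segment a≤u u≤A (side a ab aB) (side A Ab AB)
    where
    side : ∀ s → q < s * b → q < s * B → q < s * v
    side s sb sB = subst (q <_) (ℚP.*-comm v s)
      (segment b≤v v≤B (subst (q <_) (ℚP.*-comm s b) sb) (subst (q <_) (ℚP.*-comm s B) sB))

  common : ∀ {x} (C D : Bracket x) → ∃ λ u → lo C ≤ u × u ≤ hi C × lo D ≤ u × u ≤ hi D
  common {x} C D = lo C ⊔ lo D , ℚP.p≤p⊔q (lo C) (lo D) , ≤hi C , ℚP.p≤q⊔p (lo C) (lo D) , ≤hi D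
    where
    ≤hi : ∀ E → lo C ⊔ lo D ≤ hi E
    ≤hi E = ℚP.<⇒≤ (⊔-lub (in<out x (lo∈ C) (hi∉ E)) (in<out x (lo∈ D) (hi∉ E)))

open ProductFacts

-- q < x y when x and y lie in intervals (a, A] and (b, B] with q below
-- all four products of end points.
_*ℝ_ : ℝ → ℝ → ℝ
x *ℝ y = record
  { Below     = P
  ; inhabited = inh
  ; bounded   = M * M , bnd
  ; downward  = λ { p<q (a , A , b , B , a∈ , A∉ , b∈ , B∉ , h₁ , h₂ , h₃ , h₄) →
                    a , A , b , B , a∈ , A∉ , b∈ , B∉ ,
                    ℚP.<-trans p<q h₁ , ℚP.<-trans p<q h₂ , ℚP.<-trans p<q h₃ , ℚP.<-trans p<q h₄ }
  ; rounded   = rnd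
  ; located   = loc
  }
  where
  X = initial x
  Y = initial y

  P : ℚ → Set
  P q = ∃₂ λ a A → ∃₂ λ b B →
    Below x a × ¬ Below x A × Below y b × ¬ Below y B ×
    q < a * b × q < a * B × q < A * b × q < A * B

  M : ℚ
  M = 1ℚ + (ℚ.∣ lo X ∣ + ℚ.∣ hi X ∣ + (ℚ.∣ lo Y ∣ + ℚ.∣ hi Y ∣))

  0<M : 0ℚ < M
  0<M = +>≥0 0<1 (+≥0 (+≥0 (ℚP.0≤∣p∣ (lo X)) (ℚP.0≤∣p∣ (hi X)))
                      (+≥0 (ℚP.0≤∣p∣ (lo Y)) (ℚP.0≤∣p∣ (hi Y))))

  point : ∀ {q} (C : Bracket x) (D : Bracket y) → P q → ∃₂ λ u v →
          lo C ≤ u × u ≤ hi C × lo D ≤ v × v ≤ hi D × q < u * v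
  point C D (a , A , b , B , a∈ , A∉ , b∈ , B∉ , h₁ , h₂ , h₃ , h₄) =
    let u , l₁ , l₂ , l₃ , l₄ = common C (bracket a∈ A∉)
        v , m₁ , m₂ , m₃ , m₄ = common D (bracket b∈ B∉)
    in u , v , l₁ , l₂ , m₁ , m₂ , rectangle l₃ l₄ m₃ m₄ h₁ h₂ h₃ h₄

  lX = ℚ.∣ lo X ∣
  hX = ℚ.∣ hi X ∣
  lY = ℚ.∣ lo Y ∣
  hY = ℚ.∣ hi Y ∣

  ∣X∣≤M : ∀ {u} → lo X ≤ u → u ≤ hi X → ℚ.∣ u ∣ ≤ M
  ∣X∣≤M {u} l h = abs≤
    (by≤ (+≥0 (+≥0 (ℚP.<⇒≤ 0<1) (≤⇒0≤ (ℚP.≤-trans (neg≤ (lo X)) l)))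
              (+≥0 (ℚP.0≤∣p∣ (hi X)) (+≥0 (ℚP.0≤∣p∣ (lo Y)) (ℚP.0≤∣p∣ (hi Y)))))
         (d₁ u lX hX lY hY))
    (by≤ (+≥0 (+≥0 (ℚP.<⇒≤ 0<1) (≤⇒0≤ (ℚP.≤-trans h (p≤∣p∣ (hi X)))))
              (+≥0 (ℚP.0≤∣p∣ (lo X)) (+≥0 (ℚP.0≤∣p∣ (lo Y)) (ℚP.0≤∣p∣ (hi Y)))))
         (d₂ u lX hX lY hY))
    where
    d₁ : ∀ u a b c d → 1ℚ + (u - (- a)) + (b + (c + d)) ≡ u - (- (1ℚ + (a + b + (c + d))))
    d₁ = solve-∀ ℚ-ring
    d₂ : ∀ u a b c d → 1ℚ + (b - u) + (a + (c + d)) ≡ (1ℚ + (a + b + (c + d))) - u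
    d₂ = solve-∀ ℚ-ring

  ∣Y∣≤M : ∀ {u} → lo Y ≤ u → u ≤ hi Y → ℚ.∣ u ∣ ≤ M
  ∣Y∣≤M {u} l h = abs≤
    (by≤ (+≥0 (+≥0 (ℚP.<⇒≤ 0<1) (≤⇒0≤ (ℚP.≤-trans (neg≤ (lo Y)) l)))
              (+≥0 (ℚP.0≤∣p∣ (hi Y)) (+≥0 (ℚP.0≤∣p∣ (lo X)) (ℚP.0≤∣p∣ (hi X)))))
         (d₁ u lX hX lY hY))
    (by≤ (+≥0 (+≥0 (ℚP.<⇒≤ 0<1) (≤⇒0≤ (ℚP.≤-trans h (p≤∣p∣ (hi Y)))))
              (+≥0 (ℚP.0≤∣p∣ (lo Y)) (+≥0 (ℚP.0≤∣p∣ (lo X)) (ℚP.0≤∣p∣ (hi X)))))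
         (d₂ u lX hX lY hY))
    where
    d₁ : ∀ u a b c d → 1ℚ + (u - (- c)) + (d + (a + b)) ≡ u - (- (1ℚ + (a + b + (c + d))))
    d₁ = solve-∀ ℚ-ring
    d₂ : ∀ u a b c d → 1ℚ + (d - u) + (c + (a + b)) ≡ (1ℚ + (a + b + (c + d))) - u
    d₂ = solve-∀ ℚ-ring

  bnd : ¬ P (M * M)
  bnd h = let u , v , l₁ , l₂ , m₁ , m₂ , lt = point X Y h in
    ℚP.<-irrefl refl (ℚP.<-≤-trans lt (*≤abs (∣X∣≤M l₁ l₂) (∣Y∣≤M m₁ m₂)))

  corners : ∀ {q} (C : Bracket x) (D : Bracket y) →
            q < lo C * lo D → q < lo C * hi D → q < hi C * lo D → q < hi C * hi D → P q
  corners C D h₁ h₂ h₃ h₄ =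
    lo C , hi C , lo D , hi D , lo∈ C , hi∉ C , lo∈ D , hi∉ D , h₁ , h₂ , h₃ , h₄

  minimum : ℚ → ℚ → ℚ → ℚ → ℚ
  minimum a b c d = (a ⊓ b) ⊓ (c ⊓ d)

  inh : ∃ P
  inh = m - 1ℚ , corners X Y
      (lower (ℚP.≤-trans (ℚP.p⊓q≤p (p₁ ⊓ p₂) (p₃ ⊓ p₄)) (ℚP.p⊓q≤p p₁ p₂)))
      (lower (ℚP.≤-trans (ℚP.p⊓q≤p (p₁ ⊓ p₂) (p₃ ⊓ p₄)) (ℚP.p⊓q≤q p₁ p₂)))
      (lower (ℚP.≤-trans (ℚP.p⊓q≤q (p₁ ⊓ p₂) (p₃ ⊓ p₄)) (ℚP.p⊓q≤p p₃ p₄)))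
      (lower (ℚP.≤-trans (ℚP.p⊓q≤q (p₁ ⊓ p₂) (p₃ ⊓ p₄)) (ℚP.p⊓q≤q p₃ p₄)))
    where
    p₁ = lo X * lo Y
    p₂ = lo X * hi Y
    p₃ = hi X * lo Y
    p₄ = hi X * hi Y
    m  = minimum p₁ p₂ p₃ p₄
    e : ∀ m → 1ℚ ≡ m - (m - 1ℚ)
    e = solve-∀ ℚ-ring
    lower : ∀ {p} → m ≤ p → m - 1ℚ < p
    lower m≤p = ℚP.<-≤-trans (by< 0<1 (e m)) m≤p

  rnd : ∀ {p} → P p → ∃ λ q → p < q × P q
  rnd {p} (a , A , b , B , a∈ , A∉ , b∈ , B∉ , h₁ , h₂ , h₃ , h₄) =
    let q , p<q , q<m = ℚP.<-dense (⊓-glb (⊓-glb h₁ h₂) (⊓-glb h₃ h₄)) in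
    q , p<q , a , A , b , B , a∈ , A∉ , b∈ , B∉ ,
    ℚP.<-≤-trans q<m (ℚP.≤-trans (ℚP.p⊓q≤p ((a * b) ⊓ (a * B)) _) (ℚP.p⊓q≤p (a * b) _)) ,
    ℚP.<-≤-trans q<m (ℚP.≤-trans (ℚP.p⊓q≤p ((a * b) ⊓ (a * B)) _) (ℚP.p⊓q≤q (a * b) _)) ,
    ℚP.<-≤-trans q<m (ℚP.≤-trans (ℚP.p⊓q≤q ((a * b) ⊓ (a * B)) _) (ℚP.p⊓q≤p (A * b) _)) ,
    ℚP.<-≤-trans q<m (ℚP.≤-trans (ℚP.p⊓q≤q ((a * b) ⊓ (a * B)) _) (ℚP.p⊓q≤q (A * b) _))

  loc : ∀ {p q} → p < q → P p ⊎ ¬ P q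
  loc {p} {q} p<q = go (refine X 0<ε) (refine Y 0<ε)
    where
    inv = inverse (+>0 0<M 0<M)
    ε : ℚ
    ε = (q - p) * proj₁ inv
    0<ε : 0ℚ < ε
    0<ε = *>0 (<⇒0< p<q) (proj₁ (proj₂ inv))
    ε-eq : ε * M + M * ε ≡ q - p
    ε-eq = trans (e (q - p) (proj₁ inv) M)
             (trans (cong ((q - p) *_) (proj₂ (proj₂ inv))) (ℚP.*-identityʳ (q - p)))
      where
      e : ∀ d i m → d * i * m + m * (d * i) ≡ d * (i * (m + m))
      e = solve-∀ ℚ-ring

    go : Refinement X ε → Refinement Y ε → P p ⊎ ¬ P q
    go (C , Cl , Ch , Cw) (D , Dl , Dh , Dw) =
      check (p ℚP.<? lo C * lo D) (p ℚP.<? lo C * hi D) (p ℚP.<? hi C * lo D) (p ℚP.<? hi C * hi D)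
      where
      near : ∀ {z l h s u} → h ≤ l + z → l ≤ s → s ≤ h → l ≤ u → u ≤ h → ℚ.∣ u - s ∣ ≤ z
      near {z} {l} {h} {s} {u} w l≤s s≤h l≤u u≤h = abs≤
        (by≤ (+≥0 (≤⇒0≤ w) (+≥0 (≤⇒0≤ l≤u) (≤⇒0≤ s≤h))) (d₁ z l h s u))
        (by≤ (+≥0 (≤⇒0≤ w) (+≥0 (≤⇒0≤ u≤h) (≤⇒0≤ l≤s))) (d₂ z l h s u))
        where
        d₁ : ∀ z l h s u → (l + z - h) + ((u - l) + (h - s)) ≡ (u - s) - (- z)
        d₁ = solve-∀ ℚ-ring
        d₂ : ∀ z l h s u → (l + z - h) + ((h - u) + (s - l)) ≡ z - (u - s)
        d₂ = solve-∀ ℚ-ring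

      fail : ∀ {s t} → lo C ≤ s → s ≤ hi C → lo D ≤ t → t ≤ hi D → ¬ p < s * t → ¬ P q
      fail {s} {t} l≤s s≤h l≤t t≤h p≮ Pq =
        let u , v , l₁ , l₂ , m₁ , m₂ , lt = point C D Pq
            i = *≤abs {u - s} {v} (near Cw l≤s s≤h l₁ l₂)
                  (∣Y∣≤M (ℚP.≤-trans Dl m₁) (ℚP.≤-trans m₂ Dh))
            j = *≤abs {s} {v - t} (∣X∣≤M (ℚP.≤-trans Cl l≤s) (ℚP.≤-trans s≤h Ch))
                  (near Dw l≤t t≤h m₁ m₂)
            k = subst ((u - s) * v + s * (v - t) ≤_) ε-eq (ℚP.+-mono-≤ i j)
        in ℚP.<-irrefl refl (ℚP.<-≤-trans lt
             (by≤ (+≥0 (≤⇒0≤ k) (≤⇒0≤ (ℚP.≮⇒≥ p≮))) (e p q s t u v)))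
        where
        e : ∀ p q s t u v → (q - p) - ((u - s) * v + s * (v - t)) + (p - s * t) ≡ q - u * v
        e = solve-∀ ℚ-ring

      r = ℚP.≤-refl

      check : Dec (p < lo C * lo D) → Dec (p < lo C * hi D) →
              Dec (p < hi C * lo D) → Dec (p < hi C * hi D) → P p ⊎ ¬ P q
      check (no h)   _        _        _        = inj₂ (fail r (lo≤hi C) r (lo≤hi D) h)
      check (yes _)  (no h)   _        _        = inj₂ (fail r (lo≤hi C) (lo≤hi D) r h)
      check (yes _)  (yes _)  (no h)   _        = inj₂ (fail (lo≤hi C) r r (lo≤hi D) h)
      check (yes _)  (yes _)  (yes _)  (no h)   = inj₂ (fail (lo≤hi C) r (lo≤hi D) r h)
      check (yes h₁) (yes h₂) (yes h₃) (yes h₄) = inj₁ (corners C D h₁ h₂ h₃ h₄)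

0ℝ 1ℝ : ℝ
0ℝ = fromℚ 0ℚ
1ℝ = fromℚ 1ℚ

module PositiveFacts where
  0∈ : ∀ x → 0ℝ <ℝ x → Below x 0ℚ
  0∈ x (q , q≮0 , q∈) = downward-≤ x (ℚP.≮⇒≥ q≮0) q∈

  positiveBelow : ∀ x → 0ℝ <ℝ x → ∃ λ q → 0ℚ < q × Below x q
  positiveBelow x 0<x = rounded x (0∈ x 0<x)

open PositiveFacts

-- q < 1/x when q r < 1 for some r ≥ x.
recip : (x : ℝ) → 0ℝ <ℝ x → ℝ
recip x 0<x = record
  { Below     = P
  ; inhabited = 0ℚ , hi X , hi∉ X , subst (_< 1ℚ) (sym (ℚP.*-zeroˡ (hi X))) 0<1
  ; bounded   = j , bnd
  ; downward  = λ { {p} {q} p<q (r , r∉ , lt) →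
                    r , r∉ , ℚP.<-trans (by< (*>0 (<⇒0< p<q) (r>0 r∉)) (d p q r)) lt }
  ; rounded   = rnd
  ; located   = loc
  }
  where
  X = initial x
  P : ℚ → Set
  P q = ∃ λ r → ¬ Below x r × q * r < 1ℚ

  d : ∀ p q r → (q - p) * r ≡ q * r - p * r
  d = solve-∀ ℚ-ring

  r>0 : ∀ {r} → ¬ Below x r → 0ℚ < r
  r>0 r∉ = in<out x (0∈ x 0<x) r∉

  a   = proj₁ (positiveBelow x 0<x)
  0<a = proj₁ (proj₂ (positiveBelow x 0<x))
  a∈  = proj₂ (proj₂ (positiveBelow x 0<x))
  j   = proj₁ (inverse 0<a)
  0<j = proj₁ (proj₂ (inverse 0<a))
  ja  = proj₂ (proj₂ (inverse 0<a))

  bnd : ¬ P j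
  bnd (r , r∉ , lt) = ℚP.<-irrefl refl (ℚP.<-trans lt (subst (_< j * r) ja
    (by< (*>0 0<j (<⇒0< (in<out x a∈ r∉))) (e j a r))))
    where
    e : ∀ j a r → j * (r - a) ≡ j * r - j * a
    e = solve-∀ ℚ-ring

  rnd : ∀ {p} → P p → ∃ λ q → p < q × P q
  rnd {p} (r , r∉ , lt) = proj₁ mid * i , gt , r , r∉ ,
    subst (_< 1ℚ) (sym (back (proj₁ mid))) (proj₂ (proj₂ mid))
    where
    mid = ℚP.<-dense lt
    i   = proj₁ (inverse (r>0 r∉))
    0<i = proj₁ (proj₂ (inverse (r>0 r∉)))
    ir  = proj₂ (proj₂ (inverse (r>0 r∉)))
    back : ∀ z → z * i * r ≡ z
    back z = trans (ℚP.*-assoc z i r) (trans (cong (z *_) ir) (ℚP.*-identityʳ z))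
    swap : ∀ p r i → p * r * i ≡ p * (i * r)
    swap = solve-∀ ℚ-ring
    gt : p < proj₁ mid * i
    gt = subst (_< proj₁ mid * i)
      (trans (swap p r i) (trans (cong (p *_) ir) (ℚP.*-identityʳ p)))
      (by< (*>0 (<⇒0< (proj₁ (proj₂ mid))) 0<i) (d (p * r) (proj₁ mid) i))

  loc : ∀ {p q} → p < q → P p ⊎ ¬ P q
  loc {p} {q} p<q = sign (p ℚP.≤? 0ℚ)
    where
    sign : Dec (p ≤ 0ℚ) → P p ⊎ ¬ P q
    sign (yes p≤0) = inj₁ (hi X , hi∉ X , ℚP.≤-<-trans
      (by≤ (*≥0 (≤⇒0≤ p≤0) (ℚP.<⇒≤ (r>0 (hi∉ X)))) (e p (hi X))) 0<1)
      where
      e : ∀ p h → (0ℚ - p) * h ≡ 0ℚ - p * h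
      e = solve-∀ ℚ-ring
    sign (no p≰0) = [ inj₂ ∘ above , inj₁ ∘ below ]′ (located x 1/q<1/m)
      where
      0<p = ℚP.≰⇒> p≰0
      mid = ℚP.<-dense p<q
      m   = proj₁ mid
      p<m = proj₁ (proj₂ mid)
      m<q = proj₂ (proj₂ mid)
      0<m = ℚP.<-trans 0<p p<m
      iq  = proj₁ (inverse (ℚP.<-trans 0<m m<q))
      0<iq : 0ℚ < iq
      0<iq = proj₁ (proj₂ (inverse (ℚP.<-trans 0<m m<q)))
      iq-eq : iq * q ≡ 1ℚ
      iq-eq = proj₂ (proj₂ (inverse (ℚP.<-trans 0<m m<q)))
      im  = proj₁ (inverse 0<m)
      0<im : 0ℚ < im
      0<im = proj₁ (proj₂ (inverse 0<m))
      im-eq : im * m ≡ 1ℚ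
      im-eq = proj₂ (proj₂ (inverse 0<m))
      1/q<1/m : iq < im
      1/q<1/m = by< (*>0 (*>0 0<im 0<iq) (<⇒0< m<q))
        (trans (e im iq m q) (cong₂ _-_ (trans (cong (im *_) iq-eq) (ℚP.*-identityʳ im))
                                        (trans (cong (iq *_) im-eq) (ℚP.*-identityʳ iq))))
        where
        e : ∀ a b m q → a * b * (q - m) ≡ a * (b * q) - b * (a * m)
        e = solve-∀ ℚ-ring
      above : Below x iq → ¬ P q
      above i∈ (r , r∉ , lt) = ℚP.<-irrefl refl (ℚP.<-trans lt (subst (_< q * r) iq-eq
        (by< (*>0 (ℚP.<-trans 0<m m<q) (<⇒0< (in<out x i∈ r∉))) (e iq q r))))
        where
        e : ∀ i q r → q * (r - i) ≡ q * r - i * q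
        e = solve-∀ ℚ-ring
      below : ¬ Below x im → P p
      below i∉ = im , i∉ , subst (p * im <_) (trans (ℚP.*-comm m im) im-eq)
        (by< (*>0 (<⇒0< p<m) 0<im) (d p m im))

root : (k : ℕ) .{{_ : ℕ.NonZero k}} (x : ℝ) → 0ℝ <ℝ x → ℝ
root (suc k) x 0<x = record
  { Below     = P
  ; inhabited = 0ℚ , zero∈
  ; bounded   = 1ℚ ⊔ hi X , bnd
  ; downward  = λ { p<q (r , q<r , 0<r , r∈) → r , ℚP.<-trans p<q q<r , 0<r , r∈ }
  ; rounded   = λ { (r , p<r , 0<r , r∈) →
                    let q , p<q , q<r = ℚP.<-dense p<r in q , p<q , r , q<r , 0<r , r∈ }
  ; located   = loc
  }
  where
  X = initial x
  P : ℚ → Set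
  P q = ∃ λ r → q < r × 0ℚ < r × Below x (r ^ suc k)

  zero∈ : P 0ℚ
  zero∈ = r , 0<r , 0<r , downward-≤ x
    (ℚP.≤-trans (^suc≤ k (ℚP.<⇒≤ 0<r) (ℚP.p⊓q≤q a 1ℚ)) (ℚP.p⊓q≤p a 1ℚ))
    (proj₂ (proj₂ (positiveBelow x 0<x)))
    where
    a = proj₁ (positiveBelow x 0<x)
    r = a ⊓ 1ℚ
    0<r : 0ℚ < r
    0<r = ⊓-glb (proj₁ (proj₂ (positiveBelow x 0<x))) 0<1

  bnd : ¬ P (1ℚ ⊔ hi X)
  bnd (r , lt , _ , r∈) = hi∉ X (downward-≤ x
    (ℚP.≤-trans (ℚP.≤-trans (ℚP.p≤q⊔p 1ℚ (hi X)) (ℚP.<⇒≤ lt))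
                (≤^suc k (ℚP.≤-trans (ℚP.p≤p⊔q 1ℚ (hi X)) (ℚP.<⇒≤ lt)))) r∈)

  loc : ∀ {p q} → p < q → P p ⊎ ¬ P q
  loc {p} {q} p<q = sign (p ℚP.≤? 0ℚ)
    where
    sign : Dec (p ≤ 0ℚ) → P p ⊎ ¬ P q
    sign (yes p≤0) = let r , 0<r , _ , r∈ = zero∈ in inj₁ (r , ℚP.≤-<-trans p≤0 0<r , 0<r , r∈)
    sign (no p≰0) = [ (λ m∈ → inj₁ (m , p<m , 0<m , m∈)) , inj₂ ∘ above ]′
                      (located x (^-mono-< k 0<m m<q))
      where
      mid = ℚP.<-dense p<q
      m   = proj₁ mid
      p<m = proj₁ (proj₂ mid)
      m<q = proj₂ (proj₂ mid)
      0<m : 0ℚ < m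
      0<m = ℚP.<-trans (ℚP.≰⇒> p≰0) p<m
      above : ¬ Below x (q ^ suc k) → ¬ P q
      above q∉ (r , q<r , _ , r∈) =
        q∉ (downward x (^-mono-< k (ℚP.<-trans 0<m m<q) q<r) r∈)

-- e^r ≤ s, as the terms (1 + r/m)^m with m ≥ 1 and m > -r increase to e^r.
Exp≤ : ℚ → ℚ → Set
Exp≤ r s = ∀ m → 0ℚ < 1ℚ + r * unitFraction m → (1ℚ + r * unitFraction m) ^ suc m ≤ s

module ExponentialFacts where
  module _ (m : ℕ) (x : ℚ) (0<1+x : 0ℚ < 1ℚ + x) where
    u : ℚ
    u = unitFraction m

    part≥0 : 0ℚ ≤ 1ℚ + x * u
    part≥0 = subst (0ℚ ≤_) (e x (unitFraction m))
      (+≥0 (≤⇒0≤ (unit≤1 m)) (*≥0 (ℚP.<⇒≤ 0<1+x) (ℚP.<⇒≤ (unit>0 m))))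
      where
      e : ∀ x u → (1ℚ - u) + (1ℚ + x) * u ≡ 1ℚ + x * u
      e = solve-∀ ℚ-ring

    bernoulli-part : 1ℚ + x ≤ (1ℚ + x * u) ^ suc m
    bernoulli-part = subst (_≤ (1ℚ + x * u) ^ suc m)
      (go (fromℕ (suc m)) (unitFraction m) (fromℕ-unit m)) (bernoulli (suc m) part≥0)
      where
      e : ∀ f x u → 1ℚ + f * (1ℚ + x * u - 1ℚ) ≡ 1ℚ + x * (f * u)
      e = solve-∀ ℚ-ring
      go : ∀ f u → f * u ≡ 1ℚ → 1ℚ + f * (1ℚ + x * u - 1ℚ) ≡ 1ℚ + x
      go f u fu = trans (e f x u) (cong (λ z → 1ℚ + z) (trans (cong (x *_) fu) (ℚP.*-identityʳ x)))

  exp-product≤1 : ∀ r M m →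
    0ℚ < 1ℚ + r * unitFraction M → 0ℚ < 1ℚ + (- (r * unitFraction m)) →
    (1ℚ + r * unitFraction M) ^ suc M * (1ℚ + (- (r * unitFraction m))) ^ suc m ≤ 1ℚ
  exp-product≤1 r M m 0<s 0<w =
    go (1ℚ + r * unitFraction M) (1ℚ + (- (r * unitFraction m)))
       (1ℚ + r * unitFraction M * unitFraction m)
       (1ℚ + (- (r * unitFraction m)) * unitFraction M)
       (ℚP.<⇒≤ 0<s) (ℚP.<⇒≤ 0<w)
       (part≥0 m (r * unitFraction M) 0<s) (part≥0 M (- (r * unitFraction m)) 0<w)
       (bernoulli-part m (r * unitFraction M) 0<s) (bernoulli-part M (- (r * unitFraction m)) 0<w)
       (prod r (unitFraction M) (unitFraction m))
    where
    prod : ∀ r U u → (1ℚ + r * U * u) * (1ℚ + (- (r * u)) * U) ≤ 1ℚ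
    prod r U u = by≤ (^2≥0 (r * U * u)) (e r U u)
      where
      e : ∀ r U u → r * U * u * (r * U * u) ≡ 1ℚ - (1ℚ + r * U * u) * (1ℚ + (- (r * u)) * U)
      e = solve-∀ ℚ-ring
    go : ∀ s w t v → 0ℚ ≤ s → 0ℚ ≤ w → 0ℚ ≤ t → 0ℚ ≤ v →
         s ≤ t ^ suc m → w ≤ v ^ suc M → t * v ≤ 1ℚ → s ^ suc M * w ^ suc m ≤ 1ℚ
    go s w t v 0≤s 0≤w 0≤t 0≤v s≤ w≤ tv≤1 = ℚP.≤-trans
      (*-mono-≤ {s ^ suc M} {t ^ N} {w ^ suc m} {v ^ N}
        (^≥0 (suc M) 0≤s)
        (subst (s ^ suc M ≤_) (^-assocʳ t (suc m) (suc M)) (^-mono-≤ (suc M) 0≤s s≤))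
        (^≥0 (suc m) 0≤w)
        (subst (w ^ suc m ≤_)
          (trans (^-assocʳ v (suc M) (suc m)) (cong (v ^_) (ℕP.*-comm (suc M) (suc m))))
          (^-mono-≤ (suc m) 0≤w w≤)))
      (subst (_≤ 1ℚ) (^-distrib-* t v N) (^≤1 N (*≥0 0≤t 0≤v) tv≤1))
      where
      N = suc m ℕ.* suc M

  exp-upper : ∀ r m z → 0ℚ < z → 0ℚ < 1ℚ + (- (r * unitFraction m)) →
              z * (1ℚ + (- (r * unitFraction m))) ^ suc m ≡ 1ℚ → Exp≤ r z
  exp-upper r m z 0<z 0<w zw M 0<s =
    go ((1ℚ + r * unitFraction M) ^ suc M) ((1ℚ + (- (r * unitFraction m))) ^ suc m)
       (exp-product≤1 r M m 0<s 0<w) zw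
    where
    e : ∀ S W z → z * (1ℚ - S * W) ≡ z - S * (z * W)
    e = solve-∀ ℚ-ring
    go : ∀ S W → S * W ≤ 1ℚ → z * W ≡ 1ℚ → S ≤ z
    go S W SW zW = by≤ (*≥0 (ℚP.<⇒≤ 0<z) (≤⇒0≤ SW))
      (trans (e S W z) (cong (λ y → z - y) (trans (cong (S *_) zW) (ℚP.*-identityʳ S))))

  -- Two bounds of the exponential that separate e^p from e^q.
  exp-gap : ∀ {p q} → p < q → ∃ λ a → ∃ λ m →
            Exp≤ p a × 0ℚ < 1ℚ + q * unitFraction m × a < (1ℚ + q * unitFraction m) ^ suc m
  exp-gap {p} {q} p<q =
    z , m , exp-upper p m z 0<z 0<w zw , 0<t , gap
    where
    K = ℚ.∣ p ∣ + ℚ.∣ q ∣ + ℚ.∣ p * q ∣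
    d = 1ℚ ⊓ (q - p)
    0<d : 0ℚ < d
    0<d = ⊓-glb 0<1 (<⇒0< p<q)
    m = proj₁ (archimedean-unit K 0<d)
    small : ∀ {y} → y ≤ K → y * unitFraction m < d
    small {y} y≤K = ℚP.≤-<-trans
      (by≤ (*≥0 (≤⇒0≤ y≤K) (ℚP.<⇒≤ (unit>0 m))) (e y K (unitFraction m)))
      (proj₂ (archimedean-unit K 0<d))
      where
      e : ∀ y K u → (K - y) * u ≡ K * u - y * u
      e = solve-∀ ℚ-ring
    p≤K : p ≤ K
    p≤K = by≤ (+≥0 (+≥0 (≤⇒0≤ (p≤∣p∣ p)) (ℚP.0≤∣p∣ q)) (ℚP.0≤∣p∣ (p * q)))
              (e p ℚ.∣ p ∣ ℚ.∣ q ∣ ℚ.∣ p * q ∣)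
      where
      e : ∀ p a b c → (a - p) + b + c ≡ (a + b + c) - p
      e = solve-∀ ℚ-ring
    -q≤K : - q ≤ K
    -q≤K = by≤ (+≥0 (+≥0 (ℚP.0≤∣p∣ p) (≤⇒0≤ (-p≤∣p∣ q))) (ℚP.0≤∣p∣ (p * q)))
               (e q ℚ.∣ p ∣ ℚ.∣ q ∣ ℚ.∣ p * q ∣)
      where
      e : ∀ q a b c → a + (b - (- q)) + c ≡ (a + b + c) - (- q)
      e = solve-∀ ℚ-ring
    pq≤K : p * q ≤ K
    pq≤K = by≤ (+≥0 (+≥0 (ℚP.0≤∣p∣ p) (ℚP.0≤∣p∣ q)) (≤⇒0≤ (p≤∣p∣ (p * q))))
               (e (p * q) ℚ.∣ p ∣ ℚ.∣ q ∣ ℚ.∣ p * q ∣)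
      where
      e : ∀ y a b c → a + b + (c - y) ≡ (a + b + c) - y
      e = solve-∀ ℚ-ring
    0<w : 0ℚ < 1ℚ + (- (p * unitFraction m))
    0<w = <⇒0< (ℚP.<-≤-trans (small p≤K) (ℚP.p⊓q≤p 1ℚ (q - p)))
    0<t : 0ℚ < 1ℚ + q * unitFraction m
    0<t = subst (0ℚ <_) (e q (unitFraction m))
            (<⇒0< (ℚP.<-≤-trans (small -q≤K) (ℚP.p⊓q≤p 1ℚ (q - p))))
      where
      e : ∀ q u → 1ℚ - (- q) * u ≡ 1ℚ + q * u
      e = solve-∀ ℚ-ring
    W = (1ℚ + (- (p * unitFraction m))) ^ suc m
    0<W : 0ℚ < W
    0<W = ^>0 (suc m) 0<w
    z = proj₁ (inverse 0<W)
    0<z : 0ℚ < z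
    0<z = proj₁ (proj₂ (inverse 0<W))
    zw : z * W ≡ 1ℚ
    zw = proj₂ (proj₂ (inverse 0<W))
    1<tw : 1ℚ < (1ℚ + q * unitFraction m) * (1ℚ + (- (p * unitFraction m)))
    1<tw = by< (*>0 (unit>0 m) (<⇒0< (ℚP.<-≤-trans (small pq≤K) (ℚP.p⊓q≤q 1ℚ (q - p)))))
               (e p q (unitFraction m))
      where
      e : ∀ p q u → u * ((q - p) - p * q * u) ≡ (1ℚ + q * u) * (1ℚ + (- (p * u))) - 1ℚ
      e = solve-∀ ℚ-ring
    1<^ : ∀ {y} → 1ℚ < y → 1ℚ < y ^ suc m
    1<^ {y} 1<y = subst (_< y ^ suc m) (1^ (suc m)) (^-mono-< m 0<1 1<y)
    gap : z < (1ℚ + q * unitFraction m) ^ suc m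
    gap = go ((1ℚ + q * unitFraction m) ^ suc m) W zw
            (subst (1ℚ <_) (^-distrib-* (1ℚ + q * unitFraction m)
                                        (1ℚ + (- (p * unitFraction m))) (suc m)) (1<^ 1<tw))
      where
      e : ∀ T W z → z * (T * W - 1ℚ) ≡ T * (z * W) - z
      e = solve-∀ ℚ-ring
      go : ∀ T W → z * W ≡ 1ℚ → 1ℚ < T * W → z < T
      go T W zW lt = by< (*>0 0<z (<⇒0< lt))
        (trans (e T W z) (cong (_- z) (trans (cong (T *_) zW) (ℚP.*-identityʳ T))))

open ExponentialFacts

-- q < ln x when e^r ≤ s for some rationals r > q and s < x.
ln : (x : ℝ) → 0ℝ <ℝ x → ℝ
ln x 0<x = record
  { Below     = P
  ; inhabited = inh
  ; bounded   = 0ℚ ⊔ hi X , bnd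
  ; downward  = λ { p<q (r , s , q<r , s∈ , h) → r , s , ℚP.<-trans p<q q<r , s∈ , h }
  ; rounded   = λ { (r , s , p<r , s∈ , h) →
                    let q , p<q , q<r = ℚP.<-dense p<r in q , p<q , r , s , q<r , s∈ , h }
  ; located   = loc
  }
  where
  X = initial x
  P : ℚ → Set
  P q = ∃₂ λ r s → q < r × Below x s × Exp≤ r s

  inh : ∃ P
  inh = 1ℚ - i - 1ℚ , 1ℚ - i , s , by< 0<1 (e (1ℚ - i)) , proj₂ (proj₂ (positiveBelow x 0<x)) ,
        exp-upper (1ℚ - i) 0 s 0<s (subst (0ℚ <_) (sym (w i)) 0<i)
          (trans (cong (λ y → s * (y * 1ℚ)) (w i))
                 (trans (cong (s *_) (ℚP.*-identityʳ i)) (trans (ℚP.*-comm s i) is)))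
    where
    s   = proj₁ (positiveBelow x 0<x)
    0<s : 0ℚ < s
    0<s = proj₁ (proj₂ (positiveBelow x 0<x))
    i   = proj₁ (inverse 0<s)
    0<i : 0ℚ < i
    0<i = proj₁ (proj₂ (inverse 0<s))
    is : i * s ≡ 1ℚ
    is = proj₂ (proj₂ (inverse 0<s))
    e : ∀ z → 1ℚ ≡ z - (z - 1ℚ)
    e = solve-∀ ℚ-ring
    w : ∀ i → 1ℚ + (- ((1ℚ - i) * unitFraction 0)) ≡ i
    w i = trans (cong (λ y → 1ℚ + (- y)) (ℚP.*-identityʳ (1ℚ - i))) (e′ i)
      where
      e′ : ∀ i → 1ℚ + (- (1ℚ - i)) ≡ i
      e′ = solve-∀ ℚ-ring

  bnd : ¬ P (0ℚ ⊔ hi X)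
  bnd (r , s , lt , s∈ , h) = hi∉ X (downward-≤ x hi≤s s∈)
    where
    0<r : 0ℚ < r
    0<r = ℚP.≤-<-trans (ℚP.p≤p⊔q 0ℚ (hi X)) lt
    one : ∀ r → 1ℚ + r * unitFraction 0 ≡ 1ℚ + r
    one r = cong (λ y → 1ℚ + y) (ℚP.*-identityʳ r)
    1+r≤s : 1ℚ + r ≤ s
    1+r≤s = subst (_≤ s) (trans (ℚP.*-identityʳ _) (one r))
      (h 0 (subst (0ℚ <_) (sym (one r)) (+>0 0<1 0<r)))
    hi≤s : hi X ≤ s
    hi≤s = ℚP.≤-trans (ℚP.≤-trans (ℚP.p≤q⊔p 0ℚ (hi X)) (ℚP.<⇒≤ lt))
      (ℚP.≤-trans (by≤ (ℚP.<⇒≤ 0<1) (e r)) 1+r≤s)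
      where
      e : ∀ r → 1ℚ ≡ 1ℚ + r - r
      e = solve-∀ ℚ-ring

  loc : ∀ {p q} → p < q → P p ⊎ ¬ P q
  loc {p} {q} p<q = go (ℚP.<-dense p<q)
    where
    go : (∃ λ p′ → p < p′ × p′ < q) → P p ⊎ ¬ P q
    go (p′ , p<p′ , p′<q) = go′ (exp-gap p′<q)
      where
      go′ : (∃ λ a → ∃ λ m → Exp≤ p′ a × 0ℚ < 1ℚ + q * unitFraction m ×
               a < (1ℚ + q * unitFraction m) ^ suc m) → P p ⊎ ¬ P q
      go′ (a , m , h , 0<t , a<b) = [ (λ a∈ → inj₁ (p′ , a , p<p′ , a∈ , h)) , inj₂ ∘ above ]′
                                      (located x a<b)
        where
        above : ¬ Below x ((1ℚ + q * unitFraction m) ^ suc m) → ¬ P q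
        above b∉ (r , s , q<r , s∈ , h) = b∉ (downward-≤ x
          (ℚP.≤-trans (^-mono-≤ (suc m) (ℚP.<⇒≤ 0<t) (ℚP.<⇒≤ t<t′)) (h m (ℚP.<-trans 0<t t<t′))) s∈)
          where
          e : ∀ q r u → (r - q) * u ≡ (1ℚ + r * u) - (1ℚ + q * u)
          e = solve-∀ ℚ-ring
          t<t′ : 1ℚ + q * unitFraction m < 1ℚ + r * unitFraction m
          t<t′ = by< (*>0 (<⇒0< q<r) (unit>0 m)) (e q r (unitFraction m))

*ℝ-positive : ∀ x y → 0ℝ <ℝ x → 0ℝ <ℝ y → 0ℝ <ℝ (x *ℝ y)
*ℝ-positive x y 0<x 0<y = 0ℚ , ℚP.<-irrefl refl ,
  lo X , hi X , lo Y , hi Y , lo∈ X , hi∉ X , lo∈ Y , hi∉ Y ,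
  *>0 0<a 0<b , *>0 0<a 0<B , *>0 0<A 0<b , *>0 0<A 0<B
  where
  X : Bracket x
  X = bracket (proj₂ (proj₂ (positiveBelow x 0<x))) (hi∉ (initial x))
  Y : Bracket y
  Y = bracket (proj₂ (proj₂ (positiveBelow y 0<y))) (hi∉ (initial y))
  0<a = proj₁ (proj₂ (positiveBelow x 0<x))
  0<b = proj₁ (proj₂ (positiveBelow y 0<y))
  0<A = ℚP.<-≤-trans 0<a (lo≤hi X)
  0<B = ℚP.<-≤-trans 0<b (lo≤hi Y)

fromℕℝ-positive : ∀ n .{{_ : ℕ.NonZero n}} → 0ℝ <ℝ fromℕℝ n
fromℕℝ-positive (suc n) = 0ℚ , ℚP.<-irrefl refl , fromℕ>0 n

>3⇒positive : ∀ c → fromℕℝ 3 <ℝ c → 0ℝ <ℝ c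
>3⇒positive _ (q , q≮3 , q∈) = q , (λ q<0 → q≮3 (ℚP.<-trans q<0 (fromℕ>0 2))) , q∈

record Graph (V : Set) : Set₁ where
  field
    _~_      : V → V → Set
    ~-sym    : ∀ {u v} → u ~ v → v ~ u
    ~-irrefl : ∀ {v} → ¬ v ~ v

data Walk {V : Set} (G : Graph V) : V → V → ℕ → Set where
  []  : ∀ {v} → Walk G v v 0
  _∷_ : ∀ {u v w ℓ} → Graph._~_ G u v → Walk G v w ℓ → Walk G u w (suc ℓ)

Distance : {V : Set} → Graph V → V → V → ℕ → Set
Distance G u v d = Walk G u v d × (∀ {ℓ} → Walk G u v ℓ → d ℕ.≤ ℓ)

Colouring : {V : Set} → Graph V → ℕ → Set
Colouring {V} G m = Σ (V → Fin m) λ colour → ∀ {u v} → Graph._~_ G u v → colour u ≢ colour v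

induced : {V : Set} → Graph V → (P : V → Set) → Graph (∃ P)
induced G P = record
  { _~_      = λ u v → proj₁ u ~ proj₁ v
  ; ~-sym    = ~-sym
  ; ~-irrefl = ~-irrefl
  }
  where open Graph G

-- A disconnected G(C) has infinite strong diameter, hence the distance
-- is required to exist.
StrongDiameter≤ : {V : Set} → Graph V → (V → Set) → ℕ → Set
StrongDiameter≤ G C D =
  (u v : ∃ C) → ∃ λ d → Distance (induced G C) u v d × d ℕ.≤ D

-- A partition of V is given by the name of the cluster of each vertex.
-- Irrelevance of the second field makes clusters with equal names equal.
record Cluster {V : Set} (label : V → ℕ) : Set where
  constructor cluster
  field
    name      : ℕ
    .nonempty : ∃ λ v → label v ≡ name

Member : {V : Set} (label : V → ℕ) → Cluster label → V → Set
Member label C v = label v ≡ Cluster.name C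

supergraph : {V : Set} → Graph V → (label : V → ℕ) → Graph (Cluster label)
supergraph G label = record
  { _~_      = λ C C′ → C ≢ C′ × ∃₂ λ u v → Member label C u × Member label C′ v × u ~ v
  ; ~-sym    = λ { (C≢C′ , u , v , u∈ , v∈ , e) → C≢C′ ∘ sym , v , u , v∈ , u∈ , ~-sym e }
  ; ~-irrefl = λ { (C≢C , _) → C≢C refl }
  }
  where open Graph G

StrongDecomposition : {V : Set} → Graph V → (V → ℕ) → ℕ → ℝ → Set
StrongDecomposition G label D χ =
  ((C : Cluster label) → StrongDiameter≤ G (Member label C) D) ×
  ∃ λ m → fromℕℝ m ≤ℝ χ × Colouring (supergraph G label) m

-- Every vertex reaches its neighbours through locally numbered ports; the
-- numbering is arbitrary and carries no information about identities.
record PortNumbering {n : ℕ} (G : Graph (Fin n)) : Set where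
  open Graph G
  field
    degree              : Fin n → ℕ
    neighbour           : ∀ v → Fin (degree v) → Fin n
    neighbour-injective : ∀ v {i j} → neighbour v i ≡ neighbour v j → i ≡ j
    adjacent            : ∀ v i → v ~ neighbour v i
    port                : ∀ {v w} → v ~ w → Fin (degree v)
    neighbour-port      : ∀ {v w} (e : v ~ w) → neighbour v (port e) ≡ w

Message : Set
Message = List Bool

-- The code run by every vertex of an n-vertex graph.  A vertex starts
-- knowing its identity, its degree d and its own fair coin flips; receive
-- is given the messages that arrived in one round, indexed by port; the
-- output, read after the last round, is the name of the vertex's cluster.
record Algorithm (n : ℕ) : Set₁ where
  field
    coins   : ℕ
    rounds  : ℕ
    State   : (d : ℕ) → Set
    init    : ∀ {d} → Fin n → Fin (2 ℕ.^ coins) → State d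
    send    : ∀ {d} → State d → Fin d → Message
    receive : ∀ {d} → State d → (Fin d → Message) → State d
    output  : ∀ {d} → State d → ℕ

  -- Outcomes of all coin flips; outcome ω gives vertex v the flips finToFun ω v.
  outcomes : ℕ
  outcomes = (2 ℕ.^ coins) ℕ.^ n

  instance
    outcomes-nonZero : ℕ.NonZero outcomes
    outcomes-nonZero = ℕP.m^n≢0 (2 ℕ.^ coins) n {{ℕP.m^n≢0 2 coins}}

-- Distinct identities from {1,…,n} are a bijection with the vertices, so a
-- vertex v : Fin n is its own identity.
module Execution {n : ℕ} (A : Algorithm n) {G : Graph (Fin n)} (N : PortNumbering G)
                 (ω : Fin (Algorithm.outcomes A)) where
  open Algorithm A
  open Graph G
  open PortNumbering N

  state   : ℕ → (v : Fin n) → State (degree v)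
  message : ℕ → (v : Fin n) → Fin (degree v) → Message

  state zero    v = init v (finToFun ω v)
  state (suc t) v = receive (state t v)
    λ i → message t (neighbour v i) (port (~-sym (adjacent v i)))

  message t v = send (state t v)

  label : Fin n → ℕ
  label v = output (state rounds v)

  -- A word has ⌈log₂ n⌉ bits.
  MessagesWithin : ℕ → Set
  MessagesWithin words = ∀ t v i → t ℕ.< rounds →
    length (message t v i) ℕ.≤ words ℕ.* ℕL.⌈log₂ n ⌉

-- Under the uniform distribution on Fin N the event E contains a set of
-- probability at least p.  For decidable E this is Pr(E) ≥ p; it avoids
-- asking for a decision procedure for E.
Probability≥ : (N : ℕ) .{{_ : ℕ.NonZero N}} → (Fin N → Set) → ℝ → Set
Probability≥ N E p = ∃ λ (S : Subset N) →
  (∀ {ω} → ω ∈ S → E ω) × p ≤ℝ fromℚ (+ ∣ S ∣ / N)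

record Parameters : Set₁ where
  field
    n k             : ℕ
    c               : ℝ
    {{n-nonZero}}   : ℕ.NonZero n
    {{k-nonZero}}   : ℕ.NonZero k
    k≤ln[n]         : fromℕℝ k ≤ℝ ln (fromℕℝ n) (fromℕℝ-positive n)
    3<c             : fromℕℝ 3 <ℝ c

  c>0 : 0ℝ <ℝ c
  c>0 = >3⇒positive c 3<c

  cn : ℝ
  cn = c *ℝ fromℕℝ n

  cn>0 : 0ℝ <ℝ cn
  cn>0 = *ℝ-positive c (fromℕℝ n) c>0 (fromℕℝ-positive n)

module Submission where

-- The graph is carved in phases of k rounds.  In a phase every surviving
-- vertex v draws a geometric radius r(v) with success probability p slightly
-- above (cn)^(-1/k) and broadcasts the value r(v) + 1 - d(y,v) to every y
-- (ties are broken by identities).  A vertex y joins the cluster of v when the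
-- value of v exceeds every other value by more than 1.  The gap makes different
-- clusters of one phase non-adjacent and is inherited along shortest paths to
-- v, so as long as no radius exceeds k the clusters are connected and have
-- radius at most k - 1.  By memorylessness, raising the radius of the current
-- leader by one turns it into a winner, so a vertex survives a phase with
-- probability at most 1 - p.  Hence a radius above k occurs with probability at
-- most n Σ (1 - p)^t p^(k+1) ≤ n p^k, and some vertex survives all λ phases with
-- probability at most n (1 - p)^λ.  With λ at least (cn)^(1/k) ln(cn) - 1 - ε
-- the two bounds add up to less than 3/c, because k ≤ ln n forces p ≤ 4/9.
-- Only the two largest values of distinct origins have to be forwarded, which
-- keeps the messages short.

open import Defs

-- Two obstacles shape the proof. Coins are fair and finitely many, so `p` is a dyadic `a / B` and a
-- radius is cut off at `k + 1`. The cut disturbs memorylessness only when all `k + 1` coins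
-- succeed; for a survivor such a draw counts as a failure anyway, so a leader at the cap may be
-- declared a winner for free. The failure bound per survivor then obeys a recursion over the
-- remaining phases that `(1 - p)^T + p^k` solves exactly. The bounds `(cn)^(1/k)` and `ln (cn)` are
-- cuts, comparable with rationals only up to some slack, and the number of phases has to be an
-- integer below their product. With `c` bracketed between `c₀` and `C`, the choices give
-- `C n p^k ≤ 21/20` and `C n (1 - p)^(m+1) ≤ 21/20` for `m` phases. The phase lost to rounding
-- costs a factor `1 / (1 - p)`, which `p ≤ 4/9` keeps at most `9/5`.

module Carving where
  open import Data.Bool.Base using (Bool; if_then_else_; true; false)
  open import Data.Fin.Base as Fin
    using (Fin; combine; finToFun; fromℕ<; quotient; remainder; suc; toℕ; zero; _↑ʳ_; _↑ˡ_)
  open import Data.Fin.Properties as FinP using (any?; all?; remQuot-combine; toℕ-injective; toℕ<n)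
  open import Data.List.Base using (List; []; _∷_; allFin; length)
  open import Data.List.Membership.Propositional.Properties using (∈-allFin)
  import Data.List.Relation.Unary.All as All
  open import Data.Maybe.Base using (Maybe; fromMaybe; just; nothing)
  open import Data.Nat.Base
  open import Data.Nat.DivMod
  open import Data.Nat.Divisibility using (n∣m*n)
  import Data.Nat.Logarithm as Log
  open import Data.Nat.Properties
  open import Data.Nat.Tactic.RingSolver using (solve-∀)
  open import Data.List.Extrema ≤-totalOrder using (argmax; f[⊥]≤f[argmax]; f[xs]≤f[argmax])
  open import Algebra.Properties.Semiring.Sum +-*-semiring
    using (sum; sum-cong-≗; ∑-comm; ∑-distrib-+; *-distribʳ-sum; *-distribˡ-sum)
  open import Data.Product using (Σ; ∃; ∃₂; _×_; _,_; proj₁; proj₂)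
  open import Data.Sum.Base using (_⊎_; inj₁; inj₂; [_,_]′)
  open import Data.Vec.Base using (Vec; []; _∷_; lookup; map; tabulate; zipWith; _[_]≔_)
  open import Data.Vec.Properties using (lookup-map; lookup∘tabulate; lookup∘update; lookup∘update′)
  open import Function.Base using (_∘_; id)
  open import Relation.Binary.PropositionalEquality
  open import Relation.Nullary using (¬_; Dec; yes; no; contradiction)
  open import Relation.Nullary.Decidable using (¬?; map′; _×-dec_; _⊎-dec_; _→-dec_)

  -- Finite sums and counting over random vectors

  *-left-comm : ∀ x y z → x * (y * z) ≡ y * (x * z)
  *-left-comm = solve-∀

  ∑-mono : ∀ {n} {f g : Fin n → ℕ} → (∀ i → f i ≤ g i) → sum f ≤ sum g
  ∑-mono {zero}  f≤g = z≤n
  ∑-mono {suc n} f≤g = +-mono-≤ (f≤g zero) (∑-mono (f≤g ∘ suc))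

  ∑-const : ∀ n c → sum {n} (λ _ → c) ≡ n * c
  ∑-const zero    c = refl
  ∑-const (suc n) c = cong (c +_) (∑-const n c)

  term≤∑ : ∀ {n} (f : Fin n → ℕ) i → f i ≤ sum f
  term≤∑ f zero    = m≤m+n _ _
  term≤∑ f (suc i) = ≤-trans (term≤∑ (f ∘ suc) i) (m≤n+m _ _)

  ∑-↑ : ∀ m {n} (f : Fin (m + n) → ℕ) →
        sum f ≡ sum (λ i → f (i ↑ˡ n)) + sum (λ j → f (m ↑ʳ j))
  ∑-↑ zero    f = refl
  ∑-↑ (suc m) f = trans (cong (f zero +_) (∑-↑ m (f ∘ suc))) (sym (+-assoc (f zero) _ _))

  ∑-combine : ∀ m {n} (f : Fin (m * n) → ℕ) →
              sum f ≡ sum {m} λ i → sum {n} λ j → f (combine i j)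
  ∑-combine zero        f = refl
  ∑-combine (suc m) {n} f =
    trans (∑-↑ n f) (cong (sum (λ j → f (j ↑ˡ (m * n))) +_) (∑-combine m (λ j → f (n ↑ʳ j))))

  quotient-combine : ∀ {m n} (i : Fin m) (j : Fin n) → quotient n (combine i j) ≡ i
  quotient-combine i j = cong proj₁ (remQuot-combine i j)

  remainder-combine : ∀ {m n} (i : Fin m) (j : Fin n) → remainder {m} n (combine i j) ≡ j
  remainder-combine i j = cong proj₂ (remQuot-combine i j)

  -- Outcomes are counted as vectors with one entry per vertex, so that a single entry can be
  -- redrawn; `∑-finToFun` returns to the encoded outcomes.
  ∑Vec : ∀ q n → (Vec (Fin q) n → ℕ) → ℕ
  ∑Vec q zero    f = f []
  ∑Vec q (suc n) f = sum {q} λ z → ∑Vec q n λ x → f (z ∷ x)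

  module _ {q : ℕ} where
    ∑Vec-mono : ∀ {n} {f g : Vec (Fin q) n → ℕ} → (∀ x → f x ≤ g x) → ∑Vec q n f ≤ ∑Vec q n g
    ∑Vec-mono {zero}  f≤g = f≤g []
    ∑Vec-mono {suc n} f≤g = ∑-mono λ z → ∑Vec-mono λ x → f≤g (z ∷ x)

    ∑Vec-cong : ∀ {n} {f g : Vec (Fin q) n → ℕ} → (∀ x → f x ≡ g x) → ∑Vec q n f ≡ ∑Vec q n g
    ∑Vec-cong {zero}  f≡g = f≡g []
    ∑Vec-cong {suc n} f≡g = sum-cong-≗ λ z → ∑Vec-cong λ x → f≡g (z ∷ x)

    ∑Vec-const : ∀ n c → ∑Vec q n (λ _ → c) ≡ q ^ n * c
    ∑Vec-const zero    c = sym (*-identityˡ c)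
    ∑Vec-const (suc n) c = trans (sum-cong-≗ {q} λ _ → ∑Vec-const n c)
      (trans (∑-const q _) (sym (*-assoc q (q ^ n) c)))

    ∑Vec-distrib-+ : ∀ n (f g : Vec (Fin q) n → ℕ) →
                     ∑Vec q n (λ x → f x + g x) ≡ ∑Vec q n f + ∑Vec q n g
    ∑Vec-distrib-+ zero    f g = refl
    ∑Vec-distrib-+ (suc n) f g =
      trans (sum-cong-≗ {q} λ z → ∑Vec-distrib-+ n (λ x → f (z ∷ x)) (λ x → g (z ∷ x)))
            (∑-distrib-+ {q} _ _)

    *-distribˡ-∑Vec : ∀ n c (f : Vec (Fin q) n → ℕ) → c * ∑Vec q n f ≡ ∑Vec q n λ x → c * f x
    *-distribˡ-∑Vec zero    c f = refl
    *-distribˡ-∑Vec (suc n) c f = trans (*-distribˡ-sum {q} c _)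
      (sum-cong-≗ {q} λ z → *-distribˡ-∑Vec n c (λ x → f (z ∷ x)))

    ∑Vec-∑-comm : ∀ n m (f : Fin m → Vec (Fin q) n → ℕ) →
                  ∑Vec q n (λ x → sum λ i → f i x) ≡ sum λ i → ∑Vec q n (f i)
    ∑Vec-∑-comm zero    m f = refl
    ∑Vec-∑-comm (suc n) m f =
      trans (sum-cong-≗ {q} λ z → ∑Vec-∑-comm n m (λ i x → f i (z ∷ x))) (∑-comm {q} {m} _)

    -- Overwriting one entry by a fresh uniform value preserves the uniform distribution; the factor
    -- `q` counts the forgotten old values. This randomises one radius while all others stay fixed.
    ∑Vec-resample : ∀ {n} (v : Fin n) (f : Vec (Fin q) n → ℕ) →
                    q * ∑Vec q n f ≡ ∑Vec q n λ x → sum λ z → f (x [ v ]≔ z)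
    ∑Vec-resample {suc n} zero f =
      trans (sym (∑-const q _)) (sum-cong-≗ {q} λ _ → sym (∑Vec-∑-comm n q _))
    ∑Vec-resample {suc n} (suc v) f = trans (*-distribˡ-sum {q} q _)
      (sum-cong-≗ {q} λ z → ∑Vec-resample v (λ x → f (z ∷ x)))

  -- Separates, for all vertices at once, the randomness of the present phase from that of the later
  -- ones.
  ∑Vec-combine : ∀ q r n (f : Vec (Fin (q * r)) n → ℕ) →
    ∑Vec (q * r) n f ≡ ∑Vec q n λ x → ∑Vec r n λ y → f (zipWith combine x y)
  ∑Vec-combine q r zero    f = refl
  ∑Vec-combine q r (suc n) f = trans (∑-combine q _) (sum-cong-≗ {q} λ z →
    trans (sum-cong-≗ {r} λ w → ∑Vec-combine q r n (λ x → f (combine z w ∷ x)))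
          (sym (∑Vec-∑-comm n r λ w x → ∑Vec r n λ y → f (combine z w ∷ zipWith combine x y))))

  ∑-finToFun : ∀ q n (f : Vec (Fin q) n → ℕ) →
    sum (λ (ω : Fin (q ^ n)) → f (tabulate (finToFun ω))) ≡ ∑Vec q n f
  ∑-finToFun q zero    f = +-identityʳ _
  ∑-finToFun q (suc n) f = trans (∑-combine q _) (sum-cong-≗ {q} λ z →
    trans (sum-cong-≗ {q ^ n} λ i → cong₂ (λ z y → f (z ∷ tabulate (finToFun y)))
            (quotient-combine z i) (remainder-combine z i))
          (∑-finToFun q n (λ x → f (z ∷ x))))

  -- Indicators of decidable events

  𝟙 : ∀ {ℓ} {P : Set ℓ} → Dec P → ℕ
  𝟙 (yes _) = 1
  𝟙 (no  _) = 0

  module _ {ℓ ℓ′} {P : Set ℓ} {Q : Set ℓ′} where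
    𝟙-mono : (P? : Dec P) (Q? : Dec Q) → (P → Q) → 𝟙 P? ≤ 𝟙 Q?
    𝟙-mono (no  _) _       _   = z≤n
    𝟙-mono (yes _) (yes _) _   = ≤-refl
    𝟙-mono (yes p) (no ¬q) P⇒Q = contradiction (P⇒Q p) ¬q

  module _ {ℓ} {P : Set ℓ} where
    𝟙≤1 : (P? : Dec P) → 𝟙 P? ≤ 1
    𝟙≤1 (yes _) = ≤-refl
    𝟙≤1 (no  _) = z≤n

    𝟙-yes : (P? : Dec P) → P → 𝟙 P? ≡ 1
    𝟙-yes (yes _) _ = refl
    𝟙-yes (no ¬p) p = contradiction p ¬p

    𝟙-no : (P? : Dec P) → ¬ P → 𝟙 P? ≡ 0
    𝟙-no (yes p) ¬p = contradiction p ¬p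
    𝟙-no (no _)  _  = refl

  𝟙-∃≤∑ : ∀ {n ℓ} {P : Fin n → Set ℓ} (P? : ∀ i → Dec (P i)) (∃P? : Dec (∃ P)) →
           𝟙 ∃P? ≤ sum λ i → 𝟙 (P? i)
  𝟙-∃≤∑ P? (no _)        = z≤n
  𝟙-∃≤∑ P? (yes (i , p)) = ≤-trans (≤-reflexive (sym (𝟙-yes (P? i) p))) (term≤∑ (λ i → 𝟙 (P? i)) i)

  ∑𝟙≤1 : ∀ {n ℓ} {P : Fin n → Set ℓ} (P? : ∀ i → Dec (P i)) →
         (∀ {i j} → P i → P j → i ≡ j) → sum (λ i → 𝟙 (P? i)) ≤ 1
  ∑𝟙≤1 {zero}  P? unique = z≤n
  ∑𝟙≤1 {suc n} P? unique with P? zero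
  ... | no  _ = ∑𝟙≤1 (P? ∘ suc) λ p q → FinP.suc-injective (unique p q)
  ... | yes p = s≤s (≤-trans (∑-mono λ i → ≤-reflexive (𝟙-no (P? (suc i)) λ q →
                       contradiction (unique p q) λ ()))
                    (≤-reflexive (trans (∑-const n 0) (*-zeroʳ n))))

  ∑𝟙≤𝟙-∃ : ∀ {n ℓ} {P : Fin n → Set ℓ} (P? : ∀ i → Dec (P i)) (∃P? : Dec (∃ P)) →
           (∀ {i j} → P i → P j → i ≡ j) → sum (λ i → 𝟙 (P? i)) ≤ 𝟙 ∃P?
  ∑𝟙≤𝟙-∃ {n} P? (no ¬p) unique = ≤-trans (∑-mono λ i → ≤-reflexive (𝟙-no (P? i) λ p → ¬p (i , p)))
                               (≤-reflexive (trans (∑-const n 0) (*-zeroʳ n)))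
  ∑𝟙≤𝟙-∃ P? (yes p) unique = ∑𝟙≤1 P? unique

  𝟙-*-mono : ∀ {ℓ} {P : Set ℓ} (P? : Dec P) {x y} → (P → x ≤ y) → 𝟙 P? * x ≤ 𝟙 P? * y
  𝟙-*-mono (no  _) _   = z≤n
  𝟙-*-mono (yes p) x≤y = *-monoʳ-≤ 1 (x≤y p)

  ∑-threshold : ∀ {B a} X Y → a ≤ B →
    sum {B} (λ i → if toℕ i <ᵇ a then X else Y) ≡ a * X + (B ∸ a) * Y
  ∑-threshold {B}     {zero}  X Y _         = ∑-const B Y
  ∑-threshold {suc B} {suc a} X Y (s≤s a≤B) =
    trans (cong (X +_) (∑-threshold X Y a≤B)) (sym (+-assoc X _ _))

  -- Truncated geometric radii

  module Geometric (B a : ℕ) (a≤B : a ≤ B) where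
    -- The number of successes before the first failure among `ℓ` coins. Each coin is a base `B`
    -- digit of the draw and succeeds when it is below `a`.
    radius : ∀ ℓ → Fin (B ^ ℓ) → ℕ
    radius zero    z = 0
    radius (suc ℓ) z =
      if toℕ (quotient {B} (B ^ ℓ) z) <ᵇ a then suc (radius ℓ (remainder {B} (B ^ ℓ) z)) else 0

    ∑-radius : ∀ ℓ (f : ℕ → ℕ) → sum (f ∘ radius (suc ℓ)) ≡
               a * sum (f ∘ suc ∘ radius ℓ) + (B ∸ a) * (B ^ ℓ * f 0)
    ∑-radius ℓ f = trans (∑-combine B _) (trans (sum-cong-≗ {B} row) (∑-threshold _ _ a≤B))
      where
      row : ∀ i → sum (λ j → f (radius (suc ℓ) (combine i j))) ≡
            (if toℕ i <ᵇ a then sum (f ∘ suc ∘ radius ℓ) else B ^ ℓ * f 0)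
      row i = trans (sum-cong-≗ {B ^ ℓ} λ j → cong₂ (λ i j → f (if toℕ i <ᵇ a then suc (radius ℓ j) else 0))
                      (quotient-combine i j) (remainder-combine i j))
                    (split (toℕ i <ᵇ a))
        where
        split : ∀ b → sum (λ j → f (if b then suc (radius ℓ j) else 0)) ≡
                (if b then sum (f ∘ suc ∘ radius ℓ) else B ^ ℓ * f 0)
        split true  = refl
        split false = ∑-const (B ^ ℓ) (f 0)

    private
      regroup : ∀ ℓ y → (B ∸ a) * (B ^ suc ℓ * y) ≡ B * ((B ∸ a) * (B ^ ℓ * y))
      regroup ℓ y = trans (cong ((B ∸ a) *_) (*-assoc B (B ^ ℓ) y))
        (trans (sym (*-assoc (B ∸ a) B _)) (trans (cong (_* (B ^ ℓ * y)) (*-comm (B ∸ a) B)) (*-assoc B (B ∸ a) _)))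

    -- The last coin matters only after `ℓ` successes, where it decides between the radii `ℓ` and
    -- `suc ℓ`. The hypothesis on `f (suc ℓ)` is the price of dropping it.
    ∑-radius-suc≤ : ∀ ℓ {f h : ℕ → ℕ} → (∀ ρ → f ρ ≤ h ρ) → f (suc ℓ) ≤ h ℓ →
                    sum (f ∘ radius (suc ℓ)) ≤ B * sum (h ∘ radius ℓ)
    ∑-radius-suc≤ zero {f} {h} f≤h fℓ≤hℓ = begin
      sum (f ∘ radius 1)                          ≡⟨ ∑-radius 0 f ⟩
      a * (f 1 + 0) + (B ∸ a) * (1 * f 0)         ≤⟨ +-mono-≤ (*-monoʳ-≤ a (+-monoˡ-≤ 0 fℓ≤hℓ))
                                                       (*-monoʳ-≤ (B ∸ a) (≤-trans (≤-reflexive (+-identityʳ (f 0)))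
                                                         (≤-trans (f≤h 0) (m≤m+n (h 0) 0)))) ⟩
      a * (h 0 + 0) + (B ∸ a) * (h 0 + 0)         ≡⟨ *-distribʳ-+ (h 0 + 0) a (B ∸ a) ⟨
      (a + (B ∸ a)) * (h 0 + 0)                   ≡⟨ cong (_* (h 0 + 0)) (m+[n∸m]≡n a≤B) ⟩
      B * (h 0 + 0)                               ∎
      where open ≤-Reasoning
    ∑-radius-suc≤ (suc ℓ) {f} {h} f≤h fℓ≤hℓ = begin
      sum (f ∘ radius (2 + ℓ))
        ≡⟨ ∑-radius (suc ℓ) f ⟩
      a * sum (f ∘ suc ∘ radius (suc ℓ)) + (B ∸ a) * (B ^ suc ℓ * f 0)
        ≤⟨ +-mono-≤ (*-monoʳ-≤ a (∑-radius-suc≤ ℓ {f ∘ suc} {h ∘ suc} (f≤h ∘ suc) fℓ≤hℓ))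
                    (*-monoʳ-≤ (B ∸ a) (*-monoʳ-≤ (B ^ suc ℓ) (f≤h 0))) ⟩
      a * (B * sum (h ∘ suc ∘ radius ℓ)) + (B ∸ a) * (B ^ suc ℓ * h 0)
        ≡⟨ cong₂ _+_ (*-left-comm a B S)
                     (regroup ℓ (h 0)) ⟩
      B * (a * S) + B * ((B ∸ a) * (B ^ ℓ * h 0))
        ≡⟨ *-distribˡ-+ B (a * S) _ ⟨
      B * (a * S + (B ∸ a) * (B ^ ℓ * h 0))
        ≡⟨ cong (B *_) (∑-radius ℓ h) ⟨
      B * sum (h ∘ radius (suc ℓ)) ∎
      where
      open ≤-Reasoning
      S = sum (h ∘ suc ∘ radius ℓ)

    -- Memorylessness: prepend a success and drop the last coin, which only
    -- matters when all coins succeed.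
    ∑-radius-shift : ∀ ℓ {f g : ℕ → ℕ} → (∀ ρ → f ρ ≤ g (suc ρ)) → f (suc ℓ) ≤ g (suc ℓ) →
                     a * sum (f ∘ radius (suc ℓ)) ≤ B * sum (g ∘ radius (suc ℓ))
    ∑-radius-shift ℓ {f} {g} f≤g fℓ≤gℓ = begin
      a * sum (f ∘ radius (suc ℓ))              ≤⟨ *-monoʳ-≤ a (∑-radius-suc≤ ℓ {f} {g ∘ suc} f≤g fℓ≤gℓ) ⟩
      a * (B * S)                               ≡⟨ *-left-comm a B S ⟩
      B * (a * S)                               ≤⟨ *-monoʳ-≤ B (m≤m+n (a * S) _) ⟩
      B * (a * S + (B ∸ a) * (B ^ ℓ * g 0))     ≡⟨ cong (B *_) (∑-radius ℓ g) ⟨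
      B * sum (g ∘ radius (suc ℓ))              ∎
      where
      open ≤-Reasoning
      S = sum (g ∘ suc ∘ radius ℓ)

    ∑-radius-top : ∀ ℓ → sum (λ z → 𝟙 (ℓ ≤? radius ℓ z)) ≡ a ^ ℓ
    ∑-radius-top zero    = refl
    ∑-radius-top (suc ℓ) = trans (∑-radius ℓ (λ ρ → 𝟙 (suc ℓ ≤? ρ)))
      (trans (cong₂ _+_ (cong (a *_) (trans (sum-cong-≗ {B ^ ℓ} λ z → same (radius ℓ z)) (∑-radius-top ℓ)))
                        (trans (cong ((B ∸ a) *_) (*-zeroʳ (B ^ ℓ))) (*-zeroʳ (B ∸ a))))
             (+-identityʳ _))
      where
      same : ∀ ρ → 𝟙 (suc ℓ ≤? suc ρ) ≡ 𝟙 (ℓ ≤? ρ)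
      same ρ with ℓ ≤? ρ
      ... | yes p = 𝟙-yes (suc ℓ ≤? suc ρ) (s≤s p)
      ... | no ¬p = 𝟙-no (suc ℓ ≤? suc ρ) (¬p ∘ s≤s⁻¹)

    radii : ∀ ℓ {n} → Vec (Fin (B ^ ℓ)) n → Fin n → ℕ
    radii ℓ x = lookup (map (radius ℓ) x)

    radii-updated : ∀ ℓ {n} (v : Fin n) x z → radii ℓ (x [ v ]≔ z) v ≡ radius ℓ z
    radii-updated ℓ v x z = trans (lookup-map v (radius ℓ) (x [ v ]≔ z)) (cong (radius ℓ) (lookup∘update v x z))

    radii-others : ∀ ℓ {n} {v : Fin n} x z w → w ≢ v → radii ℓ (x [ v ]≔ z) w ≡ radii ℓ x w
    radii-others ℓ {v = v} x z w w≢v = trans (lookup-map w (radius ℓ) (x [ v ]≔ z))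
      (trans (cong (radius ℓ) (lookup∘update′ w≢v x z)) (sym (lookup-map w (radius ℓ) x)))

    ∑Vec-radius-top : ∀ ℓ {n} (v : Fin n) →
      B ^ ℓ * ∑Vec (B ^ ℓ) n (λ x → 𝟙 (ℓ ≤? radii ℓ x v)) ≡ a ^ ℓ * (B ^ ℓ) ^ n
    ∑Vec-radius-top ℓ {n} v = trans (∑Vec-resample v _)
      (trans (∑Vec-cong λ x → trans
               (sum-cong-≗ {B ^ ℓ} λ z → cong (λ r → 𝟙 (ℓ ≤? r)) (radii-updated ℓ v x z))
               (∑-radius-top ℓ))
             (trans (∑Vec-const n (a ^ ℓ)) (*-comm ((B ^ ℓ) ^ n) (a ^ ℓ))))

    draw : ∀ ℓ T → Fin ((B ^ ℓ) ^ T) → ℕ → ℕ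
    draw ℓ zero    z t       = 0
    draw ℓ (suc T) z zero    = radius ℓ (quotient {B ^ ℓ} ((B ^ ℓ) ^ T) z)
    draw ℓ (suc T) z (suc t) = draw ℓ T (remainder {B ^ ℓ} ((B ^ ℓ) ^ T) z) t

    rows : ∀ ℓ T {m} → Vec (Fin ((B ^ ℓ) ^ T)) m → ℕ → Vec ℕ m
    rows ℓ T x t = map (λ z → draw ℓ T z t) x

    rows-zero : ∀ ℓ T {m} (x : Vec (Fin (B ^ ℓ)) m) y →
                rows ℓ (suc T) (zipWith combine x y) 0 ≡ map (radius ℓ) x
    rows-zero ℓ T []      []      = refl
    rows-zero ℓ T (z ∷ x) (s ∷ y) = cong₂ _∷_ (cong (radius ℓ) (quotient-combine z s)) (rows-zero ℓ T x y)

    rows-suc : ∀ ℓ T {m} (x : Vec (Fin (B ^ ℓ)) m) y t →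
               rows ℓ (suc T) (zipWith combine x y) (suc t) ≡ rows ℓ T y t
    rows-suc ℓ T []      []      t = refl
    rows-suc ℓ T (z ∷ x) (s ∷ y) t =
      cong₂ _∷_ (cong (λ s → draw ℓ T s t) (remainder-combine z s)) (rows-suc ℓ T x y t)

  -- A vertex's value together with its identity, which breaks ties.
  key : ∀ {n} → ℕ → Fin n → ℕ
  key {n} h v = toℕ v + h * n

  key-% : ∀ {n} .{{_ : NonZero n}} h (v : Fin n) → key h v % n ≡ toℕ v
  key-% {n} h v = trans ([m+kn]%n≡m%n (toℕ v) h n) (m<n⇒m%n≡m (toℕ<n v))

  key-mono-≤ : ∀ {n h h′} (v : Fin n) → h ≤ h′ → key h v ≤ key h′ v
  key-mono-≤ {n} v h≤h′ = +-monoʳ-≤ (toℕ v) (*-monoˡ-≤ n h≤h′)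

  -- Adding `n` to a key raises the value by one and keeps the identity. A lead of more than 1
  -- between values is thus a lead of more than `n` between keys.
  key-suc : ∀ {n} h (v : Fin n) → key (suc h) v ≡ key h v + n
  key-suc {n} h v = trans (cong (toℕ v +_) (+-comm n (h * n))) (sym (+-assoc (toℕ v) (h * n) n))

  key-lower : ∀ {n} h (v : Fin n) → h * n ≤ key h v
  key-lower h v = m≤n+m _ (toℕ v)

  key-injective : ∀ {n h h′} {v w : Fin n} → key h v ≡ key h′ w → v ≡ w
  key-injective {suc n} {h} {h′} {v} {w} e = toℕ-injective
    (trans (sym (key-% h v)) (trans (cong (_% suc n) e) (key-% h′ w)))

  key-/ : ∀ {n} .{{_ : NonZero n}} h (v : Fin n) → key h v / n ≡ h
  key-/ {n} h v = trans (+-distrib-/-∣ʳ (toℕ v) (n∣m*n h))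
    (cong₂ _+_ (m<n⇒m/n≡0 (toℕ<n v)) (m*n/n≡m h n))

  -- Leaders and winners seen from one vertex

  module Leader {n : ℕ} {S : Fin n → Set} (S? : ∀ v → Dec (S v)) (δ : Fin n → ℕ) where
    height : Fin n → ℕ → ℕ
    height v ρ = suc ρ ∸ δ v

    -- The radius `r` of `v` is kept apart from the radii `ρ` of its rivals, so that it can vary
    -- while they are fixed. Height at least 2 says that the distance to `v` is at most `r - 1`,
    -- which later gives cluster radius `k - 1`.
    LeadAt GapAt : (Fin n → ℕ) → Fin n → ℕ → Set
    LeadAt ρ v r = S v × 1 ≤ height v r ×
      ∀ w → S w → w ≢ v → key (height w (ρ w)) w < key (height v r) v
    GapAt ρ v r = S v × 2 ≤ height v r ×
      ∀ w → S w → w ≢ v → key (height w (ρ w)) w + n < key (height v r) v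

    Gap : (Fin n → ℕ) → Fin n → Set
    Gap ρ v = GapAt ρ v (ρ v)

    -- A leader whose radius reaches the cap ℓ wins without a gap, as its
    -- untruncated radius could have been larger.
    WinAt : ℕ → (Fin n → ℕ) → Fin n → ℕ → Set
    WinAt ℓ ρ v r = GapAt ρ v r ⊎ LeadAt ρ v r × ℓ ≤ r

    LeadAt? : ∀ ρ v r → Dec (LeadAt ρ v r)
    LeadAt? ρ v r = S? v ×-dec (1 ≤? height v r) ×-dec
      all? λ w → S? w →-dec (¬? (w FinP.≟ v) →-dec (key (height w (ρ w)) w <? key (height v r) v))

    GapAt? : ∀ ρ v r → Dec (GapAt ρ v r)
    GapAt? ρ v r = S? v ×-dec (2 ≤? height v r) ×-dec
      all? λ w → S? w →-dec (¬? (w FinP.≟ v) →-dec (key (height w (ρ w)) w + n <? key (height v r) v))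

    WinAt? : ∀ ℓ ρ v r → Dec (WinAt ℓ ρ v r)
    WinAt? ℓ ρ v r = GapAt? ρ v r ⊎-dec (LeadAt? ρ v r ×-dec (ℓ ≤? r))

    Wins : ℕ → (Fin n → ℕ) → Set
    Wins ℓ ρ = ∃ λ v → WinAt ℓ ρ v (ρ v)

    Wins? : ∀ ℓ ρ → Dec (Wins ℓ ρ)
    Wins? ℓ ρ = any? λ v → WinAt? ℓ ρ v (ρ v)

    gap⇒lead : ∀ {ρ v r} → GapAt ρ v r → LeadAt ρ v r
    gap⇒lead (v∈ , h , gap) = v∈ , ≤-trans (s≤s z≤n) h ,
      λ w w∈ w≢v → ≤-<-trans (m≤m+n _ n) (gap w w∈ w≢v)

    win⇒lead : ∀ {ℓ ρ v r} → WinAt ℓ ρ v r → LeadAt ρ v r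
    win⇒lead (inj₁ gap)        = gap⇒lead gap
    win⇒lead (inj₂ (lead , _)) = lead

    lead-unique : ∀ {ρ v w} → LeadAt ρ v (ρ v) → LeadAt ρ w (ρ w) → v ≡ w
    lead-unique {ρ} {v} {w} (v∈ , _ , above-v) (w∈ , _ , above-w) with v FinP.≟ w
    ... | yes v≡w = v≡w
    ... | no  v≢w = contradiction (above-w v v∈ v≢w) (<-asym (above-v w w∈ (v≢w ∘ sym)))

    -- One more unit of radius adds `n` to the key of `v` and leaves the rivals alone. Positive
    -- height guarantees that truncated subtraction does not swallow the unit.
    lead⇒gap-suc : ∀ {ρ v r} → LeadAt ρ v r → GapAt ρ v (suc r)
    lead⇒gap-suc {ρ} {v} {r} (v∈ , 1≤h , above) = v∈ , subst (2 ≤_) (sym grow) (s≤s 1≤h) , λ w w∈ w≢v →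
      subst (key (height w (ρ w)) w + n <_)
        (sym (trans (cong (λ h → key h v) grow) (key-suc (height v r) v)))
        (+-monoˡ-< n (above w w∈ w≢v))
      where
      grow : height v (suc r) ≡ suc (height v r)
      grow = +-∸-assoc 1 {suc r} {δ v} (≮⇒≥ λ lt → contradiction (subst (1 ≤_) (m≤n⇒m∸n≡0 (<⇒≤ lt)) 1≤h) λ ())

    -- A survivor at distance 0 has a key of at least `n`, so the maximal key is at least `n`.
    -- Height 0 gives only a key below `n` and non-survivors are valued 0, hence the maximiser is a
    -- survivor of positive height.
    lead-exists : ∀ ρ {y} → S y → δ y ≡ 0 → ∃ λ v → LeadAt ρ v (ρ v)
    lead-exists ρ {y} y∈ δy≡0 = v , inS v refl , high , above
      where
      value : Fin n → ℕ
      value w = 𝟙 (S? w) * key (height w (ρ w)) w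

      v : Fin n
      v = argmax value y (allFin n)

      value-in : ∀ {w} → S w → value w ≡ key (height w (ρ w)) w
      value-in {w} w∈ = trans (cong (_* key (height w (ρ w)) w) (𝟙-yes (S? w) w∈))
                            (*-identityˡ (key (height w (ρ w)) w))

      n≤ : n ≤ value y
      n≤ = subst (n ≤_) (sym (trans (value-in y∈) (cong (λ d → key (suc (ρ y) ∸ d) y) δy≡0)))
             (≤-trans (m≤m+n n (ρ y * n)) (key-lower (suc (ρ y)) y))

      n≤v : n ≤ value v
      n≤v = ≤-trans n≤ (f[⊥]≤f[argmax] {f = value} y (allFin n))

      0<n : 0 < n
      0<n = ≤-<-trans z≤n (toℕ<n y)

      inS : ∀ w → w ≡ v → S w
      inS w e with S? w in eq
      ... | yes w∈ = w∈
      ... | no  _  = contradiction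
        (subst (n ≤_) (trans (cong value (sym e)) (cong (λ d → 𝟙 d * key (height w (ρ w)) w) eq)) n≤v)
        (<⇒≱ 0<n)

      n≤key : n ≤ key (height v (ρ v)) v
      n≤key = subst (n ≤_) (value-in (inS v refl)) n≤v

      high : 1 ≤ height v (ρ v)
      high = ≮⇒≥ λ h<1 → <⇒≱ (subst (_< n)
        (sym (trans (cong (λ h → key h v) (n<1⇒n≡0 h<1)) (+-identityʳ (toℕ v)))) (toℕ<n v)) n≤key

      above : ∀ w → S w → w ≢ v → key (height w (ρ w)) w < key (height v (ρ v)) v
      above w w∈ w≢v = ≤∧≢⇒<
        (subst₂ _≤_ (value-in w∈) (value-in (inS v refl))
          (All.lookup (f[xs]≤f[argmax] {f = value} y (allFin n)) (∈-allFin w)))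
        (w≢v ∘ key-injective {h = height w (ρ w)} {height v (ρ v)})

    module _ {ρ ρ′ : Fin n → ℕ} {v : Fin n} (same : ∀ w → w ≢ v → ρ w ≡ ρ′ w) where
      LeadAt-resp : ∀ {r} → LeadAt ρ v r → LeadAt ρ′ v r
      LeadAt-resp (v∈ , h , above) = v∈ , h , λ w w∈ w≢v →
        subst (λ s → key (height w s) w < _) (same w w≢v) (above w w∈ w≢v)

      GapAt-resp : ∀ {r} → GapAt ρ v r → GapAt ρ′ v r
      GapAt-resp (v∈ , h , above) = v∈ , h , λ w w∈ w≢v →
        subst (λ s → key (height w s) w + n < _) (same w w≢v) (above w w∈ w≢v)

      WinAt-resp : ∀ {ℓ r} → WinAt ℓ ρ v r → WinAt ℓ ρ′ v r
      WinAt-resp (inj₁ gap)          = inj₁ (GapAt-resp gap)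
      WinAt-resp (inj₂ (lead , ℓ≤r)) = inj₂ (LeadAt-resp lead , ℓ≤r)

    module _ {B a : ℕ} .{{_ : NonZero B}} (a≤B : a ≤ B) (k : ℕ) where
      open Geometric B a a≤B
      private
        ℓ = suc k
        Q = B ^ ℓ

      -- Only the radius of `v` is redrawn. With the rivals fixed, one prepended success turns
      -- leading into winning, and at the cap leading already is winning.
      lead≤win : ∀ v → a * ∑Vec Q n (λ x → 𝟙 (LeadAt? (radii ℓ x) v (radii ℓ x v))) ≤
                       B * ∑Vec Q n (λ x → 𝟙 (WinAt? ℓ (radii ℓ x) v (radii ℓ x v)))
      lead≤win v = *-cancelˡ-≤ Q {{m^n≢0 B ℓ}} (begin
        Q * (a * ∑Vec Q n lead)      ≡⟨ *-left-comm Q a _ ⟩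
        a * (Q * ∑Vec Q n lead)      ≡⟨ cong (a *_) (∑Vec-resample v lead) ⟩
        a * ∑Vec Q n (λ x → sum λ z → lead (x [ v ]≔ z))
                                     ≡⟨ *-distribˡ-∑Vec n a _ ⟩
        ∑Vec Q n (λ x → a * sum λ z → lead (x [ v ]≔ z))
                                     ≤⟨ ∑Vec-mono column ⟩
        ∑Vec Q n (λ x → B * sum λ z → win (x [ v ]≔ z))
                                     ≡⟨ *-distribˡ-∑Vec n B _ ⟨
        B * ∑Vec Q n (λ x → sum λ z → win (x [ v ]≔ z))
                                     ≡⟨ cong (B *_) (∑Vec-resample v win) ⟨
        B * (Q * ∑Vec Q n win)       ≡⟨ *-left-comm B Q _ ⟩
        Q * (B * ∑Vec Q n win)       ∎)
        where
        open ≤-Reasoning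
        lead win : Vec (Fin Q) n → ℕ
        lead x = 𝟙 (LeadAt? (radii ℓ x) v (radii ℓ x v))
        win x = 𝟙 (WinAt? ℓ (radii ℓ x) v (radii ℓ x v))
        column : ∀ x → a * sum (λ z → lead (x [ v ]≔ z)) ≤ B * sum (λ z → win (x [ v ]≔ z))
        column x = begin
          a * sum (λ z → lead (x [ v ]≔ z))
            ≤⟨ *-monoʳ-≤ a (∑-mono λ z → 𝟙-mono (LeadAt? _ v _) (LeadAt? _ v _)
                 (LeadAt-resp (radii-others ℓ x z) ∘ subst (LeadAt _ v) (radii-updated ℓ v x z))) ⟩
          a * sum (λ z → 𝟙 (LeadAt? (radii ℓ x) v (radius ℓ z)))
            ≤⟨ ∑-radius-shift k {λ r → 𝟙 (LeadAt? (radii ℓ x) v r)} {λ r → 𝟙 (WinAt? ℓ (radii ℓ x) v r)}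
                 (λ r → 𝟙-mono (LeadAt? _ v r) (WinAt? ℓ _ v (suc r)) (inj₁ ∘ lead⇒gap-suc))
                 (𝟙-mono (LeadAt? _ v ℓ) (WinAt? ℓ _ v ℓ) λ l → inj₂ (l , ≤-refl)) ⟩
          B * sum (λ z → 𝟙 (WinAt? ℓ (radii ℓ x) v (radius ℓ z)))
            ≤⟨ *-monoʳ-≤ B (∑-mono λ z → 𝟙-mono (WinAt? ℓ _ v _) (WinAt? ℓ _ v _)
                 (subst (WinAt ℓ _ v) (sym (radii-updated ℓ v x z)) ∘ WinAt-resp (λ w w≢v → sym (radii-others ℓ x z w w≢v)))) ⟩
          B * sum (λ z → win (x [ v ]≔ z)) ∎

      -- Raising the radius of the leader by one turns it into a winner.
      wins-likely : ∀ {y} → S y → δ y ≡ 0 →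
        a * Q ^ n ≤ B * ∑Vec Q n (λ x → 𝟙 (Wins? ℓ (radii ℓ x)))
      wins-likely {y} y∈ δy≡0 = begin
        a * Q ^ n
          ≡⟨ cong (a *_) (trans (∑Vec-const n 1) (*-identityʳ (Q ^ n))) ⟨
        a * ∑Vec Q n (λ _ → 1)
          ≤⟨ *-monoʳ-≤ a (∑Vec-mono one) ⟩
        a * ∑Vec Q n (λ x → sum λ v → 𝟙 (LeadAt? (radii ℓ x) v (radii ℓ x v)))
          ≡⟨ cong (a *_) (∑Vec-∑-comm n n _) ⟩
        a * sum (λ v → ∑Vec Q n λ x → 𝟙 (LeadAt? (radii ℓ x) v (radii ℓ x v)))
          ≡⟨ *-distribˡ-sum {n} a _ ⟩
        sum (λ v → a * ∑Vec Q n λ x → 𝟙 (LeadAt? (radii ℓ x) v (radii ℓ x v)))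
          ≤⟨ ∑-mono lead≤win ⟩
        sum (λ v → B * ∑Vec Q n λ x → 𝟙 (WinAt? ℓ (radii ℓ x) v (radii ℓ x v)))
          ≡⟨ *-distribˡ-sum {n} B _ ⟨
        B * sum (λ v → ∑Vec Q n λ x → 𝟙 (WinAt? ℓ (radii ℓ x) v (radii ℓ x v)))
          ≡⟨ cong (B *_) (∑Vec-∑-comm n n _) ⟨
        B * ∑Vec Q n (λ x → sum λ v → 𝟙 (WinAt? ℓ (radii ℓ x) v (radii ℓ x v)))
          ≤⟨ *-monoʳ-≤ B (∑Vec-mono λ x → ∑𝟙≤𝟙-∃ (λ v → WinAt? ℓ (radii ℓ x) v (radii ℓ x v)) (Wins? ℓ (radii ℓ x))
               λ p q → lead-unique {radii ℓ x} (win⇒lead p) (win⇒lead q)) ⟩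
        B * ∑Vec Q n (λ x → 𝟙 (Wins? ℓ (radii ℓ x))) ∎
        where
        open ≤-Reasoning
        one : ∀ x → 1 ≤ sum λ v → 𝟙 (LeadAt? (radii ℓ x) v (radii ℓ x v))
        one x = let v , lead = lead-exists (radii ℓ x) y∈ δy≡0 in
          ≤-trans (≤-reflexive (sym (𝟙-yes (LeadAt? (radii ℓ x) v _) lead)))
                  (term≤∑ (λ v → 𝟙 (LeadAt? (radii ℓ x) v (radii ℓ x v))) v)

  -- Messages as bit strings

  Pair : Set
  Pair = ℕ × ℕ

  odd : ℕ → Bool
  odd x = x % 2 ≡ᵇ 1

  bit : Bool → ℕ
  bit b = if b then 1 else 0

  encode : ℕ → Pair → List Bool
  encode zero    _       = []
  encode (suc w) (x , y) = odd x ∷ odd y ∷ encode w (x / 2 , y / 2)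

  decode : List Bool → Pair
  decode (b ∷ c ∷ bs) = bit b + proj₁ (decode bs) * 2 , bit c + proj₂ (decode bs) * 2
  decode _            = 0 , 0

  length-encode : ∀ w b → length (encode w b) ≡ w + w
  length-encode zero    b       = refl
  length-encode (suc w) (x , y) = cong suc (trans (cong suc (length-encode w _)) (sym (+-suc w w)))

  bit-odd : ∀ x → bit (odd x) + x / 2 * 2 ≡ x
  bit-odd x = trans (cong (_+ x / 2 * 2) (small (x % 2) (m%n<n x 2))) (sym (m≡m%n+[m/n]*n x 2))
    where
    small : ∀ r → r < 2 → bit (r ≡ᵇ 1) ≡ r
    small zero          _             = refl
    small (suc zero)    _             = refl
    small (suc (suc _)) (s≤s (s≤s ()))

  decode-encode : ∀ w {x y} → x < 2 ^ w → y < 2 ^ w → decode (encode w (x , y)) ≡ (x , y)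
  decode-encode zero    {zero} {zero} (s≤s z≤n) (s≤s z≤n) = refl
  decode-encode (suc w) {x}    {y}    x<        y<        =
    trans (cong (λ (p , q) → bit (odd x) + p * 2 , bit (odd y) + q * 2)
                (decode-encode w (half x x<) (half y y<)))
          (cong₂ _,_ (bit-odd x) (bit-odd y))
    where
    half : ∀ x → x < 2 ^ suc w → x / 2 < 2 ^ w
    half x x< = m<n*o⇒m/o<n (subst (x <_) (*-comm 2 (2 ^ w)) x<)

  -- The value `b` means that nothing was found below `b`. Capped distances and shortest walks are
  -- both obtained from this search.
  first : {P : ℕ → Set} → (∀ d → Dec (P d)) → ℕ → ℕ
  first P? zero    = 0
  first P? (suc b) with P? 0
  ... | yes _ = 0
  ... | no  _ = suc (first (λ d → P? (suc d)) b)

  first≤ : ∀ {P : ℕ → Set} (P? : ∀ d → Dec (P d)) b → first P? b ≤ b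
  first≤ P? zero    = z≤n
  first≤ P? (suc b) with P? 0
  ... | yes _ = z≤n
  ... | no  _ = s≤s (first≤ (λ d → P? (suc d)) b)

  first-satisfies : ∀ {P : ℕ → Set} (P? : ∀ d → Dec (P d)) b → first P? b < b → P (first P? b)
  first-satisfies P? (suc b) lt with P? 0
  ... | yes p = p
  ... | no  _ = first-satisfies (λ d → P? (suc d)) b (s≤s⁻¹ lt)

  first-minimal : ∀ {P : ℕ → Set} (P? : ∀ d → Dec (P d)) b {d} → P d → first P? b ≤ d
  first-minimal P? zero    p = z≤n
  first-minimal P? (suc b) p with P? 0
  ... | yes _ = z≤n
  first-minimal P? (suc b) {zero}  p | no ¬p = contradiction p ¬p
  first-minimal P? (suc b) {suc d} p | no ¬p = s≤s (first-minimal (λ d → P? (suc d)) b p)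

  -- The two best candidates of distinct origin

  module TopTwo (n : ℕ) .{{_ : NonZero n}} where
    -- The residue modulo `n` is the origin of a value. A value of the leading origin competes only
    -- for the first place: the runner-up has to come from another origin, since the gap is measured
    -- against rivals.
    insert : ℕ → Pair → Pair
    insert x (y₁ , y₂) with x % n ≟ y₁ % n | x ≤? y₁
    ... | yes _ | _     = x ⊔ y₁ , y₂
    ... | no  _ | yes _ = y₁ , x ⊔ y₂
    ... | no  _ | no  _ = x , y₁

    -- Subtracting `n` charges for the edge that the message has just crossed.
    absorb : Pair → Pair → Pair
    absorb (z₁ , z₂) b = insert (z₁ ∸ n) (insert (z₂ ∸ n) b)

    gather : ∀ {d} → (Fin d → Pair) → Pair → Pair
    gather {zero}  m b = b
    gather {suc d} m b = absorb (m zero) (gather (m ∘ suc) b)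

    gather-cong : ∀ {d} {m m′ : Fin d → Pair} b → (∀ i → m i ≡ m′ i) → gather m b ≡ gather m′ b
    gather-cong {zero}  b e = refl
    gather-cong {suc d} b e = cong₂ absorb (e zero) (gather-cong b (e ∘ suc))

    -- A second entry below `n` has value 0 and stands for an empty slot, whose residue is not an
    -- origin.
    record Ranked (b : Pair) : Set where
      constructor ranked
      field
        ordered  : proj₂ b ≤ proj₁ b
        distinct : proj₂ b < n ⊎ proj₁ b % n ≢ proj₂ b % n
    open Ranked

    Both : (ℕ → Set) → Pair → Set
    Both P (y₁ , y₂) = P y₁ × P y₂

    -- Nothing is lost by forgetting `x`: either its own origin holds the first place with at least
    -- this value, or, in an ordered pair, both entries are at least as large.
    Dominates : Pair → ℕ → Set
    Dominates (y₁ , y₂) x = x ≤ y₂ ⊎ x ≤ y₁ × y₁ % n ≡ x % n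

    ⊔-elim : ∀ {P : ℕ → Set} {x y} → P x → P y → P (x ⊔ y)
    ⊔-elim {P} {x} {y} px py = [ (λ e → subst P (sym e) px) , (λ e → subst P (sym e) py) ]′ (⊔-sel x y)

    insert-ranked : ∀ x {b} → Ranked b → Ranked (insert x b)
    insert-ranked x {y₁ , y₂} (ranked o d) with x % n ≟ y₁ % n | x ≤? y₁
    ... | yes e | _       = ranked (≤-trans o (m≤n⊔m x y₁))
      ([ inj₁ , (λ ≢ → inj₂ (≢ ∘ trans (sym (⊔-elim {λ z → z % n ≡ y₁ % n} e refl)))) ]′ d)
    ... | no ¬e | yes x≤y = ranked (⊔-lub x≤y o)
      (⊔-elim {λ z → z < n ⊎ y₁ % n ≢ z % n} {x} {y₂} (inj₂ (¬e ∘ sym)) d)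
    ... | no ¬e | no x≰y  = ranked (≰⇒≥ x≰y) (inj₂ ¬e)

    insert-all : ∀ {P x b} → P x → Both P b → Both P (insert x b)
    insert-all {P} {x} {y₁ , y₂} px (p₁ , p₂) with x % n ≟ y₁ % n | x ≤? y₁
    ... | yes _ | _     = ⊔-elim {P} px p₁ , p₂
    ... | no  _ | yes _ = p₁ , ⊔-elim {P} px p₂
    ... | no  _ | no  _ = px , p₁

    insert-new : ∀ x b → Dominates (insert x b) x
    insert-new x (y₁ , y₂) with x % n ≟ y₁ % n | x ≤? y₁
    ... | yes e | _     = inj₂ (m≤m⊔n x y₁ , ⊔-elim {λ z → z % n ≡ x % n} refl (sym e))
    ... | no  _ | yes _ = inj₁ (m≤m⊔n x y₂)
    ... | no  _ | no  _ = inj₂ (≤-refl , refl)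

    insert-old : ∀ x {b z} → Ranked b → Dominates b z → Dominates (insert x b) z
    insert-old x {y₁ , y₂} {z} (ranked o _) dom with x % n ≟ y₁ % n | x ≤? y₁ | dom
    ... | yes _ | _     | inj₁ z≤       = inj₁ z≤
    ... | yes e | _     | inj₂ (z≤ , i) = inj₂ (≤-trans z≤ (m≤n⊔m x y₁) ,
                                                ⊔-elim {λ s → s % n ≡ z % n} (trans e i) i)
    ... | no  _ | yes _ | inj₁ z≤       = inj₁ (≤-trans z≤ (m≤n⊔m x y₂))
    ... | no  _ | yes _ | inj₂ h        = inj₂ h
    ... | no  _ | no  _ | inj₁ z≤       = inj₁ (≤-trans z≤ o)
    ... | no  _ | no  _ | inj₂ (z≤ , _) = inj₁ z≤

    gather-ranked : ∀ {d} (m : Fin d → Pair) {b} → Ranked b → Ranked (gather m b)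
    gather-ranked {zero}  m r = r
    gather-ranked {suc d} m r = insert-ranked _ (insert-ranked _ (gather-ranked (m ∘ suc) r))

    gather-all : ∀ {P d} (m : Fin d → Pair) {b} →
                 (∀ i → Both (λ z → P (z ∸ n)) (m i)) → Both P b → Both P (gather m b)
    gather-all {P} {zero}  m pm pb = pb
    gather-all {P} {suc d} m pm pb =
      insert-all {P} (proj₁ (pm zero)) (insert-all {P} (proj₂ (pm zero)) (gather-all {P} (m ∘ suc) (pm ∘ suc) pb))

    gather-old : ∀ {d} (m : Fin d → Pair) {b z} → Ranked b → Dominates b z → Dominates (gather m b) z
    gather-old {zero}  m r dom = dom
    gather-old {suc d} m r dom =
      insert-old _ (insert-ranked _ r′) (insert-old _ r′ (gather-old (m ∘ suc) r dom))
      where r′ = gather-ranked (m ∘ suc) r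

    gather-new : ∀ {d} (m : Fin d → Pair) {b} → Ranked b → ∀ i →
      Both (λ z → Dominates (gather m b) (z ∸ n)) (m i)
    gather-new {suc d} m {b} r zero =
      insert-new _ (insert (proj₂ (m zero) ∸ n) (gather (m ∘ suc) b)) ,
      insert-old _ (insert-ranked _ r′) (insert-new (proj₂ (m zero) ∸ n) (gather (m ∘ suc) b))
      where r′ = gather-ranked (m ∘ suc) r
    gather-new {suc d} m {b} r (suc i) = keep (proj₁ h) , keep (proj₂ h)
      where
      r′ = gather-ranked (m ∘ suc) r
      h = gather-new (m ∘ suc) r i
      keep : ∀ {z} → Dominates (gather (m ∘ suc) b) z → Dominates (gather m b) z
      keep dom = insert-old _ (insert-ranked _ r′) (insert-old _ r′ dom)

    ∸-% : ∀ {x} → n ≤ x → (x ∸ n) % n ≡ x % n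
    ∸-% = m≤n⇒[n∸m]%m≡n%m

    -- Two candidates with distinct identities suffice to dominate everything
    -- that the neighbour's candidates dominate.
    dominates-step : ∀ {b z x} → Ranked z → Both (λ s → Dominates b (s ∸ n)) z →
                     Dominates z x → n + n ≤ x → Dominates b (x ∸ n)
    dominates-step {b₁ , b₂} {z₁ , z₂} {x} (ranked z₂≤z₁ d) (dom₁ , dom₂) (inj₁ x≤z₂) 2n≤x =
      go d dom₁ dom₂
      where
      n≤z₂ : n ≤ z₂
      n≤z₂ = ≤-trans (m≤m+n n n) (≤-trans 2n≤x x≤z₂)
      x≤₁ = ∸-monoˡ-≤ n (≤-trans x≤z₂ z₂≤z₁)
      x≤₂ = ∸-monoˡ-≤ n x≤z₂
      go : z₂ < n ⊎ z₁ % n ≢ z₂ % n → Dominates (b₁ , b₂) (z₁ ∸ n) → Dominates (b₁ , b₂) (z₂ ∸ n) →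
           Dominates (b₁ , b₂) (x ∸ n)
      go (inj₁ z₂<n) _ _ = contradiction n≤z₂ (<⇒≱ z₂<n)
      go (inj₂ _) (inj₁ h) _ = inj₁ (≤-trans x≤₁ h)
      go (inj₂ _) _ (inj₁ h) = inj₁ (≤-trans x≤₂ h)
      go (inj₂ z≢) (inj₂ (_ , e₁)) (inj₂ (_ , e₂)) = contradiction
        (trans (sym (∸-% (≤-trans n≤z₂ z₂≤z₁))) (trans (sym e₁) (trans e₂ (∸-% n≤z₂)))) z≢
    dominates-step {b₁ , b₂} {z₁ , z₂} {x} _ (dom₁ , _) (inj₂ (x≤z₁ , e)) 2n≤x = go dom₁
      where
      n≤x : n ≤ x
      n≤x = ≤-trans (m≤m+n n n) 2n≤x
      go : Dominates (b₁ , b₂) (z₁ ∸ n) → Dominates (b₁ , b₂) (x ∸ n)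
      go (inj₁ h)        = inj₁ (≤-trans (∸-monoˡ-≤ n x≤z₁) h)
      go (inj₂ (h , e′)) = inj₂ (≤-trans (∸-monoˡ-≤ n x≤z₁) h ,
        trans e′ (trans (∸-% (≤-trans n≤x x≤z₁)) (trans e (sym (∸-% n≤x)))))

    Joins : Pair → Set
    Joins (y₁ , y₂) = y₂ + n < y₁ × n + n ≤ y₁

    Joins? : ∀ b → Dec (Joins b)
    Joins? (y₁ , y₂) = (y₂ + n <? y₁) ×-dec (n + n ≤? y₁)

    -- The cluster of v formed in phase t is named key t v.
    relabel : ℕ → Maybe ℕ → Pair → Maybe ℕ
    relabel t (just m) b = just m
    relabel t nothing  b with Joins? b
    ... | yes _ = just (proj₁ b % n + t * n)
    ... | no  _ = nothing

    relabel-joins : ∀ t b → Joins b → relabel t nothing b ≡ just (proj₁ b % n + t * n)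
    relabel-joins t b joins with Joins? b
    ... | yes _      = refl
    ... | no  ¬joins = contradiction joins ¬joins

    relabel-just : ∀ t b {m} → relabel t nothing b ≡ just m → Joins b × m ≡ proj₁ b % n + t * n
    relabel-just t b e with Joins? b
    relabel-just t b refl | yes joins = joins , refl

  unlabelled? : (m : Maybe ℕ) → Dec (m ≡ nothing)
  unlabelled? nothing  = yes refl
  unlabelled? (just _) = no λ ()

  -- A clustered vertex sends empty slots, so broadcasts travel through survivors only and nobody
  -- has to announce having left.
  offer : Maybe ℕ → Pair → Pair
  offer nothing  b = b
  offer (just _) _ = 0 , 0

  -- Distances among the survivors

  module Survivors {n : ℕ} {degree : Fin n → ℕ} (nb : ∀ v → Fin (degree v) → Fin n)
                   (k : ℕ) (lab : Fin n → Maybe ℕ) where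
    Alive : Fin n → Set
    Alive v = lab v ≡ nothing

    data Path : Fin n → Fin n → ℕ → Set where
      here : ∀ {y} → Alive y → Path y y 0
      step : ∀ {y v d} → Alive y → (i : Fin (degree y)) → Path (nb y i) v d → Path y v (suc d)

    path-source : ∀ {y v d} → Path y v d → Alive y
    path-source (here a)     = a
    path-source (step a _ _) = a

    path-target : ∀ {y v d} → Path y v d → Alive v
    path-target (here a)     = a
    path-target (step _ _ p) = path-target p

    path? : ∀ y v d → Dec (Path y v d)
    path? y v zero    = map′ (λ { (refl , a) → here a }) (λ { (here a) → refl , a })
                          ((y FinP.≟ v) ×-dec unlabelled? (lab y))
    path? y v (suc d) = map′ (λ { (a , i , p) → step a i p }) (λ { (step a i p) → a , i , p })
                          (unlabelled? (lab y) ×-dec any? λ i → path? (nb y i) v d)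

    -- The cap `k + 1` stands for every larger or infinite distance; a radius of at most `k` has
    -- height 0 there.
    dist : Fin n → Fin n → ℕ
    dist y v = first (path? y v) (suc k)

    dist≤ : ∀ {y v d} → Path y v d → dist y v ≤ d
    dist≤ {y} {v} = first-minimal (path? y v) (suc k)

    dist-path : ∀ {y v} → dist y v ≤ k → Path y v (dist y v)
    dist-path {y} {v} = first-satisfies (path? y v) (suc k) ∘ s≤s

    dist-refl : ∀ {y} → Alive y → dist y y ≡ 0
    dist-refl a = n≤0⇒n≡0 (dist≤ (here a))

    -- The cap does no harm: a neighbour farther than `k` makes the right side exceed the largest
    -- value that the left side can take.
    dist-lipschitz : ∀ {y} v → Alive y → (i : Fin (degree y)) → dist y v ≤ suc (dist (nb y i) v)
    dist-lipschitz {y} v a i with dist (nb y i) v ≤? k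
    ... | yes d≤k = dist≤ (step a i (dist-path d≤k))
    ... | no  d≰k = ≤-trans (first≤ (path? y v) (suc k)) (≤-trans (≰⇒> d≰k) (n≤1+n _))

    dist-zero : ∀ {y v} → dist y v ≡ 0 → y ≡ v
    dist-zero {y} {v} e with dist y v | dist-path {y} {v} | e
    ... | .0 | p | refl with p z≤n
    ...   | here _ = refl

    module At (y : Fin n) = Leader (λ v → unlabelled? (lab v)) (dist y)

  -- One phase: the local test against the global gap

  module Phase (n : ℕ) .{{_ : NonZero n}} {degree : Fin n → ℕ}
               (nb : ∀ v → Fin (degree v) → Fin n) (w k : ℕ)
               (lab : Fin n → Maybe ℕ) (ρ : Fin n → ℕ) where
    open TopTwo n
    open Survivors nb k lab

    best : ℕ → Fin n → Pair
    best zero    y = key (suc (ρ y)) y , 0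
    best (suc s) y = gather (λ i → decode (encode w (offer (lab (nb y i)) (best s (nb y i))))) (best s y)

    inbox : ℕ → (y : Fin n) → Fin (degree y) → Pair
    inbox s y i = decode (encode w (offer (lab (nb y i)) (best s (nb y i))))

    Gap : Fin n → Fin n → Set
    Gap y = At.Gap y ρ

    height : Fin n → Fin n → ℕ
    height y v = At.height y v (ρ v)

    level : Fin n → Fin n → ℕ
    level y v = key (height y v) v

    level-lipschitz : ∀ {y} v → Alive y → (i : Fin (degree y)) → level (nb y i) v ≤ level y v + n
    level-lipschitz {y} v a i = ≤-trans
      (key-mono-≤ v (≤-trans (shift (suc (ρ v)) (dist (nb y i) v))
                             (s≤s (∸-monoʳ-≤ (suc (ρ v)) (dist-lipschitz v a i)))))
      (≤-reflexive (key-suc (height y v) v))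
      where
      shift : ∀ m d → m ∸ d ≤ suc (m ∸ suc d)
      shift zero    d       = ≤-trans (≤-reflexive (0∸n≡0 d)) z≤n
      shift (suc m) zero    = ≤-refl
      shift (suc m) (suc d) = shift m d

    -- For distinct centres, two gaps of more than `n` would alternate with two changes of at most
    -- `n` along the edge and close into a strict cycle. The port `j` supplies the edge in the
    -- reverse direction.
    gap-adjacent : ∀ {y v w} → Alive y → (i : Fin (degree y)) → Alive (nb y i) → (j : Fin (degree (nb y i))) →
                   nb (nb y i) j ≡ y → Gap y v → Gap (nb y i) w → v ≡ w
    gap-adjacent {y} {v} {w} y∈ i z∈ j back (v∈ , _ , gap-y) (w∈ , _ , gap-z) with v FinP.≟ w
    ... | yes v≡w = v≡w
    ... | no  v≢w = contradiction (begin-strict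
      level z w       ≤⟨ level-lipschitz w y∈ i ⟩
      level y w + n   <⟨ gap-y w w∈ (v≢w ∘ sym) ⟩
      level y v       ≤⟨ subst (λ u → level u v ≤ level z v + n) back (level-lipschitz v z∈ j) ⟩
      level z v + n   <⟨ gap-z v v∈ v≢w ⟩
      level z w       ∎) (<-irrefl refl)
      where
      open ≤-Reasoning
      z = nb y i

    module _ (quiet : ∀ v → Alive v → ρ v ≤ k) (wide : n * (2 + k) ≤ 2 ^ w) where
      gap-dist : ∀ {y v} → Gap y v → suc (dist y v) ≤ k
      gap-dist {y} {v} (v∈ , 2≤h , _) = ≤-trans
        (s≤s⁻¹ (2≤m∸d⇒2+d≤m (dist y v) 2≤h)) (quiet v v∈)
        where
        2≤m∸d⇒2+d≤m : ∀ d {m} → 2 ≤ suc m ∸ d → 2 + d ≤ suc m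
        2≤m∸d⇒2+d≤m d {m} lt = subst (_≤ suc m) (+-comm d 2)
          (subst (d + 2 ≤_) (m+[n∸m]≡n {d} {suc m} (<⇒≤ (m∸n≢0⇒n<m {suc m} {d} λ e → contradiction (subst (2 ≤_) e lt) λ ())))
            (+-monoʳ-≤ d lt))

      -- On the first edge of a shortest path to `v` the value of `v` grows by exactly one, and
      -- every other value by at most one.
      gap-step : ∀ {y v d} → Alive y → Gap y v → dist y v ≡ suc d →
        ∃ λ i → Alive (nb y i) × dist (nb y i) v ≡ d × Gap (nb y i) v
      gap-step {y} {v} {d} y∈ gap@(v∈ , 2≤h , above) e
        with subst (Path y v) e (dist-path (≤-trans (n≤1+n _) (gap-dist gap)))
      ... | step _ i p = i , path-source p , closer , v∈ , ≤-trans 2≤h (≤-trans (n≤1+n _) (≤-reflexive (sym higher))) ,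
        λ u u∈ u≢v → begin-strict
          level z u + n           ≤⟨ +-monoˡ-≤ n (level-lipschitz u y∈ i) ⟩
          level y u + n + n       <⟨ +-monoˡ-< n (above u u∈ u≢v) ⟩
          level y v + n           ≡⟨ key-suc (height y v) v ⟨
          key (suc (height y v)) v ≡⟨ cong (λ h → key h v) higher ⟨
          level z v               ∎
        where
        open ≤-Reasoning
        z = nb y i
        closer : dist z v ≡ d
        closer = ≤-antisym (dist≤ p) (s≤s⁻¹ (subst (_≤ suc (dist z v)) e (dist-lipschitz v y∈ i)))
        -- Height at least 2 places `y` within the radius of `v`, so the truncated subtraction is
        -- exact here.
        higher : height z v ≡ suc (height y v)
        higher = begin-equality
          suc (ρ v) ∸ dist z v          ≡⟨ cong (suc (ρ v) ∸_) closer ⟩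
          suc (ρ v) ∸ d                 ≡⟨ +-∸-assoc 1 (≤-trans (n≤1+n d) (subst (_≤ ρ v) e inside)) ⟩
          suc (ρ v ∸ d)                 ≡⟨ cong (λ m → suc (suc (ρ v) ∸ m)) e ⟨
          suc (height y v)              ∎
          where
          inside : dist y v ≤ ρ v
          inside = s≤s⁻¹ (m∸n≢0⇒n<m λ e → contradiction (subst (2 ≤_) e 2≤h) λ ())

      -- Soundness of a stored number: an empty slot, or a value not exceeding what `v` delivers
      -- along an actual path of survivors.
      Valid : Fin n → ℕ → Set
      Valid y x = x < n ⊎ ∃₂ λ v d → ∃ λ h → x ≡ key (suc h) v × Path y v d × suc h + d ≤ suc (ρ v)

      n>0 : 0 < n
      n>0 = >-nonZero⁻¹ n

      -- A radius of at most `k` gives a value of at most `k + 1` and so a key below `(2 + k) n`;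
      -- this is the origin of the bound in `wide`.
      valid-bounded : ∀ {y x} → Valid y x → x < 2 ^ w
      valid-bounded (inj₁ x<n) = <-≤-trans x<n (≤-trans (m≤m*n n (2 + k)) wide)
      valid-bounded (inj₂ (v , d , h , refl , p , h≤)) = <-≤-trans
        (+-mono-<-≤ (toℕ<n v) (*-monoˡ-≤ n (≤-trans (m≤m+n (suc h) d) (≤-trans h≤ (s≤s (quiet v (path-target p)))))))
        (≤-trans (≤-reflexive (*-comm (2 + k) n)) wide)

      valid-∸ : ∀ {y i x} → Alive y → Valid (nb y i) x → Valid y (x ∸ n)
      valid-∸ {x = x} y∈ (inj₁ x<n) = inj₁ (≤-<-trans (m∸n≤m x n) x<n)
      valid-∸ {i = i} y∈ (inj₂ (v , d , h , refl , p , h≤)) = drop h h≤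
        where
        lower : ∀ h → key (suc h) v ∸ n ≡ key h v
        lower h = trans (cong (_∸ n) (key-suc h v)) (m+n∸n≡m (key h v) n)
        drop : ∀ h → suc h + d ≤ suc (ρ v) → Valid _ (key (suc h) v ∸ n)
        drop zero    _  = inj₁ (subst (_< n) (sym (trans (lower 0) (+-identityʳ (toℕ v)))) (toℕ<n v))
        drop (suc h) h≤ = inj₂ (v , suc d , h , lower (suc h) , step y∈ i p ,
                                subst (_≤ suc (ρ v)) (cong suc (sym (+-suc h d))) h≤)

      received : ∀ z b → (Alive z → Both (Valid z) b) →
        decode (encode w (offer (lab z) b)) ≡ offer (lab z) b
      received z b valid with lab z
      ... | nothing = let v₁ , v₂ = valid refl in
                      decode-encode w (valid-bounded v₁) (valid-bounded v₂)
      ... | just _  = decode-encode w (m^n>0 2 w) (m^n>0 2 w)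

      best-valid : ∀ s {y} → Alive y → Both (Valid y) (best s y)
      best-valid zero    {y} y∈ = inj₂ (y , 0 , ρ y , refl , here y∈ , ≤-reflexive (+-identityʳ _)) , inj₁ n>0
      best-valid (suc s) {y} y∈ = gather-all {Valid y} (inbox s y) incoming (best-valid s y∈)
        where
        incoming : ∀ i → Both (λ x → Valid y (x ∸ n)) (inbox s y i)
        incoming i = subst (Both λ x → Valid y (x ∸ n)) (sym (received (nb y i) _ (best-valid s))) (go (lab (nb y i)) refl)
          where
          go : ∀ m → lab (nb y i) ≡ m → Both (λ x → Valid y (x ∸ n)) (offer m (best s (nb y i)))
          go nothing  z∈ = let v₁ , v₂ = best-valid s z∈ in valid-∸ y∈ v₁ , valid-∸ y∈ v₂
          go (just _) _  = valid-∸ {i = i} y∈ (inj₁ n>0) , valid-∸ {i = i} y∈ (inj₁ n>0)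

      best-ranked : ∀ s y → Ranked (best s y)
      best-ranked zero    y = ranked z≤n (inj₁ n>0)
      best-ranked (suc s) y = gather-ranked (inbox s y) (best-ranked s y)

      -- Induction along the path: the next vertex holds a value one higher, and `dominates-step`
      -- carries it across the edge. Its side condition holds because that value is at least 2.
      best-complete : ∀ s {y v d} h → Path y v d → d ≤ s → suc h + d ≤ suc (ρ v) →
                      Dominates (best s y) (key (suc h) v)
      best-complete zero {v = v} h (here _) _ h≤ = inj₂
        ( key-mono-≤ v (subst (_≤ suc (ρ v)) (+-identityʳ (suc h)) h≤)
        , trans (key-% (suc (ρ v)) v) (sym (key-% (suc h) v)))
      best-complete (suc s) h p@(here _) _ h≤ =
        gather-old (inbox s _) (best-ranked s _) (best-complete s h p z≤n h≤)
      best-complete (suc s) {y} {v} {suc d} h (step y∈ i p) (s≤s d≤s) h≤ =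
        subst (Dominates (best (suc s) y)) (trans (cong (_∸ n) (key-suc (suc h) v)) (m+n∸n≡m _ n))
          (dominates-step (best-ranked s z)
            (subst (Both λ x → Dominates (best (suc s) y) (x ∸ n))
              (trans (received z _ (best-valid s)) (cong (λ m → offer m (best s z)) (path-source p)))
              (gather-new (inbox s y) (best-ranked s y) i))
            (best-complete s (suc h) p d≤s (subst (_≤ suc (ρ v)) (cong suc (+-suc h d)) h≤))
            (≤-trans (+-monoʳ-≤ n (≤-trans (m≤m+n n (h * n)) ≤-refl)) (key-lower (2 + h) v)))
        where z = nb y i

      valid≤level : ∀ {y x} → n ≤ x → Valid y x → ∃ λ v → Alive v × x % n ≡ toℕ v × x ≤ level y v
      valid≤level n≤x (inj₁ x<n) = contradiction n≤x (<⇒≱ x<n)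
      valid≤level {y} _ (inj₂ (v , d , h , refl , p , h≤)) =
        v , path-target p , key-% (suc h) v ,
        key-mono-≤ v (≤-trans (m+n≤o⇒m≤o∸n (suc h) h≤) (∸-monoʳ-≤ (suc (ρ v)) (dist≤ p)))

      -- Positive height bounds the distance by the radius, hence by `k`, so `k` rounds are enough
      -- for the value to arrive.
      level-dominated : ∀ {y w} → Alive w → 1 ≤ height y w → Dominates (best k y) (level y w)
      level-dominated {y} {w} w∈ 1≤h = subst (λ h → Dominates (best k y) (key h w)) suc-pred′
        (best-complete k (pred (height y w)) (dist-path near) near
          (subst (λ h → h + dist y w ≤ suc (ρ w)) (sym suc-pred′) (≤-reflexive (m∸n+n≡m (≤-trans near′ (n≤1+n _))))))
        where
        near′ : dist y w ≤ ρ w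
        near′ = s≤s⁻¹ (m∸n≢0⇒n<m λ e → contradiction (subst (1 ≤_) e 1≤h) λ ())
        near : dist y w ≤ k
        near = ≤-trans near′ (quiet w w∈)
        suc-pred′ : suc (pred (height y w)) ≡ height y w
        suc-pred′ = suc-pred (height y w) {{>-nonZero 1≤h}}

      -- The first entry never overestimates the level of its origin. A rival of positive height is
      -- dominated either by the second entry, where the test supplies the gap, or by the first with
      -- equal origin, which makes it no rival. A rival of height 0 has a key below `n`, which the
      -- condition `n + n ≤ y₁` covers.
      joins⇒gap : ∀ {y} → Alive y → Joins (best k y) →
                  ∃ λ v → Gap y v × proj₁ (best k y) % n ≡ toℕ v
      joins⇒gap {y} y∈ (gap , 2n≤x)
        with valid≤level (≤-trans (m≤m+n n n) 2n≤x) (proj₁ (best-valid k y∈))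
      ... | v , v∈ , e , x≤ = v , (v∈ , high , others) , e
        where
        open ≤-Reasoning
        x₁ = proj₁ (best k y)
        x₂ = proj₂ (best k y)
        high : 2 ≤ height y v
        high = ≮⇒≥ λ h<2 → <⇒≱ (begin-strict
          level y v        ≤⟨ key-mono-≤ v (s≤s⁻¹ h<2) ⟩
          toℕ v + (n + 0)  ≡⟨ cong (toℕ v +_) (+-identityʳ n) ⟩
          toℕ v + n        <⟨ +-monoˡ-< n (toℕ<n v) ⟩
          n + n            ∎) (≤-trans 2n≤x x≤)
        others : ∀ w → Alive w → w ≢ v → level y w + n < level y v
        others w w∈ w≢v with 1 ≤? height y w
        ... | no h<1 = begin-strict
          level y w + n      ≡⟨ cong (λ h → key h w + n) (n<1⇒n≡0 (≰⇒> h<1)) ⟩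
          toℕ w + 0 + n      ≡⟨ cong (_+ n) (+-identityʳ (toℕ w)) ⟩
          toℕ w + n          <⟨ +-monoˡ-< n (toℕ<n w) ⟩
          n + n              ≤⟨ 2n≤x ⟩
          x₁                 ≤⟨ x≤ ⟩
          level y v          ∎
        ... | yes 1≤h with level-dominated w∈ 1≤h
        ...   | inj₁ ≤x₂ = begin-strict
          level y w + n      ≤⟨ +-monoˡ-≤ n ≤x₂ ⟩
          x₂ + n             <⟨ gap ⟩
          x₁                 ≤⟨ x≤ ⟩
          level y v          ∎
        ...   | inj₂ (_ , e′) = contradiction
          (toℕ-injective (trans (sym (key-% (height y w) w)) (trans (sym e′) e))) w≢v

      -- If the level of `v` were dominated by the second entry, both entries would be at least as
      -- large. By validity and the gap both would then originate at `v`, against distinctness of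
      -- origins.
      gap⇒joins : ∀ {y v} → Alive y → Gap y v → Joins (best k y)
      gap⇒joins {y} {v} y∈ (v∈ , 2≤h , above) =
        go (level-dominated v∈ (≤-trans (n≤1+n 1) 2≤h)) (best-valid k y∈) (best-ranked k y)
        where
        open ≤-Reasoning
        2n≤ : n + n ≤ level y v
        2n≤ = ≤-trans (≤-reflexive (cong (n +_) (sym (+-identityʳ n)))) (≤-trans (*-monoˡ-≤ n 2≤h) (key-lower (height y v) v))
        only : ∀ {x} → level y v ≤ x → Valid y x → x % n ≡ toℕ v
        only {x} ≤x valid with valid≤level (≤-trans (≤-trans (m≤m+n n n) 2n≤) ≤x) valid
        ... | w , w∈ , e , x≤ with w FinP.≟ v
        ...   | yes refl = e
        ...   | no  w≢v  = contradiction (≤-<-trans (≤-trans ≤x (≤-trans x≤ (m≤m+n _ n))) (above w w∈ w≢v)) (<-irrefl refl)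
        go : ∀ {b} → Dominates b (level y v) → Both (Valid y) b → Ranked b → Joins b
        go {x₁ , x₂} (inj₁ ≤x₂) (valid₁ , valid₂) (ranked o (inj₁ x₂<n)) =
          contradiction (≤-trans (≤-trans (m≤m+n n n) 2n≤) ≤x₂) (<⇒≱ x₂<n)
        go {x₁ , x₂} (inj₁ ≤x₂) (valid₁ , valid₂) (ranked o (inj₂ ≢)) =
          contradiction (trans (only (≤-trans ≤x₂ o) valid₁) (sym (only ≤x₂ valid₂))) ≢
        go {x₁ , x₂} (inj₂ (≤x₁ , e)) (valid₁ , valid₂) (ranked o d) = below , ≤-trans 2n≤ ≤x₁
          where
          below : x₂ + n < x₁
          below with x₂ <? n
          ... | yes x₂<n = <-≤-trans (+-monoˡ-< n x₂<n) (≤-trans 2n≤ ≤x₁)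
          ... | no  x₂≮n with valid≤level (≮⇒≥ x₂≮n) valid₂
          ...   | w , w∈ , e₂ , x₂≤ = <-≤-trans (≤-<-trans (+-monoˡ-≤ n x₂≤) (above w w∈ w≢v)) ≤x₁
            where
            w≢v : w ≢ v
            w≢v refl = [ x₂≮n , (λ ≢ → ≢ (trans (trans e (key-% (height y v) v)) (sym e₂))) ]′ d

  -- The failure probability over all phases

  module Process (n : ℕ) .{{_ : NonZero n}} {degree : Fin n → ℕ}
                 (nb : ∀ v → Fin (degree v) → Fin n) (w k : ℕ) where
    open TopTwo n
    module Ph = Phase n nb w k

    Labels : Set
    Labels = Fin n → Maybe ℕ

    next : ℕ → Labels → (Fin n → ℕ) → Labels
    next t lab ρ v = relabel t (lab v) (Ph.best lab ρ k v)

    Bad : Labels → (Fin n → ℕ) → Set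
    Bad lab ρ = ∃ λ v → lab v ≡ nothing × suc k ≤ ρ v

    bad? : (lab : Labels) (ρ : Fin n → ℕ) (v : Fin n) → Dec (lab v ≡ nothing × suc k ≤ ρ v)
    bad? lab ρ v = unlabelled? (lab v) ×-dec (suc k ≤? ρ v)

    -- Formulated from an arbitrary labelling with the radii still to come, so that induction can
    -- run over the remaining phases.
    Fails : ℕ → ℕ → Labels → (ℕ → Vec ℕ n) → Set
    Fails zero    t lab R = ∃ λ v → lab v ≡ nothing
    Fails (suc T) t lab R =
      Bad lab (lookup (R 0)) ⊎ Fails T (suc t) (next t lab (lookup (R 0))) (R ∘ suc)

    fails? : ∀ T t (lab : Labels) (R : ℕ → Vec ℕ n) → Dec (Fails T t lab R)
    fails? zero    t lab R = any? λ v → unlabelled? (lab v)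
    fails? (suc T) t lab R = any? (bad? lab (lookup (R 0))) ⊎-dec fails? T (suc t) _ (R ∘ suc)

    fails-resp : ∀ T {t lab R R′} → (∀ s → R s ≡ R′ s) → Fails T t lab R → Fails T t lab R′
    fails-resp zero    e f = f
    fails-resp (suc T) e (inj₁ bad) = inj₁ (subst (Bad _ ∘ lookup) (e 0) bad)
    fails-resp (suc T) {t} {lab} {R} {R′} e (inj₂ f) = inj₂ (fails-resp T (e ∘ suc)
      (subst (λ r → Fails T (suc t) (next t lab (lookup r)) (R ∘ suc)) (e 0) f))

    population : Labels → ℕ
    population lab = sum λ v → 𝟙 (unlabelled? (lab v))

    module Failure (wide : n * (2 + k) ≤ 2 ^ w) (B a : ℕ) .{{_ : NonZero B}} (a≤B : a ≤ B) where
      open Geometric B a a≤B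

      Q : ℕ
      Q = B ^ suc k

      module _ (lab : Labels) where
        open Survivors nb k lab

        wins? : ∀ y (x : Vec (Fin Q) n) → Dec (At.Wins y (suc k) (radii (suc k) x))
        wins? y x = At.Wins? y (suc k) (radii (suc k) x)

        loses-unlikely : ∀ {y} → lab y ≡ nothing →
          B * ∑Vec Q n (λ x → 𝟙 (¬? (wins? y x))) ≤ (B ∸ a) * Q ^ n
        loses-unlikely {y} y∈ = +-cancelʳ-≤ (a * Q ^ n) _ _ (begin
          B * ∑Vec Q n lose + a * Q ^ n
            ≤⟨ +-monoʳ-≤ _ (At.wins-likely y a≤B k y∈ (dist-refl y∈)) ⟩
          B * ∑Vec Q n lose + B * ∑Vec Q n win
            ≡⟨ *-distribˡ-+ B _ _ ⟨
          B * (∑Vec Q n lose + ∑Vec Q n win)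
            ≡⟨ cong (B *_) (∑Vec-distrib-+ n lose win) ⟨
          B * ∑Vec Q n (λ x → lose x + win x)
            ≡⟨ cong (B *_) (trans (∑Vec-cong λ x → total (wins? y x)) (trans (∑Vec-const n 1) (*-identityʳ _))) ⟩
          B * Q ^ n
            ≡⟨ cong (_* Q ^ n) (m∸n+n≡m a≤B) ⟨
          (B ∸ a + a) * Q ^ n
            ≡⟨ *-distribʳ-+ (Q ^ n) (B ∸ a) a ⟩
          (B ∸ a) * Q ^ n + a * Q ^ n ∎)
          where
          open ≤-Reasoning
          lose win : Vec (Fin Q) n → ℕ
          lose x = 𝟙 (¬? (wins? y x))
          win x = 𝟙 (wins? y x)
          total : ∀ {P : Set} (P? : Dec P) → 𝟙 (¬? P?) + 𝟙 P? ≡ 1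
          total (yes _) = refl
          total (no  _) = refl

        quiet : ∀ {ρ} → ¬ Bad lab ρ → ∀ v → lab v ≡ nothing → ρ v ≤ k
        quiet ¬bad v v∈ = ≮⇒≥ λ lt → ¬bad (v , v∈ , lt)

        -- A win at the cap would be a survivor with a radius above `k`, which is `Bad`; what
        -- remains is a true gap, and `gap⇒joins` detects it.
        win⇒labelled : ∀ t {ρ y} → ¬ Bad lab ρ → lab y ≡ nothing → At.Wins y (suc k) ρ →
                       next t lab ρ y ≢ nothing
        win⇒labelled t {ρ} {y} ¬bad y∈ (v , inj₂ ((v∈ , _) , k<)) = contradiction (v , v∈ , k<) ¬bad
        win⇒labelled t {ρ} {y} ¬bad y∈ (v , inj₁ gap) eq =
          contradiction (trans (sym eq) (trans (cong (λ m → relabel t m (Ph.best lab ρ k y)) y∈)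
            (relabel-joins t _ (Ph.gap⇒joins lab ρ (quiet ¬bad) wide y∈ gap)))) λ ()

        next-unlabelled : ∀ t {ρ y} → next t lab ρ y ≡ nothing → lab y ≡ nothing
        next-unlabelled t {ρ} {y} eq with lab y
        ... | nothing = refl

      -- The integer form of `(1 - p)^T + p^k`, multiplied by `B ^ (suc k + T)`: the failure bound
      -- per survivor with `T` phases to go.
      bound : ℕ → ℕ
      bound T = (B ∸ a) ^ T * B ^ suc k + a ^ k * B ^ suc T

      private
        ^-distrib-* : ∀ x y m → (x * y) ^ m ≡ x ^ m * y ^ m
        ^-distrib-* x y zero    = refl
        ^-distrib-* x y (suc m) = trans (cong (x * y *_) (^-distrib-* x y m)) (regroup x y (x ^ m) (y ^ m))
          where
          regroup : ∀ x y p q → x * y * (p * q) ≡ x * p * (y * q)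
          regroup = solve-∀

      module _ (T t : ℕ) (lab : Labels)
        (IH : ∀ lab → B ^ (suc k + T) * ∑Vec (Q ^ T) n (λ y → 𝟙 (fails? T (suc t) lab (rows (suc k) T y)))
                      ≤ population lab * (bound T * (Q ^ T) ^ n)) where
        private
          M = B ^ (suc k + T)
          V = (Q ^ T) ^ n
          alive : Fin n → ℕ
          alive v = 𝟙 (unlabelled? (lab v))
          top lose : Fin n → Vec (Fin Q) n → ℕ
          top v x = 𝟙 (suc k ≤? radii (suc k) x v)
          lose v x = 𝟙 (¬? (wins? lab v x))
          joint : Vec (Fin Q) n → Vec (Fin (Q ^ T)) n → ℕ → Vec ℕ n
          joint x y = rows (suc k) (suc T) (zipWith combine x y)
          after : Vec (Fin Q) n → Vec (Fin (Q ^ T)) n → ℕ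
          after x y = 𝟙 (fails? (suc T) t lab (joint x y))

        -- With the radii of the present phase fixed, failure is charged to survivors. One whose
        -- radius reaches the cap pays for certain failure; if there is none, every survivor that
        -- does not win pays the inductive bound.
        fails-inner : ∀ x → M * ∑Vec (Q ^ T) n (after x) ≤
          V * sum λ v → alive v * (M * top v x + bound T * lose v x)
        fails-inner x = go (any? (bad? lab ρ))
          where
          open ≤-Reasoning
          ρ = radii (suc k) x
          cost : Fin n → ℕ
          cost v = alive v * (M * top v x + bound T * lose v x)
          go : Dec (Bad lab ρ) → M * ∑Vec (Q ^ T) n (after x) ≤ V * sum cost
          go (yes (v , v∈ , k<)) = begin
            M * ∑Vec (Q ^ T) n (after x)  ≤⟨ *-monoʳ-≤ M (∑Vec-mono λ y → 𝟙≤1 (fails? (suc T) t lab (joint x y))) ⟩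
            M * ∑Vec (Q ^ T) n (λ _ → 1)  ≡⟨ cong (M *_) (trans (∑Vec-const n 1) (*-identityʳ V)) ⟩
            M * V                         ≡⟨ *-comm M V ⟩
            V * M                         ≤⟨ *-monoʳ-≤ V (≤-trans expensive (term≤∑ cost v)) ⟩
            V * sum cost                  ∎
            where
            expensive : M ≤ cost v
            expensive = begin
              M            ≡⟨ *-identityʳ M ⟨
              M * 1        ≡⟨ cong (M *_) (𝟙-yes (suc k ≤? ρ v) k<) ⟨
              M * top v x  ≤⟨ m≤m+n _ _ ⟩
              M * top v x + bound T * lose v x  ≡⟨ *-identityˡ _ ⟨
              1 * (M * top v x + bound T * lose v x)
                ≡⟨ cong (_* (M * top v x + bound T * lose v x)) (𝟙-yes (unlabelled? (lab v)) v∈) ⟨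
              cost v       ∎
          go (no ¬bad) = begin
            M * ∑Vec (Q ^ T) n (after x)
              ≤⟨ *-monoʳ-≤ M (∑Vec-mono λ y →
                   𝟙-mono (fails? (suc T) t lab (joint x y)) (fails? T (suc t) lab′ (rows (suc k) T y)) (later y)) ⟩
            M * ∑Vec (Q ^ T) n (λ y → 𝟙 (fails? T (suc t) lab′ (rows (suc k) T y)))
              ≤⟨ IH lab′ ⟩
            population lab′ * (bound T * V)
              ≡⟨ trans (*-comm (population lab′) _) (trans (cong (_* population lab′) (*-comm (bound T) V)) (*-assoc V _ _)) ⟩
            V * (bound T * population lab′)
              ≡⟨ cong (V *_) (*-distribˡ-sum {n} (bound T) _) ⟩
            V * sum (λ v → bound T * 𝟙 (unlabelled? (lab′ v)))
              ≤⟨ *-monoʳ-≤ V (∑-mono survivor) ⟩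
            V * sum cost ∎
            where
            lab′ = next t lab ρ
            later : ∀ y → Fails (suc T) t lab (joint x y) → Fails T (suc t) lab′ (rows (suc k) T y)
            later y f = [ (λ bad → contradiction bad ¬bad) , id ]′ (fails-resp (suc T) {R′ = R′} same f)
              where
              R′ : ℕ → Vec ℕ n
              R′ zero    = map (radius (suc k)) x
              R′ (suc s) = rows (suc k) T y s
              same : ∀ s → joint x y s ≡ R′ s
              same zero    = rows-zero (suc k) T x y
              same (suc s) = rows-suc (suc k) T x y s
            survivor : ∀ v → bound T * 𝟙 (unlabelled? (lab′ v)) ≤ cost v
            survivor v = begin
              bound T * 𝟙 (unlabelled? (lab′ v))
                ≤⟨ *-monoʳ-≤ (bound T) (lasting (unlabelled? (lab′ v)) (unlabelled? (lab v)) (¬? (wins? lab v x))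
                     (λ v∈ → next-unlabelled lab t v∈ , λ wins → win⇒labelled lab t ¬bad (next-unlabelled lab t v∈) wins v∈)) ⟩
              bound T * (alive v * lose v x)
                ≡⟨ *-left-comm (bound T) (alive v) (lose v x) ⟩
              alive v * (bound T * lose v x)
                ≤⟨ *-monoʳ-≤ (alive v) (m≤n+m _ _) ⟩
              cost v ∎
              where
              lasting : ∀ {P P′ P″ : Set} (P? : Dec P) (P′? : Dec P′) (P″? : Dec P″) → (P → P′ × P″) →
                        𝟙 P? ≤ 𝟙 P′? * 𝟙 P″?
              lasting P? P′? P″? imp = ≤-trans (𝟙-mono P? (P′? ×-dec P″?) imp) (≤-reflexive (prod P′? P″?))
                where
                prod : ∀ {P P′ : Set} (P? : Dec P) (P′? : Dec P′) → 𝟙 (P? ×-dec P′?) ≡ 𝟙 P? * 𝟙 P′?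
                prod (yes _) (yes _) = refl
                prod (yes _) (no  _) = refl
                prod (no  _) _       = refl

        -- A survivor reaches the cap with probability `p^(k+1)` and loses with probability at most
        -- `1 - p`. The identity `collect` is then `(1 - p) ((1 - p)^T + p^k) + p^(k+1) = (1 -
        -- p)^(T+1) + p^k`, cleared of denominators.
        cost-sum : ∀ v → alive v * (B * ∑Vec Q n (λ x → M * top v x + bound T * lose v x)) ≤
                         alive v * (bound (suc T) * Q ^ n)
        cost-sum v = 𝟙-*-mono (unlabelled? (lab v)) λ v∈ → (begin
          B * ∑Vec Q n (λ x → M * top v x + bound T * lose v x)
            ≡⟨ cong (B *_) (trans (∑Vec-distrib-+ n _ _)
                 (cong₂ _+_ (sym (*-distribˡ-∑Vec n M _)) (sym (*-distribˡ-∑Vec n (bound T) _)))) ⟩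
          B * (M * ∑Vec Q n (top v) + bound T * ∑Vec Q n (lose v))
            ≡⟨ cong (λ m → B * (m * ∑Vec Q n (top v) + bound T * ∑Vec Q n (lose v))) (^-distribˡ-+-* B (suc k) T) ⟩
          B * (B ^ suc k * B ^ T * ∑Vec Q n (top v) + bound T * ∑Vec Q n (lose v))
            ≡⟨ regroup B (B ^ suc k) (B ^ T) _ (bound T) _ ⟩
          B ^ suc T * (B ^ suc k * ∑Vec Q n (top v)) + bound T * (B * ∑Vec Q n (lose v))
            ≤⟨ +-mono-≤ (*-monoʳ-≤ (B ^ suc T) (≤-reflexive (∑Vec-radius-top (suc k) v)))
                        (*-monoʳ-≤ (bound T) (loses-unlikely lab v∈)) ⟩
          B ^ suc T * (a ^ suc k * Q ^ n) + bound T * ((B ∸ a) * Q ^ n)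
            ≡⟨ collect B a (B ∸ a) (B ^ suc T) (a ^ k) ((B ∸ a) ^ T) (B ^ suc k) (Q ^ n) ⟩
          ((B ∸ a) ^ suc T * B ^ suc k + a ^ k * ((a + (B ∸ a)) * B ^ suc T)) * Q ^ n
            ≡⟨ cong (λ b → ((B ∸ a) ^ suc T * B ^ suc k + a ^ k * (b * B ^ suc T)) * Q ^ n) (m+[n∸m]≡n a≤B) ⟩
          bound (suc T) * Q ^ n ∎)
          where
          open ≤-Reasoning
          regroup : ∀ b q s x f y → b * (q * s * x + f * y) ≡ b * s * (q * x) + f * (b * y)
          regroup = solve-∀
          collect : ∀ B a u s p r q N →
            s * (a * p * N) + (r * q + p * s) * (u * N) ≡ (u * r * q + p * ((a + u) * s)) * N
          collect = solve-∀

        fails-step : B ^ (suc k + suc T) * ∑Vec (Q ^ suc T) n (λ x → 𝟙 (fails? (suc T) t lab (rows (suc k) (suc T) x)))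
                     ≤ population lab * (bound (suc T) * (Q ^ suc T) ^ n)
        fails-step = begin
          B ^ (suc k + suc T) * ∑Vec (Q ^ suc T) n (λ x → 𝟙 (fails? (suc T) t lab (rows (suc k) (suc T) x)))
            ≡⟨ cong₂ _*_ (cong (B ^_) (+-suc (suc k) T)) (∑Vec-combine Q (Q ^ T) n _) ⟩
          B * M * ∑Vec Q n (λ x → ∑Vec (Q ^ T) n (after x))
            ≡⟨ trans (*-assoc B M _) (cong (B *_) (*-distribˡ-∑Vec n M _)) ⟩
          B * ∑Vec Q n (λ x → M * ∑Vec (Q ^ T) n (after x))
            ≤⟨ *-monoʳ-≤ B (∑Vec-mono fails-inner) ⟩
          B * ∑Vec Q n (λ x → V * sum λ v → alive v * (M * top v x + bound T * lose v x))
            ≡⟨ cong (B *_) (trans (sym (*-distribˡ-∑Vec n V _)) (cong (V *_) (∑Vec-∑-comm n n _))) ⟩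
          B * (V * sum λ v → ∑Vec Q n λ x → alive v * (M * top v x + bound T * lose v x))
            ≡⟨ *-left-comm B V _ ⟩
          V * (B * sum λ v → ∑Vec Q n λ x → alive v * (M * top v x + bound T * lose v x))
            ≡⟨ cong (V *_) (trans (*-distribˡ-sum {n} B _) (sum-cong-≗ {n} λ v →
                 trans (cong (B *_) (sym (*-distribˡ-∑Vec n (alive v) _))) (*-left-comm B (alive v) _))) ⟩
          V * sum (λ v → alive v * (B * ∑Vec Q n λ x → M * top v x + bound T * lose v x))
            ≤⟨ *-monoʳ-≤ V (∑-mono cost-sum) ⟩
          V * sum (λ v → alive v * (bound (suc T) * Q ^ n))
            ≡⟨ cong (V *_) (*-distribʳ-sum {n} _ alive) ⟨
          V * (population lab * (bound (suc T) * Q ^ n))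
            ≡⟨ final V (population lab) (bound (suc T)) (Q ^ n) ⟩
          population lab * (bound (suc T) * (Q ^ n * V))
            ≡⟨ cong (λ z → population lab * (bound (suc T) * z)) (^-distrib-* Q (Q ^ T) n) ⟨
          population lab * (bound (suc T) * (Q ^ suc T) ^ n) ∎
          where
          open ≤-Reasoning
          final : ∀ v p f m → v * (p * (f * m)) ≡ p * (f * (m * v))
          final = solve-∀

      fails-bound : ∀ T t lab →
        B ^ (suc k + T) * ∑Vec (Q ^ T) n (λ x → 𝟙 (fails? T t lab (rows (suc k) T x))) ≤
        population lab * (bound T * (Q ^ T) ^ n)
      fails-bound zero t lab = begin
        B ^ (suc k + 0) * ∑Vec 1 n (λ x → 𝟙 (fails? 0 t lab (rows (suc k) 0 x)))
          ≡⟨ cong₂ (λ e s → B ^ e * s) (+-identityʳ (suc k)) (trans (∑Vec-const n some) (*-comm (1 ^ n) some)) ⟩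
        B ^ suc k * (some * 1 ^ n)
          ≤⟨ *-mono-≤ (≤-trans (m≤m+n (B ^ suc k) 0) (m≤m+n (B ^ suc k + 0) _))
                      (*-monoˡ-≤ (1 ^ n) (𝟙-∃≤∑ (λ v → unlabelled? (lab v)) any-alive?)) ⟩
        bound 0 * (population lab * 1 ^ n)
          ≡⟨ *-left-comm (bound 0) (population lab) (1 ^ n) ⟩
        population lab * (bound 0 * 1 ^ n) ∎
        where
        open ≤-Reasoning
        any-alive? : Dec (∃ λ v → lab v ≡ nothing)
        any-alive? = any? λ v → unlabelled? (lab v)
        some = 𝟙 any-alive?
      fails-bound (suc T) t lab = fails-step T t lab λ lab′ → fails-bound T (suc t) lab′

  -- The labels of a whole run

  module History (n : ℕ) .{{_ : NonZero n}} {degree : Fin n → ℕ}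
                 (nb : ∀ v → Fin (degree v) → Fin n) (w k : ℕ) (R : ℕ → Vec ℕ n) where
    open TopTwo n
    open Process n nb w k

    labels : ℕ → Labels
    labels zero    v = nothing
    labels (suc t)   = next t (labels t) (lookup (R t))

    best : ℕ → ℕ → Fin n → Pair
    best t = Ph.best (labels t) (lookup (R t))

    succeeds : ∀ T t {R′} → (∀ s → R′ s ≡ R (t + s)) → ¬ Fails T t (labels t) R′ →
      (∀ s → t ≤ s → s < t + T → ¬ Bad (labels s) (lookup (R s))) × (∀ v → labels (t + T) v ≢ nothing)
    succeeds zero t e ¬f =
      (λ s t≤s s<t → contradiction (subst (s <_) (+-identityʳ t) s<t) (≤⇒≯ t≤s)) ,
      λ v v∈ → ¬f (v , subst (λ s → labels s v ≡ nothing) (+-identityʳ t) v∈)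
    succeeds (suc T) t {R′} e ¬f = quiet , subst (λ s → ∀ v → labels s v ≢ nothing) (sym (+-suc t T)) (proj₂ rest)
      where
      now : R′ 0 ≡ R t
      now = trans (e 0) (cong R (+-identityʳ t))
      rest = succeeds T (suc t) {R′ ∘ suc} (λ s → trans (e (suc s)) (cong R (+-suc t s)))
        λ f → ¬f (inj₂ (subst (λ r → Fails T (suc t) (next t (labels t) (lookup r)) (R′ ∘ suc)) (sym now) f))
      quiet : ∀ s → t ≤ s → s < t + suc T → ¬ Bad (labels s) (lookup (R s))
      quiet s t≤s s< bad with m≤n⇒m<n∨m≡n t≤s
      ... | inj₁ t<s  = proj₁ rest s t<s (subst (s <_) (+-suc t T) s<) bad
      ... | inj₂ refl = ¬f (inj₁ (subst (Bad (labels t) ∘ lookup) (sym now) bad))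

    labels-suc : ∀ {t v m} → labels t v ≡ just m → labels (suc t) v ≡ just m
    labels-suc {t} {v} e = cong (λ l → relabel t l (best t k v)) e

    labels-persist : ∀ {t v m} s → labels t v ≡ just m → labels (s + t) v ≡ just m
    labels-persist zero    e = e
    labels-persist {t} {v} (suc s) e = labels-suc {s + t} {v} (labels-persist {t} {v} s e)

    labels-trace : ∀ T {v m} → labels T v ≡ just m →
      ∃ λ t → t < T × labels t v ≡ nothing × Joins (best t k v) × m ≡ proj₁ (best t k v) % n + t * n
    labels-trace (suc T) {v} {m} e = go (labels T v) refl
      where
      go : ∀ l → labels T v ≡ l → ∃ λ t → t < suc T × labels t v ≡ nothing ×
             Joins (best t k v) × m ≡ proj₁ (best t k v) % n + t * n
      go (just m′) e′ = let t , t<T , rest = labels-trace T (trans e′ (trans (sym (labels-suc {T} {v} e′)) e)) in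
                        t , m<n⇒m<1+n t<T , rest
      go nothing   e′ = T , ≤-refl , e′ ,
        relabel-just T (best T k v) (trans (cong (λ l → relabel T l (best T k v)) (sym e′)) e)

  -- The distributed protocol

  record Local (n : ℕ) : Set where
    constructor local
    field
      me     : Fin n
      radius : ℕ → ℕ
      phase  : ℕ
      left   : ℕ
      label  : Maybe ℕ
      best   : Pair

  module Protocol (n : ℕ) .{{_ : NonZero n}} (k w phases b a : ℕ) (a≤B : a ≤ 2 ^ b) where
    open TopTwo n
    open Geometric (2 ^ b) a a≤B using (draw; rows)

    -- Each of the `k + 1` trials of a radius in each phase uses `b` fair bits, read as a number
    -- below `2 ^ b`.
    coins : ℕ
    coins = b * suc k * phases

    coins-split : 2 ^ coins ≡ ((2 ^ b) ^ suc k) ^ phases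
    coins-split = trans (sym (^-*-assoc 2 (b * suc k) phases)) (cong (_^ phases) (sym (^-*-assoc 2 b (suc k))))

    begin-phase : Fin n → (ℕ → ℕ) → ℕ → Maybe ℕ → Local n
    begin-phase me radius t label = local me radius t (pred k) label (key (suc (radius t)) me , 0)

    -- `left` starts at `pred k` because the round that finds it zero is itself the last of the
    -- phase: it gathers, decides and opens the next phase, so no round is spent on deciding.
    advance : Local n → Pair → Local n
    advance (local me radius t (suc l) label _) b = local me radius t l label b
    advance (local me radius t zero    label _) b = begin-phase me radius (suc t) (relabel t label b)

    decomposer : Algorithm n
    decomposer = record
      { coins   = coins
      ; rounds  = phases * k
      ; State   = λ _ → Local n
      ; init    = λ v z → begin-phase v (draw (suc k) phases (Fin.cast coins-split z)) 0 nothing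
      ; send    = λ s _ → encode w (offer (Local.label s) (Local.best s))
      ; receive = λ s ms → advance s (gather (decode ∘ ms) (Local.best s))
      ; output  = fromMaybe 0 ∘ Local.label
      }

    module Run {G : Graph (Fin n)} (N : PortNumbering G) (ω : Fin (Algorithm.outcomes decomposer))
               .{{_ : NonZero k}} where
      open Execution decomposer N ω
      open PortNumbering N

      coin : Fin n → Fin (((2 ^ b) ^ suc k) ^ phases)
      coin v = Fin.cast coins-split (finToFun ω v)

      R : ℕ → Vec ℕ n
      R = rows (suc k) phases (tabulate coin)

      open History n neighbour w k R

      R-lookup : ∀ t v → draw (suc k) phases (coin v) t ≡ lookup (R t) v
      R-lookup t v = sym (trans (lookup-map v _ (tabulate coin))
        (cong (λ z → draw (suc k) phases z t) (lookup∘tabulate coin v)))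

      radius : Fin n → ℕ → ℕ
      radius v = draw (suc k) phases (coin v)

      StartsPhase : ℕ → Set
      StartsPhase t = ∀ v → state (t * k) v ≡ begin-phase v (radius v) t (labels t v)

      within-phase : ∀ {t} → StartsPhase t → ∀ s l → s + l ≡ pred k → ∀ v →
        state (s + t * k) v ≡ local v (radius v) t l (labels t v) (best t s v)
      round : ∀ {t} → StartsPhase t → ∀ s l → s + l ≡ pred k → ∀ v →
        state (suc s + t * k) v ≡
        advance (local v (radius v) t l (labels t v) (best t s v)) (best t (suc s) v)

      within-phase {t} start zero l refl v = trans (start v)
        (cong (λ r → local v (radius v) t (pred k) (labels t v) (key (suc r) v , 0)) (R-lookup t v))
      within-phase start (suc s) l e v = round start s (suc l) (trans (+-suc s l) e) v

      round {t} start s l e v = cong₂ advance (here v) (trans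
        (cong (gather incoming ∘ Local.best) (here v))
        (gather-cong {m = incoming} {m′ = λ i → sent (now (neighbour v i))} (best t s v)
          λ i → cong sent (here (neighbour v i))))
        where
        now : Fin n → Local n
        now u = local u (radius u) t l (labels t u) (best t s u)
        here : ∀ u → state (s + t * k) u ≡ now u
        here = within-phase start s l e
        sent : Local n → Pair
        sent st = decode (encode w (offer (Local.label st) (Local.best st)))
        incoming : Fin (degree v) → Pair
        incoming i = sent (state (s + t * k) (neighbour v i))

      starts-phase : ∀ t → StartsPhase t
      starts-phase zero    v = refl
      starts-phase (suc t) v = subst
        (λ j → state (j + t * k) v ≡ begin-phase v (radius v) (suc t) (relabel t (labels t v) (best t j v)))
        (suc-pred k) (round (starts-phase t) (pred k) 0 (+-identityʳ (pred k)) v)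

      label-labels : ∀ v → label v ≡ fromMaybe 0 (labels phases v)
      label-labels v = cong (fromMaybe 0 ∘ Local.label) (starts-phase phases v)

      messages-short : ∀ {words} → w + w ≤ words * Log.⌈log₂ n ⌉ → MessagesWithin words
      messages-short short t v i _ = ≤-trans (≤-reflexive (length-encode w _)) short

  -- Clusters, colours and strong diameter

  cluster-≡ : {V : Set} {label : V → ℕ} {C C′ : Cluster label} → Cluster.name C ≡ Cluster.name C′ → C ≡ C′
  cluster-≡ refl = refl

  module _ {V : Set} {G : Graph V} where
    open Graph G

    _++ʷ_ : ∀ {u v x ℓ m} → Walk G u v ℓ → Walk G v x m → Walk G u x (ℓ + m)
    []      ++ʷ q = q
    (e ∷ p) ++ʷ q = e ∷ (p ++ʷ q)

    reverseʷ : ∀ {u v ℓ} → Walk G u v ℓ → Walk G v u ℓ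
    reverseʷ []              = []
    reverseʷ {ℓ = suc ℓ} (e ∷ p) = subst (Walk G _ _) (+-comm ℓ 1) (reverseʷ p ++ʷ (~-sym e ∷ []))

  module Decomposition {n : ℕ} .{{_ : NonZero n}} {G : Graph (Fin n)} (N : PortNumbering G)
    (w k phases : ℕ) (R : ℕ → Vec ℕ n) (wide : n * (2 + k) ≤ 2 ^ w) where
    open Graph G
    open PortNumbering N
    open TopTwo n
    open Process n neighbour w k
    open History n neighbour w k R

    module _ (calm : ∀ t → t < phases → ¬ Bad (labels t) (lookup (R t)))
             (done : ∀ v → labels phases v ≢ nothing)
             {label : Fin n → ℕ} (label-labels : ∀ v → label v ≡ fromMaybe 0 (labels phases v)) where

      module Srv (t : ℕ) = Survivors neighbour k (labels t)
      module Phs (t : ℕ) = Phase n neighbour w k (labels t) (lookup (R t))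

      quiet : ∀ {t} → t < phases → ∀ v → labels t v ≡ nothing → lookup (R t) v ≤ k
      quiet t< v v∈ = ≮⇒≥ λ lt → calm _ t< (v , v∈ , lt)

      Joined : ℕ → Fin n → Fin n → Set
      Joined t y v = t < phases × labels t y ≡ nothing × Phs.Gap t y v

      joined-label : ∀ {t y v} → Joined t y v → label y ≡ key t v
      joined-label {t} {y} {v} (t< , y∈ , gap) =
        trans (label-labels y) (cong (fromMaybe 0) (subst (λ s → labels s y ≡ just (key t v)) (m∸n+n≡m t<)
          (labels-persist {suc t} {y} (phases ∸ suc t) now)))
        where
        joins = Phs.gap⇒joins t (quiet t<) wide y∈ gap
        leader = Phs.joins⇒gap t (quiet t<) wide y∈ joins
        same : proj₁ leader ≡ v
        same = Srv.At.lead-unique t y {lookup (R t)}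
          (Srv.At.gap⇒lead t y (proj₁ (proj₂ leader))) (Srv.At.gap⇒lead t y gap)
        now : labels (suc t) y ≡ just (key t v)
        now = trans (cong (λ l → relabel t l (best t k y)) y∈) (trans (relabel-joins t _ joins)
          (cong (λ i → just (i + t * n)) (trans (proj₂ (proj₂ leader)) (cong toℕ same))))

      every-joined : ∀ y → ∃₂ λ t v → Joined t y v
      every-joined y with labels phases y in e
      ... | nothing = contradiction e (done y)
      ... | just m  = let t , t< , y∈ , joins , _ = labels-trace phases {y} e
                          v , gap , _ = Phs.joins⇒gap t (quiet t<) wide y∈ joins
                      in t , v , t< , y∈ , gap

      -- The name `key t v` determines the centre as its residue and the phase as its quotient
      -- modulo `n`.
      label-joined : ∀ {y t v} → label y ≡ key t v → Joined t y v
      label-joined {y} {t} {v} e with every-joined y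
      ... | s , u , joined
        with key-injective {h = s} {t} {u} {v} (trans (sym (joined-label joined)) e)
           | trans (sym (key-/ s u)) (trans (cong (_/ n) (trans (sym (joined-label joined)) e)) (key-/ t v))
      ...   | refl | refl = joined

      adjacent-joined : ∀ {t u u′ v v′} → u ~ u′ → Joined t u v → Joined t u′ v′ → v ≡ v′
      adjacent-joined {t} {u} {u′} e (_ , u∈ , gap) (_ , u′∈ , gap′) =
        Phs.gap-adjacent t u∈ (port e)
          (subst (λ z → labels t z ≡ nothing) (sym (neighbour-port e)) u′∈)
          (port back) (neighbour-port back) gap
          (subst (λ z → Phs.Gap t z _) (sym (neighbour-port e)) gap′)
        where
        back : neighbour u (port e) ~ u
        back = ~-sym (adjacent u (port e))

      colour< : ∀ {m} → (∃ λ v → label v ≡ m) → m / n < phases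
      colour< (y , refl) = let t , v , joined = every-joined y in
        subst (_< phases) (sym (trans (cong (_/ n) (joined-label joined)) (key-/ t v))) (proj₁ joined)

      -- A cluster is coloured by its phase. Adjacent vertices clustered in the same phase have the
      -- same centre by `adjacent-joined`, hence the same cluster.
      colouring : Colouring (supergraph G label) phases
      colouring = colour , proper
        where
        colour : Cluster label → Fin phases
        colour (cluster m m∈) = fromℕ< (colour< m∈)
        proper : ∀ {C C′} → Graph._~_ (supergraph G label) C C′ → colour C ≢ colour C′
        proper {cluster m m∈} {cluster m′ m′∈} (C≢C′ , u , u′ , u∈ , u′∈ , e) same =
          C≢C′ (cluster-≡ (trans (sym u∈) (trans
            (trans (joined-label joined) (trans (cong₂ key t≡t′ v≡v′) (sym (joined-label joined′)))) u′∈)))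
          where
          t = proj₁ (every-joined u)
          v = proj₁ (proj₂ (every-joined u))
          joined : Joined t u v
          joined = proj₂ (proj₂ (every-joined u))
          t′ = proj₁ (every-joined u′)
          v′ = proj₁ (proj₂ (every-joined u′))
          joined′ : Joined t′ u′ v′
          joined′ = proj₂ (proj₂ (every-joined u′))
          t≡t′ : t ≡ t′
          t≡t′ = trans (sym (key-/ t v)) (trans (cong (_/ n) (trans (sym (joined-label joined)) u∈))
            (trans (FinP.fromℕ<-injective _ _ (colour< m∈) (colour< m′∈) same)
              (trans (cong (_/ n) (trans (sym u′∈) (joined-label joined′))) (key-/ t′ v′))))
          v≡v′ : v ≡ v′
          v≡v′ = adjacent-joined e joined (subst (λ s → Joined s u′ v′) (sym t≡t′) joined′)

      module InCluster (C : Cluster label) where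
        Inside : Set
        Inside = ∃ (Member label C)

        inside-≡ : {u v : Inside} → proj₁ u ≡ proj₁ v → u ≡ v
        inside-≡ {u , p} {.u , q} refl = cong (u ,_) (≡-irrelevant p q)

        GC : Graph Inside
        GC = induced G (Member label C)

        -- `Distance` asks for a shortest walk, found by search; the ports enumerate the possible
        -- first edges.
        walk? : (u v : Inside) (ℓ : ℕ) → Dec (Walk GC u v ℓ)
        walk? u v zero with proj₁ u FinP.≟ proj₁ v
        ... | yes e = yes (subst (λ x → Walk GC u x 0) (inside-≡ e) [])
        ... | no ¬e = no λ { [] → ¬e refl }
        walk? u v (suc ℓ) = map′ from to (any? there?)
          where
          There : Fin (degree (proj₁ u)) → Set
          There i = Σ (label (neighbour (proj₁ u) i) ≡ Cluster.name C) λ m → Walk GC (neighbour (proj₁ u) i , m) v ℓ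
          there? : ∀ i → Dec (There i)
          there? i with label (neighbour (proj₁ u) i) ≟ Cluster.name C
          ... | no ¬m = no (¬m ∘ proj₁)
          ... | yes m = map′ (m ,_) (λ { (m′ , p) → subst (λ m → Walk GC (_ , m) v ℓ) (≡-irrelevant m′ m) p })
                             (walk? (_ , m) v ℓ)
          from : ∃ There → Walk GC u v (suc ℓ)
          from (i , _ , p) = adjacent (proj₁ u) i ∷ p
          to : Walk GC u v (suc ℓ) → ∃ There
          to (_∷_ {v = x} e p) = port e , subst (λ z → Σ (label z ≡ Cluster.name C) λ m → Walk GC (z , m) v ℓ)
            (sym (neighbour-port e)) (proj₂ x , p)

        walk⇒distance : ∀ {u v ℓ D} → Walk GC u v ℓ → ℓ ≤ D → ∃ λ d → Distance GC u v d × d ≤ D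
        walk⇒distance {u} {v} {ℓ} {D} p ℓ≤D = d ,
          (first-satisfies (walk? u v) (suc D) (s≤s d≤D) , first-minimal (walk? u v) (suc D)) , d≤D
          where
          d = first (walk? u v) (suc D)
          d≤D : d ≤ D
          d≤D = ≤-trans (first-minimal (walk? u v) (suc D) p) ℓ≤D

        -- Each `gap-step` keeps centre and phase and thereby the label, so the walk never leaves
        -- the cluster. This makes the diameter bound a strong one.
        to-leader : ∀ {t v} d (u : Inside) → Joined t (proj₁ u) v → Survivors.dist neighbour k (labels t) (proj₁ u) v ≡ d →
                    ∃ λ v∈ → Walk GC u (v , v∈) d
        to-leader {t} zero (u , u∈) joined e with Srv.dist-zero t {u} e
        ... | refl = u∈ , []
        to-leader {t} {v} (suc d) (u , u∈) joined@(t< , alive , gap) e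
          with Phs.gap-step t (quiet t<) wide alive gap e
        ... | i , alive′ , e′ , gap′ = proj₁ rest , adjacent u i ∷ proj₂ rest
          where
          joined′ : Joined t (neighbour u i) v
          joined′ = t< , alive′ , gap′
          rest = to-leader d (neighbour u i , trans (joined-label joined′) (trans (sym (joined-label joined)) u∈)) joined′ e′

        diameter : StrongDiameter≤ G (Member label C) (2 * k ∸ 2)
        diameter u v = walk⇒distance walk short
          where
          t = proj₁ (every-joined (proj₁ u))
          c = proj₁ (proj₂ (every-joined (proj₁ u)))
          joined-u : Joined t (proj₁ u) c
          joined-u = proj₂ (proj₂ (every-joined (proj₁ u)))
          joined-v : Joined t (proj₁ v) c
          joined-v = label-joined (trans (proj₂ v) (trans (sym (proj₂ u)) (joined-label joined-u)))
          dᵤ = Srv.dist t (proj₁ u) c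
          dᵥ = Srv.dist t (proj₁ v) c
          walk-u = to-leader dᵤ u joined-u refl
          walk-v = to-leader dᵥ v joined-v refl
          walk : Walk GC u v (dᵤ + dᵥ)
          walk = subst (λ m → Walk GC u (c , m) dᵤ) (≡-irrelevant _ _) (proj₂ walk-u) ++ʷ reverseʷ (proj₂ walk-v)
          near : ∀ {y} → Joined t y c → suc (Srv.dist t y c) ≤ k
          near (t< , _ , gap) = Phs.gap-dist t (quiet t<) wide gap
          short : dᵤ + dᵥ ≤ 2 * k ∸ 2
          -- Each leg is shorter than `k`; adding the 2 on the left turns the bound into two
          -- inequalities `suc d ≤ k`.
          short = m+n≤o⇒m≤o∸n (dᵤ + dᵥ) (≤-trans (≤-reflexive (arrange dᵤ dᵥ))
            (≤-trans (+-mono-≤ (near joined-u) (near joined-v)) (≤-reflexive (cong (k +_) (sym (+-identityʳ k))))))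
            where
            arrange : ∀ x y → x + y + 2 ≡ suc x + suc y
            arrange = solve-∀

      decomposition : ∀ {χ} → fromℕℝ phases ≤ℝ χ → StrongDecomposition G label (2 * k ∸ 2) χ
      decomposition phases≤χ = InCluster.diameter , phases , phases≤χ , colouring

module Calibration where
  open Carving
  open RationalFacts
  open PowerFacts
  open CutFacts
  open PositiveFacts
  open ExponentialFacts using (exp-upper)
  open import Algebra.Bundles using (CommutativeRing)
  open import Data.Bool.Base using (not)
  open import Data.Fin.Base as Fin using (Fin; finToFun; suc; zero)
  import Data.Fin.Properties as FinP
  open import Data.Fin.Subset using (Subset; _∈_; ∣_∣)
  open import Data.Integer.Base as ℤ using (+_)
  import Data.Integer.Properties as ℤP
  open import Data.Maybe.Base using (nothing)
  open import Data.Nat.Base as ℕ using (ℕ; suc; zero)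
  open import Data.Nat.Induction using (<-rec)
  import Data.Nat.Logarithm as Log
  import Data.Nat.Properties as ℕP
  open import Algebra.Properties.Semiring.Sum ℕP.+-*-semiring using (sum; sum-cong-≗)
  open import Data.Product using (∃; _×_; _,_; proj₁; proj₂)
  open import Data.Rational.Base as ℚ
    using (ℚ; 0ℚ; 1ℚ; ½; _+_; _*_; _-_; -_; _<_; _≤_; _⊔_; _/_; *≤*)
  import Data.Rational.Properties as ℚP
  open import Algebra.Properties.CommutativeSemiring.Exp
    (CommutativeRing.commutativeSemiring ℚP.+-*-commutativeRing)
    using (_^_; ^-distrib-*; ^-homo-*)
  import Data.Rational.Unnormalised.Base as ℚᵘ
  import Data.Rational.Unnormalised.Properties as ℚᵘP
  open import Data.Sum.Base using ([_,_]′)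
  open import Data.Vec.Base using (Vec; map; tabulate)
  open import Data.Vec.Properties using ([]=⇒lookup; lookup∘tabulate; map-cong; map-id; tabulate-∘)
  open import Function.Base using (_∘_)
  open import Relation.Binary.PropositionalEquality
  open import Relation.Nullary using (¬_; Dec; yes; no; contradiction; does)
  open import Tactic.RingSolver using (solve-∀)

  -- Rational estimates and membership in cuts

  fromℕ-+ : ∀ m n → fromℕ (m ℕ.+ n) ≡ fromℕ m + fromℕ n
  fromℕ-+ zero    n = sym (ℚP.+-identityˡ (fromℕ n))
  fromℕ-+ (suc m) n = trans (fromℕ-suc (m ℕ.+ n)) (trans (cong (_+_ 1ℚ) (fromℕ-+ m n))
    (trans (sym (ℚP.+-assoc 1ℚ (fromℕ m) (fromℕ n))) (cong (_+ fromℕ n) (sym (fromℕ-suc m)))))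

  fromℕ-* : ∀ m n → fromℕ (m ℕ.* n) ≡ fromℕ m * fromℕ n
  fromℕ-* zero    n = sym (ℚP.*-zeroˡ (fromℕ n))
  fromℕ-* (suc m) n = trans (fromℕ-+ n (m ℕ.* n)) (trans (cong (_+_ (fromℕ n)) (fromℕ-* m n))
    (trans (e (fromℕ m) (fromℕ n)) (cong (_* fromℕ n) (sym (fromℕ-suc m)))))
    where
    e : ∀ x y → y + x * y ≡ (1ℚ + x) * y
    e = solve-∀ ℚ-ring

  fromℕ-^ : ∀ m n → fromℕ (m ℕ.^ n) ≡ fromℕ m ^ n
  fromℕ-^ m zero    = refl
  fromℕ-^ m (suc n) = trans (fromℕ-* m (m ℕ.^ n)) (cong (_*_ (fromℕ m)) (fromℕ-^ m n))

  fromℕ-mono-≤ : ∀ {m n} → m ℕ.≤ n → fromℕ m ≤ fromℕ n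
  fromℕ-mono-≤ {m} {n} m≤n = *≤* (ℤP.*-monoʳ-≤-nonNeg (+ 1) (ℤ.+≤+ m≤n))

  fromℕ-mono-< : ∀ {m n} → m ℕ.< n → fromℕ m < fromℕ n
  fromℕ-mono-< {m} m<n = ℚP.<-≤-trans (fromℕ<suc m) (fromℕ-mono-≤ m<n)

  fromℕ-cancel-< : ∀ {m n} → fromℕ m < fromℕ n → m ℕ.< n
  fromℕ-cancel-< lt = ℕP.≰⇒> λ n≤m → ℚP.<-irrefl refl (ℚP.<-≤-trans lt (fromℕ-mono-≤ n≤m))

  fromℕ-cancel-≤ : ∀ {m n} → fromℕ m ≤ fromℕ n → m ℕ.≤ n
  fromℕ-cancel-≤ le = ℕP.≮⇒≥ λ n<m → ℚP.<-irrefl refl (ℚP.<-≤-trans (fromℕ-mono-< n<m) le)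

  *-cancelʳ-≤⁺ : ∀ {x y z} → 0ℚ < z → x * z ≤ y * z → x ≤ y
  *-cancelʳ-≤⁺ {x} {y} {z} 0<z le = ℚP.*-cancelʳ-≤-pos z {{ℚ.positive 0<z}} le

  *-cancelʳ-<⁺ : ∀ {x y z} → 0ℚ < z → x * z < y * z → x < y
  *-cancelʳ-<⁺ {x} {y} {z} 0<z lt = ℚP.*-cancelʳ-<-nonNeg z {{ℚ.nonNegative (ℚP.<⇒≤ 0<z)}} lt

  *-monoʳ-≤⁺ : ∀ {x y z} → 0ℚ ≤ z → x ≤ y → z * x ≤ z * y
  *-monoʳ-≤⁺ {z = z} 0≤z x≤y = ℚP.*-monoˡ-≤-nonNeg z {{ℚ.nonNegative 0≤z}} x≤y

  *-monoˡ-≤⁺ : ∀ {x y z} → 0ℚ ≤ z → x ≤ y → x * z ≤ y * z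
  *-monoˡ-≤⁺ {z = z} 0≤z x≤y = ℚP.*-monoʳ-≤-nonNeg z {{ℚ.nonNegative 0≤z}} x≤y

  *-monoʳ-<⁺ : ∀ {x y z} → 0ℚ < z → x < y → z * x < z * y
  *-monoʳ-<⁺ {z = z} 0<z x<y = ℚP.*-monoʳ-<-pos z {{ℚ.positive 0<z}} x<y

  *-monoˡ-<⁺ : ∀ {x y z} → 0ℚ < z → x < y → x * z < y * z
  *-monoˡ-<⁺ {z = z} 0<z x<y = ℚP.*-monoˡ-<-pos z {{ℚ.positive 0<z}} x<y

  cancel-inverse : ∀ x {i y} → i * y ≡ 1ℚ → x * i * y ≡ x
  cancel-inverse x {i} {y} e = trans (ℚP.*-assoc x i y) (trans (cong (x *_) e) (ℚP.*-identityʳ x))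

  -- A rational is not below its own cut, so a factor has to be lowered a little before it can
  -- witness membership in a product.
  shrink : ∀ {a b q} → 0ℚ < a → 0ℚ < b → q < a * b → ∃ λ a′ → 0ℚ < a′ × a′ < a × q < a′ * b
  shrink {a} {b} {q} 0<a 0<b lt =
    let i , _ , ib = inverse 0<b
        qi<a = *-cancelʳ-<⁺ {q * i} {a} {b} 0<b (subst (_< a * b) (sym (cancel-inverse q {i} {b} ib)) lt)
        a′ , <a′ , a′<a = ℚP.<-dense (⊔-lub {q * i} {0ℚ} qi<a 0<a)
    in a′ , ℚP.≤-<-trans (ℚP.p≤q⊔p (q * i) 0ℚ) <a′ , a′<a ,
       subst (_< a′ * b) (cancel-inverse q {i} {b} ib) (*-monoˡ-<⁺ 0<b (ℚP.≤-<-trans (ℚP.p≤p⊔q (q * i) 0ℚ) <a′))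

  below-* : ∀ x y {a b q} → 0ℚ < a → Below x a → 0ℚ < b → Below y b → q < a * b → Below (x *ℝ y) q
  below-* x y {a} {b} 0<a a∈ 0<b b∈ lt =
    a , hi X , b , hi Y , a∈ , hi∉ X , b∈ , hi∉ Y , lt ,
    ℚP.<-≤-trans lt (*-mono-≤ (ℚP.<⇒≤ 0<a) ℚP.≤-refl (ℚP.<⇒≤ 0<b) b≤B) ,
    ℚP.<-≤-trans lt (*-mono-≤ (ℚP.<⇒≤ 0<a) a≤A (ℚP.<⇒≤ 0<b) ℚP.≤-refl) ,
    ℚP.<-≤-trans lt (*-mono-≤ (ℚP.<⇒≤ 0<a) a≤A (ℚP.<⇒≤ 0<b) b≤B)
    where
    X = initial x
    Y = initial y
    a≤A = ℚP.<⇒≤ (in<out x a∈ (hi∉ X))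
    b≤B = ℚP.<⇒≤ (in<out y b∈ (hi∉ Y))

  below-scale : ∀ κ y {b q} → 0ℚ < κ → 0ℚ < b → Below y b → q < κ * b → Below (fromℚ κ *ℝ y) q
  below-scale κ y 0<κ 0<b b∈ lt = let a , 0<a , a<κ , lt′ = shrink 0<κ 0<b lt in
    below-* (fromℚ κ) y 0<a a<κ 0<b b∈ lt′

  below-scaleʳ : ∀ x κ {a q} → 0ℚ < κ → 0ℚ < a → Below x a → q < a * κ → Below (x *ℝ fromℚ κ) q
  below-scaleʳ x κ {a} {q} 0<κ 0<a a∈ lt =
    let b , 0<b , b<κ , lt′ = shrink 0<κ 0<a (subst (q <_) (ℚP.*-comm a κ) lt) in
    below-* x (fromℚ κ) 0<a a∈ 0<b b<κ (subst (q <_) (ℚP.*-comm b a) lt′)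

  scaled≤ : ∀ k χ m → .{{_ : ℕ.NonZero k}} → Below χ (fromℕ m) → fromℕℝ (m ℕ.* k) ≤ℝ fromℕℝ k *ℝ χ
  scaled≤ (suc k) χ m m∈ q q< = let m′ , m<m′ , m′∈ = rounded χ m∈ in
    below-scale (fromℕ (suc k)) χ (fromℕ>0 k) (ℚP.≤-<-trans (fromℕ≥0 m) m<m′) m′∈
      (ℚP.<-trans q< (subst (_< fromℕ (suc k) * m′) (sym (trans (fromℕ-* m (suc k)) (ℚP.*-comm (fromℕ m) (fromℕ (suc k)))))
        (*-monoʳ-<⁺ (fromℕ>0 k) m<m′)))

  below⇒≤ : ∀ {χ x} → Below χ x → fromℚ x ≤ℝ χ
  below⇒≤ {χ} x∈ q q<x = downward χ q<x x∈

  -- Since `C` bounds `c` from above, `F < 3/C ≤ 3/c`; hence every rational upper bound of `3/c` is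
  -- at least `F`.
  1-3/c≤ : ∀ c (c>0 : 0ℝ <ℝ c) {C F s} → ¬ Below c C → 0ℚ ≤ F → F * C < fromℕ 3 → 1ℚ - F ≤ s →
           1ℝ -ℝ fromℕℝ 3 *ℝ recip c c>0 ≤ℝ fromℚ s
  1-3/c≤ c c>0 {C} {F} {s} C∉ 0≤F FC<3 1-F≤s q (α , β , α<1 , β∉ , q<) =
    ℚP.<-≤-trans q< (ℚP.≤-trans (ℚP.<⇒≤ (ℚP.+-mono-<-≤ α<1 (ℚP.neg-antimono-≤ F≤β))) 1-F≤s)
    where
    0<C : 0ℚ < C
    0<C = in<out c (0∈ c c>0) C∉
    F∈ : Below (fromℕℝ 3 *ℝ recip c c>0) F
    F∈ = let i , 0<i , iC = inverse 0<C
             F<i3 = *-cancelʳ-<⁺ {F} {i * fromℕ 3} {C} 0<C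
               (subst (F * C <_) (sym (trans (cong (_* C) (ℚP.*-comm i (fromℕ 3))) (cancel-inverse (fromℕ 3) {i} {C} iC))) FC<3)
             g , 0<g , g<i , F<g3 = shrink 0<i (fromℕ>0 2) F<i3
         in below-scale (fromℕ 3) (recip c c>0) (fromℕ>0 2) 0<g
              (C , C∉ , subst (g * C <_) iC (*-monoˡ-<⁺ 0<C g<i))
              (subst (F <_) (ℚP.*-comm g (fromℕ 3)) F<g3)
    F≤β : F ≤ β
    F≤β = ℚP.≮⇒≥ λ β<F → β∉ (downward (fromℕℝ 3 *ℝ recip c c>0) β<F F∈)

  ^-inverse : ∀ {i x} k → i * x ≡ 1ℚ → i ^ k * x ^ k ≡ 1ℚ
  ^-inverse {i} {x} k e = trans (sym (^-distrib-* i x k)) (trans (cong (_^ k) e) (1^ k))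

  -- The witness is `r = 1/x`: it exceeds `ρ`, and `r^k < w`.
  root-below : ∀ k .{{_ : ℕ.NonZero k}} y (0<y : 0ℝ <ℝ y) {w x ρ} → (∀ q → q < w → Below y q) →
               0ℚ < x → 1ℚ < w * x ^ k → ρ * x < 1ℚ → Below (root k y 0<y) ρ
  root-below (suc k) y 0<y {w} {x} {ρ} w⊆ 0<x 1<wx ρx<1 =
    let r , 0<r , rx = inverse 0<x in
    r , *-cancelʳ-<⁺ {ρ} {r} {x} 0<x (subst (ρ * x <_) (sym rx) ρx<1) , 0<r ,
    w⊆ (r ^ suc k) (*-cancelʳ-<⁺ {r ^ suc k} {w} {x ^ suc k} (^>0 (suc k) 0<x)
      (subst (_< w * x ^ suc k) (sym (^-inverse {r} {x} (suc k) rx)) 1<wx))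

  -- As k ≤ ln n, the term (1 + r/2k)^(2k) of the exponential for r slightly
  -- less than k is less than n.
  k≤ln⇒ : ∀ n k .{{_ : ℕ.NonZero n}} .{{_ : ℕ.NonZero k}} →
    fromℕℝ k ≤ℝ ln (fromℕℝ n) (fromℕℝ-positive n) → (+ 9 / 4) ^ k < fromℕ 2 * fromℕ n
  k≤ln⇒ (suc n′) k@(suc k′) k≤ = go (k≤ (fromℕ k - (+ 3 / 4)) (by< {d = + 3 / 4} (ℚP.positive⁻¹ (+ 3 / 4)) (e₀ (fromℕ k))))
    where
    n = suc n′
    e₀ : ∀ K → (+ 3 / 4) ≡ K - (K - (+ 3 / 4))
    e₀ = solve-∀ ℚ-ring
    m : ℕ
    m = k′ ℕ.+ k
    u : ℚ
    u = unitFraction m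
    2Ku : (fromℕ k + fromℕ k) * u ≡ 1ℚ
    2Ku = trans (cong (_* u) (sym (fromℕ-+ k k))) (fromℕ-unit m)
    y : ℚ
    y = 1ℚ - ½ * u
    0<y : 0ℚ < y
    0<y = by< {d = (1ℚ - u) + ½ * u} (subst (0ℚ <_) (ℚP.+-comm (½ * u) (1ℚ - u))
            (+>≥0 (*>0 (ℚP.positive⁻¹ ½) (unit>0 m)) (≤⇒0≤ (unit≤1 m)))) (e u)
      where
      e : ∀ u → (1ℚ - u) + ½ * u ≡ 1ℚ - ½ * u - 0ℚ
      e = solve-∀ ℚ-ring
    half≤ : ½ ≤ y ^ suc m
    half≤ = ℚP.≤-trans (ℚP.≤-reflexive (trans (sym (e₂ (fromℕ k) u 2Ku)) (cong (λ f → 1ℚ + f * (y - 1ℚ)) (sym (fromℕ-+ k k)))))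
              (bernoulli (suc m) (ℚP.<⇒≤ 0<y))
      where
      e₁ : ∀ K u → 1ℚ + (K + K) * (1ℚ - ½ * u - 1ℚ) ≡ 1ℚ - ½ * ((K + K) * u)
      e₁ = solve-∀ ℚ-ring
      e₂ : ∀ K u → (K + K) * u ≡ 1ℚ → 1ℚ + (K + K) * (1ℚ - ½ * u - 1ℚ) ≡ ½
      e₂ K u h = trans (e₁ K u) (cong (λ z → 1ℚ - ½ * z) h)
    -- With `u = 1/(2k)`, the offset `3/4` makes the base factor as `3/2 (1 - u/2)`. Bernoulli keeps
    -- `(1 - u/2)^(2k)` at least `1/2`, whence the factor 2 in the conclusion.
    base : 1ℚ + (fromℕ k - (+ 3 / 4)) * u ≡ (+ 3 / 2) * y
    base = trans (e₁ (fromℕ k) u) (trans (cong (λ z → 1ℚ + ½ * z - (+ 3 / 4) * u) 2Ku) (e₂ u))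
      where
      e₁ : ∀ K u → 1ℚ + (K - (+ 3 / 4)) * u ≡ 1ℚ + ½ * ((K + K) * u) - (+ 3 / 4) * u
      e₁ = solve-∀ ℚ-ring
      e₂ : ∀ u → 1ℚ + ½ * 1ℚ - (+ 3 / 4) * u ≡ (+ 3 / 2) * (1ℚ - ½ * u)
      e₂ = solve-∀ ℚ-ring
    square : ((+ 9 / 4) ^ k) ≡ (+ 3 / 2) ^ suc m
    square = trans (^-distrib-* (+ 3 / 2) (+ 3 / 2) k) (sym (^-homo-* (+ 3 / 2) k k))
    go : Below (ln (fromℕℝ n) (fromℕℝ-positive n)) (fromℕ k - (+ 3 / 4)) → (+ 9 / 4) ^ k < fromℕ 2 * fromℕ n
    go (r , s , q<r , s<n , exp) = subst (_< fromℕ 2 * fromℕ n) (sym square)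
      (ℚP.≤-<-trans (finish ((+ 3 / 2) ^ suc m) (y ^ suc m) s (^≥0 (suc m) (ℚP.<⇒≤ (ℚP.positive⁻¹ (+ 3 / 2)))) half≤
        (subst (_≤ s) (^-distrib-* (+ 3 / 2) y (suc m)) chain))
        (*-monoʳ-<⁺ (fromℕ>0 1) s<n))
      where
      0<base : 0ℚ < (+ 3 / 2) * y
      0<base = *>0 (ℚP.positive⁻¹ (+ 3 / 2)) 0<y
      base< : (+ 3 / 2) * y < 1ℚ + r * u
      base< = subst (_< 1ℚ + r * u) base (ℚP.+-monoʳ-< 1ℚ (*-monoˡ-<⁺ (unit>0 m) q<r))
      chain : ((+ 3 / 2) * y) ^ suc m ≤ s
      chain = ℚP.≤-trans (^-mono-≤ (suc m) (ℚP.<⇒≤ 0<base) (ℚP.<⇒≤ base<)) (exp m (ℚP.<-trans 0<base base<))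
      finish : ∀ P Y s → 0ℚ ≤ P → ½ ≤ Y → P * Y ≤ s → P ≤ fromℕ 2 * s
      finish P Y s 0≤P h le = by≤
        (+≥0 (*≥0 (ℚP.<⇒≤ (fromℕ>0 1)) (≤⇒0≤ le)) (*≥0 (*≥0 (ℚP.<⇒≤ (fromℕ>0 1)) 0≤P) (≤⇒0≤ h))) (e P Y s)
        where
        e : ∀ P Y s → fromℕ 2 * (s - P * Y) + fromℕ 2 * P * (Y - ½) ≡ fromℕ 2 * s - P
        e = solve-∀ ℚ-ring

  -- Success probability and number of phases

  n<2^n : ∀ n → n ℕ.< 2 ℕ.^ n
  n<2^n zero    = ℕ.s≤s ℕ.z≤n
  n<2^n (suc n) = ℕP.≤-trans (ℕP.+-mono-≤ (ℕP.m^n>0 2 n) (n<2^n n))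
    (ℕP.≤-reflexive (cong (2 ℕ.^ n ℕ.+_) (sym (ℕP.+-identityʳ (2 ℕ.^ n)))))

  -- A mean value estimate: on the interval from `x` to `x + δ` the derivative of the power is at
  -- most `j K^j`.
  ^-increment : ∀ {x δ K} j → 0ℚ ≤ x → 0ℚ ≤ δ → 1ℚ ≤ K → x + δ ≤ K →
                (x + δ) ^ j ≤ x ^ j + δ * (fromℕ j * K ^ j)
  ^-increment {x} {δ} {K} zero    0≤x 0≤δ 1≤K ≤K = ℚP.≤-reflexive (e δ)
    where
    e : ∀ δ → 1ℚ ≡ 1ℚ + δ * (0ℚ * 1ℚ)
    e = solve-∀ ℚ-ring
  ^-increment {x} {δ} {K} (suc j) 0≤x 0≤δ 1≤K ≤K = step (fromℕ j) (fromℕ (suc j)) (fromℕ-suc j)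
      ((x + δ) ^ j) (x ^ j) (K ^ j) (fromℕ≥0 j) 0≤Kj xj≤ (^-increment j 0≤x 0≤δ 1≤K ≤K)
    where
    0≤K = ℚP.≤-trans (ℚP.<⇒≤ 0<1) 1≤K
    0≤Kj : 0ℚ ≤ K ^ j
    0≤Kj = ^≥0 j 0≤K
    0≤x+δ = +≥0 0≤x 0≤δ
    x≤K : x ≤ K
    x≤K = ℚP.≤-trans (by≤ 0≤δ (e x δ)) ≤K
      where
      e : ∀ x δ → δ ≡ x + δ - x
      e = solve-∀ ℚ-ring
    xj≤ : x ^ j ≤ K * K ^ j
    xj≤ = ℚP.≤-trans (^-mono-≤ j 0≤x x≤K) (subst (_≤ K * K ^ j) (ℚP.*-identityˡ (K ^ j)) (*-monoˡ-≤⁺ 0≤Kj 1≤K))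
    step : ∀ f f′ → f′ ≡ 1ℚ + f → ∀ s p q → 0ℚ ≤ f → 0ℚ ≤ q → p ≤ K * q → s ≤ p + δ * (f * q) →
           (x + δ) * s ≤ x * p + δ * (f′ * (K * q))
    step f _ refl s p q 0≤f 0≤q p≤ s≤ = by≤
      (+≥0 (*≥0 0≤x+δ (≤⇒0≤ s≤)) (+≥0 (*≥0 0≤δ (≤⇒0≤ p≤)) (*≥0 (≤⇒0≤ ≤K) (*≥0 0≤δ (*≥0 0≤f 0≤q)))))
      (e x δ K f s p q)
      where
      e : ∀ x δ K f s p q →
          (x + δ) * (p + δ * (f * q) - s) + (δ * (K * q - p) + (K - (x + δ)) * (δ * (f * q))) ≡
          x * p + δ * ((1ℚ + f) * (K * q)) - (x + δ) * s
      e = solve-∀ ℚ-ring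

  -- A dyadic p slightly above w^(-1/k); the numbers x < 1/ρ < p witness that
  -- p w^(1/k) > 1.
  record Dyadic (k : ℕ) (w W : ℚ) : Set where
    field
      b a         : ℕ
      p x ρ       : ℚ
      p-eq        : p * fromℕ (2 ℕ.^ b) ≡ fromℕ a
      0<p         : 0ℚ < p
      0<x         : 0ℚ < x
      1<wx^k      : 1ℚ < w * x ^ k
      0<ρ         : 0ℚ < ρ
      ρx<1        : ρ * x < 1ℚ
      1<ρp        : 1ℚ < ρ * p
      Wp^k≤       : W * p ^ k ≤ (+ 21 / 20)

  -- On the grid of mesh `i = 1/B`, the field `x` is the first point with `1 < w x^k`. Its
  -- predecessor `x₀` fails this test, and the next two points after `x` serve as `1/ρ` and `p`.
  dyadic : ∀ k .{{_ : ℕ.NonZero k}} {w W} → 1ℚ < w → 0ℚ ≤ W → fromℕ 24 * W ≤ fromℕ 25 * w → Dyadic k w W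
  dyadic k@(suc k′) {w} {W} 1<w 0≤W 24W≤25w = record
    { b = b ; a = 3 ℕ.+ a₀ ; p = x₀ + fromℕ 3 * i ; x = p′ ; ρ = proj₁ inv
    ; p-eq = trans (cong (_* fromℕ B) (sym (pr-+ 3))) (cancel-inverse (fromℕ (3 ℕ.+ a₀)) {i} {fromℕ B} iB)
    ; 0<p = subst (0ℚ <_) (pr-+ 3) (0<pr (2 ℕ.+ a₀)) ; 0<x = 0<pr a₀ ; 1<wx^k = subst P sa₀ P-a
    ; 0<ρ = proj₁ (proj₂ inv) ; ρx<1 = subst (ρ * p′ <_) ρ-eq (*-monoʳ-<⁺ {p′} {mid} {ρ} 0<ρ (pr-mono 1))
    ; 1<ρp = subst (_< ρ * (x₀ + fromℕ 3 * i)) ρ-eq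
               (*-monoʳ-<⁺ {mid} {x₀ + fromℕ 3 * i} {ρ} 0<ρ (subst (mid <_) (pr-+ 3) (pr-mono 2)))
    ; Wp^k≤ = upper (x₀ ^ k) ((x₀ + fromℕ 3 * i) ^ k) (^≥0 k 0≤x₀) x₀-small increment
    }
    where
    -- The mesh is so fine that moving three steps from `x₀` to `p` changes `W x^k` by at most
    -- `H i < 1/120`; the 4 bounds `x₀ + 3 i`.
    H : ℚ
    H = W * (fromℕ 3 * (fromℕ k * fromℕ 4 ^ k))
    large : ∃ λ m → fromℕ 120 * H < fromℕ (suc m)
    large = <fromℕ (fromℕ 120 * H)
    b = suc (proj₁ large)
    B = 2 ℕ.^ b
    120H<B : fromℕ 120 * H < fromℕ B
    120H<B = ℚP.<-trans (proj₂ large) (fromℕ-mono-< (n<2^n b))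
    0<B : 0ℚ < fromℕ B
    0<B = fromℕ-mono-< (ℕP.m^n>0 2 b)
    i : ℚ
    i = proj₁ (inverse 0<B)
    0<i : 0ℚ < i
    0<i = proj₁ (proj₂ (inverse 0<B))
    iB : i * fromℕ B ≡ 1ℚ
    iB = proj₂ (proj₂ (inverse 0<B))
    pr : ℕ → ℚ
    pr a = fromℕ a * i
    P : ℕ → Set
    P a = 1ℚ < w * pr a ^ k
    P? : ∀ a → Dec (P a)
    P? a = 1ℚ ℚP.<? w * pr a ^ k
    P-B : P B
    P-B = subst (1ℚ <_)
      (sym (trans (cong (w *_) (trans (cong (_^ k) (trans (ℚP.*-comm (fromℕ B) i) iB)) (1^ k))) (ℚP.*-identityʳ w))) 1<w
    a₁ = first P? (suc B)
    a₁≤B : a₁ ℕ.≤ B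
    a₁≤B = first-minimal P? (suc B) P-B
    P-a : P a₁
    P-a = first-satisfies P? (suc B) (ℕ.s≤s a₁≤B)
    ¬P0 : ¬ P 0
    ¬P0 lt = ℚP.<-irrefl refl (ℚP.<-trans 0<1 (subst (1ℚ <_) (e w i (pr 0 ^ k′)) lt))
      where
      e : ∀ w i z → w * (0ℚ * i * z) ≡ 0ℚ
      e = solve-∀ ℚ-ring
    a₀ = ℕ.pred a₁
    sa₀ : a₁ ≡ suc a₀
    sa₀ = go a₁ refl
      where
      go : ∀ m → a₁ ≡ m → a₁ ≡ suc (ℕ.pred a₁)
      go zero    e = contradiction (subst P e P-a) ¬P0
      go (suc m) e = trans e (cong suc (sym (cong ℕ.pred e)))
    x₀ = pr a₀
    x₀-small : w * x₀ ^ k ≤ 1ℚ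
    x₀-small = ℚP.≮⇒≥ λ P-a₀ → ℕP.<-irrefl refl (ℕP.≤-trans (ℕP.≤-reflexive (sym sa₀)) (first-minimal P? (suc B) P-a₀))
    pr-+ : ∀ m → pr (m ℕ.+ a₀) ≡ x₀ + fromℕ m * i
    pr-+ m = trans (cong (_* i) (fromℕ-+ m a₀)) (e (fromℕ m) (fromℕ a₀) i)
      where
      e : ∀ m a i → (m + a) * i ≡ a * i + m * i
      e = solve-∀ ℚ-ring
    pr-mono : ∀ m → pr (m ℕ.+ a₀) < pr (suc m ℕ.+ a₀)
    pr-mono m = *-monoˡ-<⁺ 0<i (fromℕ<suc (m ℕ.+ a₀))
    0<pr : ∀ m → 0ℚ < pr (suc m)
    0<pr m = *>0 (fromℕ>0 m) 0<i
    p′ = pr (suc a₀)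
    mid = pr (2 ℕ.+ a₀)
    inv = inverse (0<pr (suc a₀))
    ρ : ℚ
    ρ = proj₁ inv
    0<ρ : 0ℚ < ρ
    0<ρ = proj₁ (proj₂ inv)
    ρ-eq : ρ * mid ≡ 1ℚ
    ρ-eq = proj₂ (proj₂ inv)
    0≤x₀ : 0ℚ ≤ x₀
    0≤x₀ = *≥0 (fromℕ≥0 a₀) (ℚP.<⇒≤ 0<i)
    ≤4 : x₀ + fromℕ 3 * i ≤ fromℕ 4
    ≤4 = subst₂ _≤_ (pr-+ 3) (cancel-inverse (fromℕ 4) {fromℕ B} {i} (trans (ℚP.*-comm (fromℕ B) i) iB))
           (*-monoˡ-≤⁺ (ℚP.<⇒≤ 0<i) (subst (fromℕ (3 ℕ.+ a₀) ≤_) (fromℕ-* 4 B) (fromℕ-mono-≤ bound)))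
      where
      bound : 3 ℕ.+ a₀ ℕ.≤ 4 ℕ.* B
      bound = ℕP.≤-trans (ℕP.+-mono-≤ (ℕP.*-monoʳ-≤ 3 (ℕP.m^n>0 2 b))
                           (ℕP.≤-trans (ℕP.n≤1+n a₀) (ℕP.≤-trans (ℕP.≤-reflexive (sym sa₀)) a₁≤B)))
                         (ℕP.≤-reflexive (ℕP.+-comm (3 ℕ.* B) B))
    increment : (x₀ + fromℕ 3 * i) ^ k ≤ x₀ ^ k + fromℕ 3 * i * (fromℕ k * fromℕ 4 ^ k)
    increment = ^-increment k 0≤x₀ (*≥0 (ℚP.<⇒≤ (fromℕ>0 2)) (ℚP.<⇒≤ 0<i)) (fromℕ-mono-≤ {1} {4} (ℕ.s≤s ℕ.z≤n)) ≤4
    120Hi<1 : fromℕ 120 * H * i < 1ℚ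
    120Hi<1 = subst (fromℕ 120 * H * i <_) (trans (ℚP.*-comm (fromℕ B) i) iB) (*-monoˡ-<⁺ 0<i 120H<B)
    -- `W x₀^k ≤ 25/24` follows from `24 W ≤ 25 w`, and the three grid steps add at most `1/120`;
    -- together this is `21/20`.
    upper : ∀ X Y → 0ℚ ≤ X → w * X ≤ 1ℚ → Y ≤ X + fromℕ 3 * i * (fromℕ k * fromℕ 4 ^ k) → W * Y ≤ (+ 21 / 20)
    upper X Y 0≤X wX≤1 Y≤ = ℚP.≤-trans (*-monoʳ-≤⁺ 0≤W Y≤) (go (fromℕ k * fromℕ 4 ^ k) 120Hi<1)
      where
      e : ∀ w W X i M → (+ 25 / 24) * (1ℚ - w * X) + ((+ 1 / 24) * ((fromℕ 25 * w - fromℕ 24 * W) * X) +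
          (+ 1 / 120) * (1ℚ - fromℕ 120 * (W * (fromℕ 3 * M)) * i)) ≡ (+ 21 / 20) - W * (X + fromℕ 3 * i * M)
      e = solve-∀ ℚ-ring
      go : ∀ M → fromℕ 120 * (W * (fromℕ 3 * M)) * i < 1ℚ → W * (X + fromℕ 3 * i * M) ≤ (+ 21 / 20)
      go M small = by≤
        (+≥0 (*≥0 (ℚP.<⇒≤ (ℚP.positive⁻¹ (+ 25 / 24))) (≤⇒0≤ wX≤1))
          (+≥0 (*≥0 (ℚP.<⇒≤ (ℚP.positive⁻¹ (+ 1 / 24))) (*≥0 (≤⇒0≤ 24W≤25w) 0≤X))
               (*≥0 (ℚP.<⇒≤ (ℚP.positive⁻¹ (+ 1 / 120))) (ℚP.<⇒≤ (<⇒0< small)))))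
        (e w W X i M)

  -- By `1 - p ≤ e^(-p)`, the number `z = (1 - p)^(-(m+1))` bounds `e^((m+1) p)` from above, and
  -- `z < w`.
  below-ln : ∀ y (0<y : 0ℝ <ℝ y) {w p} m → (∀ q → q < w → Below y q) → p < 1ℚ → 1ℚ < w * (1ℚ - p) ^ suc m →
             ∀ {q} → q < fromℕ (suc m) * p → Below (ln y 0<y) q
  below-ln y 0<y {w} {p} m w⊆ p<1 1<w {q} q< = fromℕ (suc m) * p , z , q< ,
    w⊆ z (*-cancelʳ-<⁺ {z} {w} {V} 0<V (subst (_< w * V) (sym zV) 1<w)) ,
    exp-upper (fromℕ (suc m) * p) m z 0<z (subst (0ℚ <_) (sym base) (<⇒0< p<1))
      (trans (cong (λ v → z * v ^ suc m) base) zV)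
    where
    V = (1ℚ - p) ^ suc m
    0<V : 0ℚ < V
    0<V = ^>0 (suc m) (<⇒0< p<1)
    z : ℚ
    z = proj₁ (inverse 0<V)
    0<z : 0ℚ < z
    0<z = proj₁ (proj₂ (inverse 0<V))
    zV : z * V ≡ 1ℚ
    zV = proj₂ (proj₂ (inverse 0<V))
    base : 1ℚ + (- (fromℕ (suc m) * p * unitFraction m)) ≡ 1ℚ - p
    base = trans (e (fromℕ (suc m)) p (unitFraction m)) (cong (λ t → 1ℚ - t)
      (trans (cong (p *_) (fromℕ-unit m)) (ℚP.*-identityʳ p)))
      where
      e : ∀ M p u → 1ℚ + (- (M * p * u)) ≡ 1ℚ - p * (M * u)
      e = solve-∀ ℚ-ring

  -- Whether the next integer lies below a cut is not decidable; locatedness settles it up to the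
  -- slack `ε`.
  floor-below : ∀ χ {ε} → 0ℚ < ε → Below χ 0ℚ →
                ∃ λ m → Below χ (fromℕ m) × ¬ Below χ (fromℕ (suc m) + ε)
  floor-below χ {ε} 0<ε 0∈χ = walk _ 0 0∈χ (upward χ (ℚP.<⇒≤ (proj₂ (<fromℕ (hi X)))) (hi∉ X))
    where
    X = initial χ
    walk : ∀ f m → Below χ (fromℕ m) → ¬ Below χ (fromℕ (m ℕ.+ f)) →
           ∃ λ m → Below χ (fromℕ m) × ¬ Below χ (fromℕ (suc m) + ε)
    walk zero    m m∈ ∉ = contradiction (subst (Below χ ∘ fromℕ) (sym (ℕP.+-identityʳ m)) m∈) ∉
    walk (suc f) m m∈ ∉ = [ (λ m′∈ → walk f (suc m) m′∈ (∉ ∘ subst (Below χ ∘ fromℕ) (sym (ℕP.+-suc m f)))) ,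
                              (λ ∉′ → m , m∈ , ∉′) ]′
      (located χ (by< 0<ε (e (fromℕ (suc m)) ε)))
      where
      e : ∀ m ε → ε ≡ m + ε - m
      e = solve-∀ ℚ-ring

  record Choice (n k : ℕ) (c χ : ℝ) : Set where
    field
      b a phases : ℕ
      p C        : ℚ
      p-eq       : p * fromℕ (2 ℕ.^ b) ≡ fromℕ a
      0<p        : 0ℚ < p
      p<1        : p < 1ℚ
      phases∈    : Below χ (fromℕ phases)
      C∉         : ¬ Below c C
      small      : fromℕ n * ((1ℚ - p) ^ phases + p ^ k) * C < fromℕ 3

  module Margins {n k : ℕ} .{{_ : ℕ.NonZero n}} .{{_ : ℕ.NonZero k}}
    (n-large : (+ 9 / 4) ^ k < fromℕ 2 * fromℕ n)
    {c₀ C : ℚ} (3≤c₀ : fromℕ 3 ≤ c₀) (c₀≤C : c₀ ≤ C) (C≤ : C ≤ c₀ + (+ 1 / 8)) where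
    N = fromℕ n
    0<N : 0ℚ < N
    0<N = fromℕ-mono-< (ℕ.>-nonZero⁻¹ n)
    1≤N : 1ℚ ≤ N
    1≤N = fromℕ-mono-≤ (ℕ.>-nonZero⁻¹ n)

    3≤C : fromℕ 3 ≤ C
    3≤C = ℚP.≤-trans 3≤c₀ c₀≤C
    w = c₀ * N
    W = C * N
    0<W : 0ℚ < W
    0<W = *>0 (ℚP.<-≤-trans (fromℕ>0 2) 3≤C) 0<N
    3≤w : fromℕ 3 ≤ w
    3≤w = subst (_≤ w) (ℚP.*-identityʳ (fromℕ 3)) (*-mono-≤ (fromℕ≥0 3) 3≤c₀ (ℚP.<⇒≤ 0<1) 1≤N)
    -- The bracket width `1/8` is made for this: `24 (c₀ + 1/8) = 24 c₀ + 3 ≤ 25 c₀`.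
    24W≤25w : fromℕ 24 * W ≤ fromℕ 25 * w
    24W≤25w = by≤ (*≥0 (+≥0 (*≥0 (fromℕ≥0 24) (≤⇒0≤ C≤)) (≤⇒0≤ 3≤c₀)) (ℚP.<⇒≤ 0<N)) (e c₀ C N)
      where
      e : ∀ c C N → (fromℕ 24 * (c + (+ 1 / 8) - C) + (c - fromℕ 3)) * N ≡ fromℕ 25 * (c * N) - fromℕ 24 * (C * N)
      e = solve-∀ ℚ-ring
    1<w : 1ℚ < w
    1<w = ℚP.<-≤-trans (fromℕ-mono-< {1} {3} (ℕ.s≤s (ℕ.s≤s ℕ.z≤n))) 3≤w

    module _ (d : Dyadic k w W) where
      open Dyadic d

      -- A larger `p` would give `W p^k ≥ 3 n (4/9)^k > 3/2`, because `(9/4)^k < 2 n`; this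
      -- contradicts `Wp^k≤`.
      p≤4/9 : p ≤ (+ 4 / 9)
      p≤4/9 = ℚP.≮⇒≥ λ 4/9<p → absurd ((+ 4 / 9) ^ k) (^≥0 k (ℚP.<⇒≤ (ℚP.positive⁻¹ (+ 4 / 9))))
        (subst (_< fromℕ 2 * N * (+ 4 / 9) ^ k) (^-inverse {+ 9 / 4} {+ 4 / 9} k refl)
          (*-monoˡ-<⁺ (^>0 k (ℚP.positive⁻¹ (+ 4 / 9))) n-large))
        (ℚP.≤-trans (*-monoʳ-≤⁺ (ℚP.<⇒≤ 0<W) (^-mono-≤ k (ℚP.<⇒≤ (ℚP.positive⁻¹ (+ 4 / 9))) (ℚP.<⇒≤ 4/9<p))) Wp^k≤)
        where
        e : ∀ C N t → (C - fromℕ 3) * (N * t) + ((+ 21 / 20) - C * N * t) + (+ 3 / 2) * (fromℕ 2 * N * t - 1ℚ) ≡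
            (+ 21 / 20) - (+ 3 / 2)
        e = solve-∀ ℚ-ring
        absurd : ∀ t → 0ℚ ≤ t → 1ℚ < fromℕ 2 * N * t → ¬ W * t ≤ (+ 21 / 20)
        absurd t 0≤t 1< W≤ = ℚP.<-irrefl refl (ℚP.≤-<-trans
          (subst (0ℚ ≤_) (e C N t) (+≥0 (+≥0 (*≥0 (≤⇒0≤ 3≤C) (*≥0 (ℚP.<⇒≤ 0<N) 0≤t)) (≤⇒0≤ W≤))
            (*≥0 (ℚP.<⇒≤ (ℚP.positive⁻¹ (+ 3 / 2))) (ℚP.<⇒≤ (<⇒0< 1<)))))
          (ℚP.negative⁻¹ ((+ 21 / 20) - (+ 3 / 2))))

      p<1 : p < 1ℚ
      p<1 = ℚP.≤-<-trans p≤4/9 (by< (ℚP.positive⁻¹ (+ 5 / 9)) refl)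
      0≤1-p : 0ℚ ≤ 1ℚ - p
      0≤1-p = ℚP.<⇒≤ (<⇒0< p<1)

      regroup : ∀ C N X Y → C * N * X + C * N * Y ≡ N * (Y + X) * C
      regroup = solve-∀ ℚ-ring
      last : ∀ W q Q → W * (q * Q) ≡ W * Q * q
      last = solve-∀ ℚ-ring
      -- Since `1 - p ≥ 5/9`, `V` is at most `(9/5)(21/20) = 1.89`, and `X ≤ 1.05`. The remaining
      -- `3/50` is the strict slack.
      total : ∀ X V → 0ℚ ≤ V → X ≤ (+ 21 / 20) → V * (1ℚ - p) ≤ (+ 21 / 20) → X + V < fromℕ 3
      total X V 0≤V X≤ Y≤ = by< (+>≥0 (ℚP.positive⁻¹ (+ 3 / 50)) (+≥0 (≤⇒0≤ X≤)
          (*≥0 (ℚP.<⇒≤ (ℚP.positive⁻¹ (+ 9 / 5))) (+≥0 (≤⇒0≤ Y≤) (*≥0 0≤V (≤⇒0≤ p≤4/9)))))) (e X V p)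
        where
        e : ∀ X V p → (+ 3 / 50) + (((+ 21 / 20) - X) + (+ 9 / 5) * (((+ 21 / 20) - V * (1ℚ - p)) + V * ((+ 4 / 9) - p))) ≡
            fromℕ 3 - (X + V)
        e = solve-∀ ℚ-ring

      module _ {y : ℝ} (0<y : 0ℝ <ℝ y) (w⊆ : ∀ q → q < w → Below y q) where
        χ = root k y 0<y *ℝ ln y 0<y
        ρ∈ : Below (root k y 0<y) ρ
        ρ∈ = root-below k y 0<y w⊆ 0<x 1<wx^k ρx<1

        -- `ρ` is below the root and `(m + 1) p` below the logarithm: while `w (1 - p)^(m+1)`
        -- exceeds 1, the product `χ` still has room for `m + 1` phases.
        below-χ : ∀ m {q} → 1ℚ < w * (1ℚ - p) ^ suc m → q < fromℕ (suc m) * p * ρ → Below χ q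
        below-χ m {q} 1< q< = let l , 0<l , l< , q<lρ = shrink (*>0 (fromℕ>0 m) 0<p) 0<ρ q< in
          below-* (root k y 0<y) (ln y 0<y) 0<ρ ρ∈ 0<l (below-ln y 0<y m w⊆ p<1 1< l<)
            (subst (q <_) (ℚP.*-comm l ρ) q<lρ)

        0∈χ : Below χ 0ℚ
        0∈χ = below-χ 0 (by< (+>≥0 (ℚP.positive⁻¹ (+ 2 / 3)) (+≥0 (*≥0 (≤⇒0≤ 3≤w) 0≤1-p) (*≥0 (fromℕ≥0 3) (≤⇒0≤ p≤4/9)))) (e w p))
                (*>0 (*>0 (fromℕ>0 0) 0<p) 0<ρ)
          where
          e : ∀ w p → (+ 2 / 3) + ((w - fromℕ 3) * (1ℚ - p) + fromℕ 3 * ((+ 4 / 9) - p)) ≡ w * ((1ℚ - p) * 1ℚ) - 1ℚ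
          e = solve-∀ ℚ-ring

        -- Half the excess of `ρ p` over 1, so that `(m + 1) p ρ = (m + 1)(1 + 2 ε)` is larger than
        -- `m + 1 + ε`.
        ε = ½ * (ρ * p - 1ℚ)
        0<ε : 0ℚ < ε
        0<ε = *>0 (ℚP.positive⁻¹ ½) (<⇒0< 1<ρp)

        -- Contrapositive of `below-χ`. Passing from `W` to `w` costs at most a factor `24/25`, and
        -- `(24/25)(21/20)` still exceeds 1.
        survivors : ∀ m → ¬ Below χ (fromℕ (suc m) + ε) → W * (1ℚ - p) ^ suc m ≤ (+ 21 / 20)
        survivors m ∉ = ℚP.≮⇒≥ λ lt → ∉ (below-χ m (above ((1ℚ - p) ^ suc m) (^≥0 (suc m) 0≤1-p) lt)
          (by< (+>≥0 0<ε (*≥0 (+≥0 (fromℕ≥0 m) (fromℕ≥0 m)) (ℚP.<⇒≤ 0<ε)))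
            (trans (e (fromℕ m) ρ p) (cong (λ M → M * p * ρ - (M + ε)) (sym (fromℕ-suc m))))))
          where
          e : ∀ M ρ p → ½ * (ρ * p - 1ℚ) + (M + M) * (½ * (ρ * p - 1ℚ)) ≡ (1ℚ + M) * p * ρ - (1ℚ + M + ½ * (ρ * p - 1ℚ))
          e = solve-∀ ℚ-ring
          above : ∀ V → 0ℚ ≤ V → (+ 21 / 20) < W * V → 1ℚ < w * V
          above V 0≤V lt = by< (+>≥0 (ℚP.positive⁻¹ (+ 1 / 125))
            (+≥0 (*≥0 (ℚP.<⇒≤ (ℚP.positive⁻¹ (+ 1 / 25))) (*≥0 (≤⇒0≤ 24W≤25w) 0≤V))
              (*≥0 (ℚP.<⇒≤ (ℚP.positive⁻¹ (+ 24 / 25))) (ℚP.<⇒≤ (<⇒0< lt))))) (e′ w W V)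
            where
            e′ : ∀ w W V → (+ 1 / 125) + ((+ 1 / 25) * ((fromℕ 25 * w - fromℕ 24 * W) * V) +
                           (+ 24 / 25) * (W * V - (+ 21 / 20))) ≡ w * V - 1ℚ
            e′ = solve-∀ ℚ-ring

        enough-phases : ∃ λ m → Below χ (fromℕ m) × N * ((1ℚ - p) ^ m + p ^ k) * C < fromℕ 3
        enough-phases = finish (floor-below χ 0<ε 0∈χ)
          where
          finish : (∃ λ m → Below χ (fromℕ m) × ¬ Below χ (fromℕ (suc m) + ε)) →
                   ∃ λ m → Below χ (fromℕ m) × N * ((1ℚ - p) ^ m + p ^ k) * C < fromℕ 3
          finish (m , m∈ , ∉) = m , m∈ , subst (_< fromℕ 3) (regroup C N (p ^ k) ((1ℚ - p) ^ m))
            (total (W * p ^ k) (W * (1ℚ - p) ^ m) (*≥0 (ℚP.<⇒≤ 0<W) (^≥0 m 0≤1-p)) Wp^k≤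
              (subst (_≤ (+ 21 / 20)) (last W (1ℚ - p) ((1ℚ - p) ^ m)) (survivors m ∉)))

  choice : ∀ {n k} .{{_ : ℕ.NonZero n}} .{{_ : ℕ.NonZero k}} {c} (D : Bracket c) →
    (+ 9 / 4) ^ k < fromℕ 2 * fromℕ n → fromℕ 3 ≤ lo D → hi D ≤ lo D + (+ 1 / 8) →
    ∀ y (0<y : 0ℝ <ℝ y) → (∀ q → q < lo D * fromℕ n → Below y q) →
    Choice n k c (root k y 0<y *ℝ ln y 0<y)
  choice {n} {k} {c} D n-large 3≤ C≤ y 0<y w⊆ = finish d (enough-phases d 0<y w⊆)
    where
    open Margins {n} {k} n-large 3≤ (lo≤hi D) C≤ hiding (χ)
    χ : ℝ
    χ = root k y 0<y *ℝ ln y 0<y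
    d : Dyadic k w W
    d = dyadic k 1<w (ℚP.<⇒≤ 0<W) 24W≤25w
    finish : (d : Dyadic k w W) →
      (∃ λ m → Below χ (fromℕ m) × N * ((1ℚ - Dyadic.p d) ^ m + Dyadic.p d ^ k) * hi D < fromℕ 3) → Choice n k c χ
    finish d (m , m∈ , small) = record
      { b = Dyadic.b d ; a = Dyadic.a d ; phases = m ; p = Dyadic.p d ; C = hi D
      ; p-eq = Dyadic.p-eq d ; 0<p = Dyadic.0<p d ; p<1 = p<1 d
      ; phases∈ = m∈ ; C∉ = hi∉ D ; small = small }

  precise-bracket : ∀ c → fromℕℝ 3 <ℝ c → ∃ λ (D : Bracket c) → fromℕ 3 ≤ lo D × hi D ≤ lo D + (+ 1 / 8)
  precise-bracket c (q , 3≤q , q∈) =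
    let D , q≤ , _ , C≤ = refine {c} (bracket q∈ (hi∉ (initial c))) (ℚP.positive⁻¹ (+ 1 / 8)) in
    D , ℚP.≤-trans (ℚP.≮⇒≥ 3≤q) q≤ , C≤

  below-cn : ∀ π (D : Bracket (Parameters.c π)) → fromℕ 3 ≤ lo D →
    ∀ q → q < lo D * fromℕ (Parameters.n π) → Below (Parameters.cn π) q
  below-cn π D 3≤ q = below-scaleʳ (Parameters.c π) (fromℕ (Parameters.n π)) {lo D} {q}
    (fromℕ-mono-< (ℕ.>-nonZero⁻¹ (Parameters.n π) {{Parameters.n-nonZero π}}))
    (ℚP.<-≤-trans (fromℕ>0 2) 3≤) (lo∈ D)

  n-large : ∀ π → (+ 9 / 4) ^ Parameters.k π < fromℕ 2 * fromℕ (Parameters.n π)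
  n-large π = k≤ln⇒ (Parameters.n π) (Parameters.k π) {{Parameters.n-nonZero π}} {{Parameters.k-nonZero π}} (Parameters.k≤ln[n] π)

  abstract
    choose : ∀ π → Choice (Parameters.n π) (Parameters.k π) (Parameters.c π)
      (root (Parameters.k π) {{Parameters.k-nonZero π}} (Parameters.cn π) (Parameters.cn>0 π) *ℝ
       ln (Parameters.cn π) (Parameters.cn>0 π))
    choose π = from (precise-bracket (Parameters.c π) (Parameters.3<c π))
      where
      from : (∃ λ (D : Bracket (Parameters.c π)) → fromℕ 3 ≤ lo D × hi D ≤ lo D + (+ 1 / 8)) →
             Choice (Parameters.n π) (Parameters.k π) (Parameters.c π)
               (root (Parameters.k π) {{Parameters.k-nonZero π}} (Parameters.cn π) (Parameters.cn>0 π) *ℝ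
                ln (Parameters.cn π) (Parameters.cn>0 π))
      from (D , 3≤ , C≤) = choice {{Parameters.n-nonZero π}} {{Parameters.k-nonZero π}} D (n-large π) 3≤ C≤
        (Parameters.cn π) (Parameters.cn>0 π) (below-cn π D 3≤)

  -- Counting the outcomes and assembling the result

  ∑Vec-cast : ∀ {q r} (e : q ≡ r) n (f : Vec (Fin r) n → ℕ) →
              ∑Vec q n (λ x → f (map (Fin.cast e) x)) ≡ ∑Vec r n f
  ∑Vec-cast refl n f = ∑Vec-cong λ x → cong f (trans (map-cong (FinP.cast-is-id refl) x) (map-id x))

  complement : ∀ {N} {P : Fin N → Set} → (∀ i → Dec (P i)) → Subset N
  complement P? = tabulate (not ∘ does ∘ P?)

  ∈-complement : ∀ {N} {P : Fin N → Set} (P? : ∀ i → Dec (P i)) {i} → i ∈ complement P? → ¬ P i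
  ∈-complement P? {i} i∈ p with P? i | trans (sym (lookup∘tabulate (not ∘ does ∘ P?) i)) ([]=⇒lookup i∈)
  ... | no ¬p | _ = ¬p p

  ∣complement∣ : ∀ {N} {P : Fin N → Set} (P? : ∀ i → Dec (P i)) →
                 ∣ complement P? ∣ ℕ.+ sum (𝟙 ∘ P?) ≡ N
  ∣complement∣ {zero}  P? = refl
  ∣complement∣ {suc N} P? with P? zero
  ... | no  _ = cong suc (∣complement∣ (P? ∘ suc))
  ... | yes _ = trans (ℕP.+-suc _ _) (cong suc (∣complement∣ (P? ∘ suc)))

  n≤2^⌈log₂n⌉ : ∀ n → n ℕ.≤ 2 ℕ.^ Log.⌈log₂ n ⌉
  n≤2^⌈log₂n⌉ = <-rec _ step
    where
    open ℕP.≤-Reasoning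
    step : ∀ n → (∀ {m} → m ℕ.< n → m ℕ.≤ 2 ℕ.^ Log.⌈log₂ m ⌉) → n ℕ.≤ 2 ℕ.^ Log.⌈log₂ n ⌉
    step 0 _ = ℕ.z≤n
    step 1 _ = ℕP.m^n>0 2 Log.⌈log₂ 1 ⌉
    step n@(suc (suc m)) IH = begin
      n                                       ≡⟨ ℕP.⌊n/2⌋+⌈n/2⌉≡n n ⟨
      ℕ.⌊ n /2⌋ ℕ.+ ℕ.⌈ n /2⌉                 ≤⟨ ℕP.+-monoˡ-≤ ℕ.⌈ n /2⌉ (ℕP.⌊n/2⌋≤⌈n/2⌉ n) ⟩
      ℕ.⌈ n /2⌉ ℕ.+ ℕ.⌈ n /2⌉                 ≤⟨ ℕP.+-mono-≤ half half ⟩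
      H ℕ.+ H                                 ≡⟨ cong (H ℕ.+_) (ℕP.+-identityʳ H) ⟨
      2 ℕ.^ suc (Log.⌈log₂ n ⌉ ℕ.∸ 1)         ≡⟨ cong (2 ℕ.^_) (ℕP.m+[n∸m]≡n (Log.⌈log₂⌉-mono-≤ {2} {n} (ℕ.s≤s (ℕ.s≤s ℕ.z≤n)))) ⟩
      2 ℕ.^ Log.⌈log₂ n ⌉                     ∎
      where
      H = 2 ℕ.^ (Log.⌈log₂ n ⌉ ℕ.∸ 1)
      half : ℕ.⌈ n /2⌉ ℕ.≤ H
      half = subst (λ l → ℕ.⌈ n /2⌉ ℕ.≤ 2 ℕ.^ l) (Log.⌈log₂⌈n/2⌉⌉≡⌈log₂n⌉∸1 n) (IH (ℕP.⌈n/2⌉<n m))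

  /-* : ∀ m d .{{_ : ℕ.NonZero d}} → (+ m / d) * fromℕ d ≡ fromℕ m
  /-* m (suc d) = ℚP.toℚᵘ-injective (ℚᵘP.≃-trans (ℚP.toℚᵘ-homo-* (+ m / suc d) (fromℕ (suc d)))
    (ℚᵘP.≃-trans (ℚᵘP.*-congʳ {ℚ.toℚᵘ (fromℕ (suc d))} (ℚP.toℚᵘ-fromℚᵘ (ℚᵘ.mkℚᵘ (+ m) d)))
                 (ℚᵘ.*≡* (ℤP.*-assoc (+ m) (+ suc d) (+ 1)))))

  module Solution {n k : ℕ} .{{_ : ℕ.NonZero n}} .{{_ : ℕ.NonZero k}} {c χ : ℝ} (choice : Choice n k c χ)
                  (n-large : (+ 9 / 4) ^ k < fromℕ 2 * fromℕ n) where
    open Choice choice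

    B : ℕ
    B = 2 ℕ.^ b

    instance
      B-nonZero : ℕ.NonZero B
      B-nonZero = ℕP.m^n≢0 2 b

    0<B : 0ℚ < fromℕ B
    0<B = fromℕ-mono-< (ℕP.m^n>0 2 b)

    a≤B : a ℕ.≤ B
    a≤B = fromℕ-cancel-≤ (subst₂ _≤_ p-eq (ℚP.*-identityˡ (fromℕ B)) (*-monoˡ-≤⁺ (ℚP.<⇒≤ 0<B) (ℚP.<⇒≤ p<1)))

    -- With `X = 2 ^ ⌈log₂ n⌉`, which is at least 2, a key is below `n (2 + k) ≤ 4 n^2 ≤ X^4`. Hence
    -- four words for a key and eight for a message.
    width : ℕ
    width = 4 ℕ.* Log.⌈log₂ n ⌉

    open Protocol n k width phases b a a≤B public using (decomposer)
    open Protocol n k width phases b a a≤B using (coins-split; module Run)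
    open Algorithm decomposer using (outcomes; rounds)

    -- Bernoulli applied to `(9/4)^k < 2 n`. For `k ≥ 1` it excludes `n = 1`, where a word would
    -- have no bits.
    4+5k<8n : 4 ℕ.+ 5 ℕ.* k ℕ.< 8 ℕ.* n
    4+5k<8n = fromℕ-cancel-< (subst₂ _<_
      (trans (e₁ (fromℕ k)) (sym (trans (fromℕ-+ 4 (5 ℕ.* k)) (cong (_+_ (fromℕ 4)) (fromℕ-* 5 k)))))
      (trans (e₂ (fromℕ n)) (sym (fromℕ-* 8 n)))
      (*-monoʳ-<⁺ (fromℕ>0 3) (ℚP.≤-<-trans (bernoulli k (ℚP.<⇒≤ (ℚP.positive⁻¹ (+ 9 / 4)))) n-large)))
      where
      e₁ : ∀ k → fromℕ 4 * (1ℚ + k * ((+ 9 / 4) - 1ℚ)) ≡ fromℕ 4 + fromℕ 5 * k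
      e₁ = solve-∀ ℚ-ring
      e₂ : ∀ n → fromℕ 4 * (fromℕ 2 * n) ≡ fromℕ 8 * n
      e₂ = solve-∀ ℚ-ring

    wide : n ℕ.* (2 ℕ.+ k) ℕ.≤ 2 ℕ.^ width
    wide = begin
      n ℕ.* (2 ℕ.+ k)          ≤⟨ ℕP.*-monoʳ-≤ n k≤ ⟩
      n ℕ.* (4 ℕ.* n)          ≤⟨ ℕP.*-mono-≤ n≤ (ℕP.*-mono-≤ 4≤ n≤) ⟩
      X ℕ.* ((X ℕ.* X) ℕ.* X)  ≡⟨ e X ⟩
      X ℕ.^ 4                  ≡⟨ ℕP.^-*-assoc 2 L 4 ⟩
      2 ℕ.^ (L ℕ.* 4)          ≡⟨ cong (2 ℕ.^_) (ℕP.*-comm L 4) ⟩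
      2 ℕ.^ width              ∎
      where
      open ℕP.≤-Reasoning
      L = Log.⌈log₂ n ⌉
      X = 2 ℕ.^ L
      n≤ : n ℕ.≤ X
      n≤ = n≤2^⌈log₂n⌉ n
      2≤n : 2 ℕ.≤ n
      2≤n = ℕP.*-cancelˡ-< 8 1 n (ℕP.≤-<-trans
        (ℕP.≤-trans (ℕP.n≤1+n 8) (ℕP.+-monoʳ-≤ 4 (ℕP.*-monoʳ-≤ 5 (ℕ.>-nonZero⁻¹ k)))) 4+5k<8n)
      4≤ : 4 ℕ.≤ X ℕ.* X
      4≤ = ℕP.*-mono-≤ (ℕP.≤-trans 2≤n n≤) (ℕP.≤-trans 2≤n n≤)
      k≤ : 2 ℕ.+ k ℕ.≤ 4 ℕ.* n
      k≤ = ℕP.*-cancelˡ-≤ 2 (begin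
        2 ℕ.* (2 ℕ.+ k)      ≡⟨ ℕP.*-distribˡ-+ 2 2 k ⟩
        4 ℕ.+ 2 ℕ.* k        ≤⟨ ℕP.+-monoʳ-≤ 4 (ℕP.*-monoˡ-≤ k {2} {5} (ℕ.s≤s (ℕ.s≤s ℕ.z≤n))) ⟩
        4 ℕ.+ 5 ℕ.* k        ≤⟨ ℕP.<⇒≤ 4+5k<8n ⟩
        8 ℕ.* n              ≡⟨ ℕP.*-assoc 2 4 n ⟩
        2 ℕ.* (4 ℕ.* n)      ∎)
      e : ∀ x → x ℕ.* ((x ℕ.* x) ℕ.* x) ≡ x ℕ.^ 4
      e x = cong (x ℕ.*_) (trans (ℕP.*-assoc x x x) (cong (λ y → x ℕ.* (x ℕ.* y)) (sym (ℕP.*-identityʳ x))))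

    failure : ℚ
    failure = fromℕ n * ((1ℚ - p) ^ phases + p ^ k)

    0≤failure : 0ℚ ≤ failure
    0≤failure = *≥0 (fromℕ≥0 n) (+≥0 (^≥0 phases (ℚP.<⇒≤ (<⇒0< p<1))) (^≥0 k (ℚP.<⇒≤ 0<p)))

    module _ {G : Graph (Fin n)} (N : PortNumbering G) where
      open PortNumbering N
      open Process n neighbour width k
      open Failure wide B a a≤B using (bound; fails-bound)

      unlabelled : Labels
      unlabelled _ = nothing

      Failing : Fin outcomes → Set
      Failing ω = Fails phases 0 unlabelled (Run.R N ω)

      failing? : ∀ ω → Dec (Failing ω)
      failing? ω = fails? phases 0 unlabelled (Run.R N ω)

      count : ℕ
      count = sum (𝟙 ∘ failing?)

      open Geometric B a a≤B using (rows)

      count-bound : B ℕ.^ (suc k ℕ.+ phases) ℕ.* count ℕ.≤ n ℕ.* (bound phases ℕ.* outcomes)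
      count-bound = subst₂ ℕ._≤_ (cong (B ℕ.^ (suc k ℕ.+ phases) ℕ.*_) (sym count-vec))
        (cong₂ ℕ._*_ (trans (∑-const n 1) (ℕP.*-identityʳ n))
                     (cong (λ q → bound phases ℕ.* q ℕ.^ n) (sym coins-split)))
        (fails-bound phases 0 unlabelled)
        where
        F : Vec (Fin (((2 ℕ.^ b) ℕ.^ suc k) ℕ.^ phases)) n → ℕ
        F x = 𝟙 (fails? phases 0 unlabelled (rows (suc k) phases x))
        count-vec : count ≡ ∑Vec (((2 ℕ.^ b) ℕ.^ suc k) ℕ.^ phases) n F
        count-vec = trans
          (sum-cong-≗ {outcomes} λ ω → cong F (tabulate-∘ (Fin.cast coins-split) (finToFun ω)))
          (trans (∑-finToFun (2 ℕ.^ Algorithm.coins decomposer) n (F ∘ map (Fin.cast coins-split)))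
                 (∑Vec-cast coins-split n F))

      -- Cancelling `B ^ (suc k + phases)` turns `bound` into `(1 - p)^phases + p^k`; the factor `n`
      -- in `failure` is the initial number of survivors.
      count≤ : fromℕ count ≤ failure * fromℕ outcomes
      count≤ = ℚP.*-cancelˡ-≤-pos (β ^ (suc k ℕ.+ phases)) {{ℚ.positive (^>0 (suc k ℕ.+ phases) 0<B)}}
        (subst₂ _≤_
          (trans (fromℕ-* (B ℕ.^ (suc k ℕ.+ phases)) count) (cong (_* fromℕ count) (fromℕ-^ B (suc k ℕ.+ phases))))
          (trans (fromℕ-* n _) (trans (cong (fromℕ n *_)
              (trans (fromℕ-* (bound phases) outcomes) (cong (_* fromℕ outcomes) bound-eq)))
            (e (fromℕ n) (β ^ (suc k ℕ.+ phases)) ((1ℚ - p) ^ phases) (p ^ k) (fromℕ outcomes))))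
          (fromℕ-mono-≤ count-bound))
        where
        β = fromℕ B
        e : ∀ N M S Q O → N * (M * (S + Q) * O) ≡ M * (N * (S + Q) * O)
        e = solve-∀ ℚ-ring
        fail-coin : fromℕ (B ℕ.∸ a) ≡ (1ℚ - p) * β
        fail-coin = trans (trans (e₁ (fromℕ (B ℕ.∸ a)) (fromℕ a))
          (cong₂ _-_ (trans (sym (fromℕ-+ (B ℕ.∸ a) a)) (cong fromℕ (ℕP.m∸n+n≡m a≤B))) (sym p-eq))) (e₂ β p)
          where
          e₁ : ∀ x y → x ≡ (x + y) - y
          e₁ = solve-∀ ℚ-ring
          e₂ : ∀ β p → β - p * β ≡ (1ℚ - p) * β
          e₂ = solve-∀ ℚ-ring
        bound-eq : fromℕ (bound phases) ≡ β ^ (suc k ℕ.+ phases) * ((1ℚ - p) ^ phases + p ^ k)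
        bound-eq = trans (fromℕ-+ ((B ℕ.∸ a) ℕ.^ phases ℕ.* B ℕ.^ suc k) (a ℕ.^ k ℕ.* B ℕ.^ suc phases))
          (trans (cong₂ _+_
            (trans (fromℕ-* ((B ℕ.∸ a) ℕ.^ phases) (B ℕ.^ suc k)) (cong₂ _*_
              (trans (fromℕ-^ (B ℕ.∸ a) phases) (trans (cong (_^ phases) fail-coin) (^-distrib-* (1ℚ - p) β phases)))
              (fromℕ-^ B (suc k))))
            (trans (fromℕ-* (a ℕ.^ k) (B ℕ.^ suc phases)) (cong₂ _*_
              (trans (fromℕ-^ a k) (trans (cong (_^ k) (sym p-eq)) (^-distrib-* p β k)))
              (fromℕ-^ B (suc phases)))))
          (trans (e₃ ((1ℚ - p) ^ phases) (p ^ k) β (β ^ k) (β ^ phases))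
            (cong (_* ((1ℚ - p) ^ phases + p ^ k)) (sym (^-homo-* β (suc k) phases)))))
          where
          e₃ : ∀ S Q β K T → S * T * (β * K) + Q * K * (β * T) ≡ β * K * T * (S + Q)
          e₃ = solve-∀ ℚ-ring

      likely : 1ℚ - failure ≤ (+ ∣ complement failing? ∣ / outcomes) {{Algorithm.outcomes-nonZero decomposer}}
      likely = *-cancelʳ-≤⁺ {1ℚ - failure} 0<O (subst ((1ℚ - failure) * fromℕ outcomes ≤_)
        (sym (/-* ∣ complement failing? ∣ outcomes {{Algorithm.outcomes-nonZero decomposer}}))
        (remaining {failure} total count≤))
        where
        0<O : 0ℚ < fromℕ outcomes
        0<O = fromℕ-mono-< (ℕ.>-nonZero⁻¹ outcomes {{Algorithm.outcomes-nonZero decomposer}})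
        total : fromℕ ∣ complement failing? ∣ + fromℕ count ≡ fromℕ outcomes
        total = trans (sym (fromℕ-+ ∣ complement failing? ∣ count)) (cong fromℕ (∣complement∣ failing?))
        remaining : ∀ {F s x O} → s + x ≡ O → x ≤ F * O → (1ℚ - F) * O ≤ s
        remaining {F} {s} {x} refl x≤ = by≤ (≤⇒0≤ x≤) (e F s x)
          where
          e : ∀ F s x → F * (s + x) - x ≡ s - (1ℚ - F) * (s + x)
          e = solve-∀ ℚ-ring

      correct : (c>0 : 0ℝ <ℝ c) →
        let open Execution decomposer N in
        (∀ ω → MessagesWithin ω 8) ×
        (fromℕℝ rounds ≤ℝ fromℕℝ k *ℝ χ) ×
        Probability≥ outcomes {{Algorithm.outcomes-nonZero decomposer}}
          (λ ω → StrongDecomposition G (label ω) (2 ℕ.* k ℕ.∸ 2) χ)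
          (1ℝ -ℝ fromℕℝ 3 *ℝ recip c c>0)
      correct c>0 =
        (λ ω → Run.messages-short N ω {8} (ℕP.≤-reflexive (sym (ℕP.*-distribʳ-+ Log.⌈log₂ n ⌉ 4 4)))) ,
        scaled≤ k χ phases phases∈ ,
        complement failing? , good ,
        1-3/c≤ c c>0 C∉ 0≤failure small likely
        where
        good : ∀ {ω} → ω ∈ complement failing? →
               StrongDecomposition G (Execution.label decomposer N ω) (2 ℕ.* k ℕ.∸ 2) χ
        good {ω} ω∈ = Decomposition.decomposition N width k phases (Run.R N ω) wide
          (λ t → proj₁ success t ℕ.z≤n) (proj₂ success) (Run.label-labels N ω) {χ} (below⇒≤ {χ} phases∈)
          where
          success = History.succeeds n neighbour width k (Run.R N ω) phases 0 (λ _ → refl) (∈-complement failing? ω∈)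

  module Solve (π : Parameters) =
    Solution {Parameters.n π} {Parameters.k π} {{Parameters.n-nonZero π}} {{Parameters.k-nonZero π}} (choose π) (n-large π)

open Calibration using (module Solve)
open import Data.Fin.Base using (Fin)
open import Data.Nat.Base using (ℕ; _*_; _∸_)
open import Data.Product using (Σ; _×_; _,_)

theorem1 : Σ ℕ λ words →
    Σ ((π : Parameters) → Algorithm (Parameters.n π)) λ algorithm →
    (π : Parameters) →
    let open Parameters π
        open Algorithm (algorithm π)
        χ = root k cn cn>0 *ℝ ln cn cn>0
    in
    (G : Graph (Fin n)) (N : PortNumbering G) →
    let open Execution (algorithm π) N in
      (∀ ω → MessagesWithin ω words) ×
      (fromℕℝ rounds ≤ℝ fromℕℝ k *ℝ χ) ×
      Probability≥ outcomes
        (λ ω → StrongDecomposition G (label ω) (2 * k ∸ 2) χ)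
        (1ℝ -ℝ fromℕℝ 3 *ℝ recip c c>0)
theorem1 = 8 , (λ π → Solve.decomposer π) , λ π G N → Solve.correct π N (Parameters.c>0 π)
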